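{- Let $k\ge 2$ be an integer, let $G$ be an abelian group, and let $S$ be a finite non-empty subset of $G$ such that $S-S$ generates $G$, $S$ is not an arithmetic progression, $kS$ is aperiodic and $|kS|=k|S|-k+1$. Let $H$ be a hyper-atom of $S$, let $S_0$ be an $H$-component of $S$ of smallest cardinality, and let $\phi:G\to G/H$ be the canonical morphism. Then: (a) if $|2S|\neq |G|-1$, then $|H|\ge 2$; (b) $(S\setminus S_0)+H=S\setminus S_0$ and $|kS_0|=k|S_0|-k+1$; (c) either $\phi(S)$ is an arithmetic progression, or $k=2$ and one of the following holds: 1. $S=x-(G\setminus S)$ for some $x\in G$; 2. $(\phi(S)-\phi(S_0))\cap(\phi(S_0)-\phi(S))=\{\phi(0)\}$.
   Context: Notation: $A+B=\{a+b: a\in A,\ b\in B\}$, $A-B=\{a-b: a\in A,\ b\in B\}$, $x-A=\{x-a:a\in A\}$, and $kS=S+\cdots+S$ ($k$ summands). A set $A$ is aperiodic if $\{x\in G: x+A=A\}=\{0\}$. An arithmetic progression is a set of the form $\{a,a+d,\dots,a+(m-1)d\}$ with $m\ge 1$. For a subgroup $H$, an $H$-component of $S$ is a non-empty set of the form $S\cap(x+H)$. Let $S$ be a finite non-empty proper subset of $G$ such that $S-S$ generates $G$ (equivalently, $S$ generates $G$ when $0\in S$). Put $$\kappa_1(S)=\min\{|X+S|-|X| : X\subset G \text{ finite non-empty},\ X+S\neq G\}.$$ A ($1$-)fragment of $S$ is a finite non-empty set $X\subset G$ with $X+S\ne G$ and $|X+S|-|X|=\kappa_1(S)$. (It is known that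 some subgroup of $G$, possibly $\{0\}$, is a $1$-fragment of $S$.) A hyper-atom of $S$ is a maximal element (for inclusion) among the subgroups of $G$ that are $1$-fragments of $S$. -}

module Defs where

open import Algebra.Bundles using (AbelianGroup)
open import Data.Integer.Base as ℤ using (ℤ)
open import Data.List.Base using (List; length)
open import Data.List.Relation.Unary.Unique.Setoid using (Unique)
open import Data.Nat.Base as ℕ using (ℕ; zero; suc)
open import Data.Product.Base using (∃; ∃₂; _×_; _,_)
open import Data.Unit.Polymorphic.Base using (⊤)
open import Level using (_⊔_; Lift) renaming (suc to lsuc)
open import Relation.Binary.PropositionalEquality.Core using (_≡_)
open import Relation.Nullary.Negation.Core using (¬_)
open import Relation.Unary
  using (Pred; Satisfiable; Universal; _∩_; _⊆_; _≐_) renaming (_∈_ to _∈ᵖ_)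

import Algebra.Definitions.RawMonoid
import Algebra.Properties.AbelianGroup
import Data.List.Membership.Setoid
import Relation.Binary.Reasoning.Setoid

module Subsets {c ℓ} (G : AbelianGroup c ℓ) where

  open AbelianGroup G public
    using (Carrier; _≈_; rawMonoid; setoid)
    renaming (_∙_ to _+_; ε to 0#; _⁻¹ to -_)
  open Algebra.Definitions.RawMonoid rawMonoid public
    using () renaming (_×_ to _·_)
  open Data.List.Membership.Setoid setoid using (_∈_)

  infixl 7 _-_
  infixl 6 _⊕_ _⊝_ _+ˢ_ _-ˢ_
  infixr 8 _⋆_

  _-_ : Carrier → Carrier → Carrier
  x - y = x + (- y)

  -- Subsets are not required to respect _≈_. Finite subsets (HasSize) and
  -- subgroups respect it automatically.
  Subset : Set (lsuc (c ⊔ ℓ))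
  Subset = Pred Carrier (c ⊔ ℓ)

  _⊕_ : Subset → Subset → Subset
  (A ⊕ B) x = ∃₂ λ a b → a ∈ᵖ A × b ∈ᵖ B × x ≈ a + b

  _⊝_ : Subset → Subset → Subset
  (A ⊝ B) x = ∃₂ λ a b → a ∈ᵖ A × b ∈ᵖ B × x ≈ a - b

  -- x + A
  _+ˢ_ : Carrier → Subset → Subset
  (x +ˢ A) y = ∃ λ a → a ∈ᵖ A × y ≈ x + a

  -- x - A
  _-ˢ_ : Carrier → Subset → Subset
  (x -ˢ A) y = ∃ λ a → a ∈ᵖ A × y ≈ x - a

  -- A + ⋯ + A with k summands
  _⋆_ : ℕ → Subset → Subset
  (zero  ⋆ A) x = Lift c (x ≈ 0#)
  (suc k ⋆ A)   = A ⊕ (k ⋆ A)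

  -- A is finite and |A| = n.
  HasSize : Subset → ℕ → Set (c ⊔ ℓ)
  HasSize A n = ∃ λ (xs : List Carrier) →
    Unique setoid xs × length xs ≡ n × A ≐ (_∈ xs)

  whole : Subset
  whole _ = ⊤

  Aperiodic : Subset → Set (c ⊔ ℓ)
  Aperiodic A = (λ x → (x +ˢ A) ≐ A) ≐ (_≈ 0#)

  IsArithmeticProgression : Subset → Set (c ⊔ ℓ)
  IsArithmeticProgression A = ∃₂ λ a d → ∃ λ m → 1 ℕ.≤ m ×
    A ≐ (λ x → ∃ λ i → i ℕ.< m × x ≈ a + (i · d))

  data ⟨_⟩ (A : Subset) : Subset where
    gen   : ∀ {x} → x ∈ᵖ A → x ∈ᵖ ⟨ A ⟩
    ⟨0⟩   : 0# ∈ᵖ ⟨ A ⟩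
    _⟨+⟩_ : ∀ {x y} → x ∈ᵖ ⟨ A ⟩ → y ∈ᵖ ⟨ A ⟩ → (x + y) ∈ᵖ ⟨ A ⟩
    ⟨-⟩_  : ∀ {x} → x ∈ᵖ ⟨ A ⟩ → (- x) ∈ᵖ ⟨ A ⟩
    ⟨≈⟩   : ∀ {x y} → x ≈ y → x ∈ᵖ ⟨ A ⟩ → y ∈ᵖ ⟨ A ⟩

  Generates : Subset → Set (c ⊔ ℓ)
  Generates A = Universal ⟨ A ⟩

  record IsSubgroup (H : Subset) : Set (c ⊔ ℓ) where
    field
      resp       : ∀ {x y} → x ≈ y → x ∈ᵖ H → y ∈ᵖ H
      0-mem      : 0# ∈ᵖ H
      +-closed   : ∀ {x y} → x ∈ᵖ H → y ∈ᵖ H → (x + y) ∈ᵖ H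
      neg-closed : ∀ {x} → x ∈ᵖ H → (- x) ∈ᵖ H

  IsComponent : Subset → Subset → Subset → Set (c ⊔ ℓ)
  IsComponent H S T = Satisfiable T × ∃ λ x → T ≐ (S ∩ (x +ˢ H))

  IsSmallestComponent : Subset → Subset → Subset → Set (lsuc (c ⊔ ℓ))
  IsSmallestComponent H S T = IsComponent H S T × ∃ λ m → HasSize T m ×
    (∀ T′ m′ → IsComponent H S T′ → HasSize T′ m′ → m ℕ.≤ m′)

  -- X is one of the sets over which κ₁(S) is the minimum, and
  -- |X + S| - |X| = z.
  Contributes : Subset → Subset → ℤ → Set (c ⊔ ℓ)
  Contributes S X z = Satisfiable X × ¬ Universal (X ⊕ S) ×
    ∃₂ λ m n → HasSize X m × HasSize (X ⊕ S) n × z ≡ n ℤ.⊖ m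

  -- κ₁(S) = z
  Isκ₁ : Subset → ℤ → Set (lsuc (c ⊔ ℓ))
  Isκ₁ S z = (∃ λ X → Contributes S X z) ×
    (∀ X z′ → Contributes S X z′ → z ℤ.≤ z′)

  IsFragment : Subset → Subset → Set (lsuc (c ⊔ ℓ))
  IsFragment S X = ∃ λ z → Isκ₁ S z × Contributes S X z

  record IsHyperAtom (S H : Subset) : Set (lsuc (c ⊔ ℓ)) where
    field
      isSubgroup : IsSubgroup H
      isFragment : IsFragment S H
      maximal    : ∀ K → IsSubgroup K → IsFragment S K → H ⊆ K → K ⊆ H

-- G/H has the carrier of G, with equality x - y ∈ H.
module Quotient {c ℓ} (G : AbelianGroup c ℓ)
                (H : Subsets.Subset G) (isSubgroup : Subsets.IsSubgroup G H) where

  private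
    module G = AbelianGroup G
    module GP = Algebra.Properties.AbelianGroup G
  open Subsets G using (Carrier; _≈_; _+_; 0#; -_; _-_; Subset)
  open Subsets.IsSubgroup isSubgroup
  open Relation.Binary.Reasoning.Setoid G.setoid

  _≈ᴴ_ : Carrier → Carrier → Set (c ⊔ ℓ)
  x ≈ᴴ y = (x - y) ∈ᵖ H

  private
    neg-diff : ∀ x y → - (x - y) ≈ y - x
    neg-diff x y = begin
      - (x - y)      ≈⟨ GP.⁻¹-∙-comm x (- y) ⟨
      - x + (- - y)  ≈⟨ G.∙-congˡ (GP.⁻¹-involutive y) ⟩
      - x + y        ≈⟨ G.comm (- x) y ⟩
      y - x          ∎

    telescope : ∀ x y z → (x - y) + (y - z) ≈ x - z
    telescope x y z = begin
      (x - y) + (y - z)    ≈⟨ G.assoc x (- y) (y - z) ⟩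
      x + (- y + (y - z))  ≈⟨ G.∙-congˡ (GP.\\-leftDividesʳ y (- z)) ⟩
      x - z                ∎

    sum-diff : ∀ x y u v → (x - y) + (u - v) ≈ (x + u) - (y + v)
    sum-diff x y u v = begin
      (x - y) + (u - v)        ≈⟨ G.assoc x (- y) (u - v) ⟩
      x + (- y + (u - v))      ≈⟨ G.∙-congˡ (G.assoc (- y) u (- v)) ⟨
      x + ((- y + u) - v)      ≈⟨ G.∙-congˡ (G.∙-congʳ (G.comm (- y) u)) ⟩
      x + ((u - y) - v)        ≈⟨ G.∙-congˡ (G.assoc u (- y) (- v)) ⟩
      x + (u + (- y + - v))    ≈⟨ G.assoc x u (- y + - v) ⟨
      (x + u) + (- y + - v)    ≈⟨ G.∙-congˡ (GP.⁻¹-∙-comm y v) ⟩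
      (x + u) - (y + v)        ∎

    ≈⇒≈ᴴ : ∀ {x y} → x ≈ y → x ≈ᴴ y
    ≈⇒≈ᴴ {x} {y} x≈y =
      resp (G.sym (G.trans (G.∙-congʳ x≈y) (G.inverseʳ y))) 0-mem

  G/H : AbelianGroup c (c ⊔ ℓ)
  G/H = record
    { Carrier = Carrier
    ; _≈_ = _≈ᴴ_
    ; _∙_ = _+_
    ; ε = 0#
    ; _⁻¹ = -_
    ; isAbelianGroup = record
      { isGroup = record
        { isMonoid = record
          { isSemigroup = record
            { isMagma = record
              { isEquivalence = record
                { refl  = ≈⇒≈ᴴ G.refl
                ; sym   = λ {x} {y} p → resp (neg-diff x y) (neg-closed p)
                ; trans = λ {x} {y} {z} p q → resp (telescope x y z) (+-closed p q)
                }
              ; ∙-cong = λ {x} {y} {u} {v} p q →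
                  resp (sum-diff x y u v) (+-closed p q)
              }
            ; assoc = λ x y z → ≈⇒≈ᴴ (G.assoc x y z)
            }
          ; identity = (λ x → ≈⇒≈ᴴ (G.identityˡ x)) , (λ x → ≈⇒≈ᴴ (G.identityʳ x))
          }
        ; inverse = (λ x → ≈⇒≈ᴴ (G.inverseˡ x)) , (λ x → ≈⇒≈ᴴ (G.inverseʳ x))
        ; ⁻¹-cong = λ {x} {y} p →
            resp (G.sym (GP.⁻¹-∙-comm x (- y))) (neg-closed p)
        }
      ; comm = λ x y → ≈⇒≈ᴴ (G.comm x y)
      }
    }

  φ : Carrier → AbelianGroup.Carrier G/H
  φ x = x

  -- φ(A), saturated with respect to the equality of G/H
  φ[_] : Subset → Subsets.Subset G/H
  φ[ A ] y = ∃ λ a → a ∈ᵖ A × y ≈ᴴ φ a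

-- Let H be the hyper-atom and κ = ∣S + H∣ - ∣H∣ ≤ ∣S∣ - 1. As S misses at most ∣H∣ - 1 elements of
-- S + H, the sum of two H-components of S is a full coset unless both are smallest components.
-- If H ≠ 0 and kS is aperiodic, then kS₀ is the only incomplete coset of kS, so that
-- ∣kS∣ = ∣kS + H∣ - ∣H∣ + ∣kS₀∣. Here ∣kS + H∣ ≥ kκ + ∣H∣ by the isoperimetric inequality,
-- ∣kS₀∣ ≥ k∣S₀∣ - k + 1 by Kneser's theorem (which follows by induction from the same
-- decomposition), and κ ≥ ∣S∣ - ∣S₀∣, so all three are equalities. This is (b).
--
-- Parts (a) and (c) come from a theorem of Vosper type, applied to S if H = 0 and to φ(S) if k ≥ 3:
-- a generating set T with ∣2T∣ = 2∣T∣ - 1 ≤ ∣G∣ - 2 and ∣K + T∣ ≥ ∣K∣ + ∣T∣ for all finite subgroups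
-- K ≠ 0 with K + T ≠ G is an arithmetic progression. Take a 2-atom B of T, that is, a smallest
-- minimiser of ∣X + T∣ - ∣X∣ among the X with ∣X∣ ≥ 2 and ∣G ∖ (X + T)∣ ≥ 2. By submodularity B is a
-- coset of a subgroup, which is excluded, or a Sidon set: it meets each of its other translates in
-- at most one element. If ∣B∣ = 2, then T is a progression. If ∣B∣ ≥ 3, a 2-atom C of B is again a
-- Sidon set, and counting translates shows that ∣B + C∣ > ∣B∣ + ∣C∣ - 1.

module Submission where

-- `G` may be infinite, so sizes of complements are avoided: a bound such as `∣X + S∣ ≤ ∣G∣ - r`
-- becomes a list of `r` missed elements, and the ambient group is listed and counted only when
-- fewer are missed. Differences of cardinalities are moved across inequalities in ℕ.
--
-- The isoperimetric inequality says nothing about a step `jS + H` to `(j+1)S + H` that ends at all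
-- of `G`, as the last one may. There the bound comes from the incomplete coset of `kS`: its
-- elements have only summands from `S₀`, so for `y` in it `(k-1)S + H` and `y - (S + H)` share at
-- most one coset of `H`.
--
-- The alternatives in (c) reflect the second missed element that the Vosper type theorem needs. If
-- `H` is nonzero and `k ≥ 3`, it is found in `3φ(S)`, since `∣3φ(S)∣ ≥ ∣2φ(S)∣ + ∣φ(S)∣ - 1`; for
-- `k = 2` there is no such supply, and uniqueness of the representation of `2φ(S₀)` gives
-- alternative 2. If `H` is zero, a second missed element would make `S` a progression, so `G` is
-- `2S` and one more point `y₀`. Then `S` and `y₀ - S` fill `G`, which is alternative 1, and
-- `3S = G` forces `k = 2`.

open import Defs
open import Algebra.Bundles using (AbelianGroup)
open import Axiom.ExcludedMiddle using (ExcludedMiddle)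
open import Data.Bool.Base using (Bool; true; _∧_; T)
open import Data.Empty using (⊥; ⊥-elim)
open import Data.Fin.Base as Fin using (Fin; zero; suc)
open import Data.Fin.Properties using (injective⇒≤)
open import Data.Integer.Base as ℤ using (ℤ)
open import Data.List.Base as List
  using (List; []; _∷_; _++_; length; filter; map; deduplicate; cartesianProductWith)
open import Data.List.Relation.Unary.All as All using (All; []; _∷_)
open import Data.List.Relation.Unary.All.Properties using (All¬⇒¬Any)
open import Data.List.Relation.Unary.AllPairs using ([]; _∷_)
open import Data.List.Relation.Unary.Any as Any using (here; there; index)
open import Data.List.Relation.Unary.Unique.Setoid using (Unique)
open import Data.Nat.Base as ℕ using (ℕ; zero; suc; s≤s; z≤n)
open import Data.Product.Base using (∃; ∃₂; _×_; _,_; proj₁; proj₂)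
open import Data.Sum.Base using (_⊎_; inj₁; inj₂; [_,_]′; map₂)
open import Data.Unit.Base using (tt)
open import Data.Vec.Base as Vec using (Vec; []; _∷_; allFin)
open import Data.Vec.N-ary using (N-ary; Eq; ∀ⁿ; curryⁿ; _$ⁿ_; curryⁿ-cong; uncurry-∀ⁿ; left-inverse)
open import Function.Base using (_∘_; id)
open import Function.Bundles using (Equivalence)
open import Level using (_⊔_; lift) renaming (suc to lsuc)
open import Relation.Binary.Bundles using (Setoid; DecSetoid)
open import Relation.Binary.Definitions using (_Respects_)
open import Relation.Binary.PropositionalEquality as ≡ using (_≡_; refl)
open import Relation.Nullary using (¬_; Dec; yes; no)
open import Relation.Nullary.Decidable using (decidable-stable)
open import Relation.Unary using (Pred; _≐_; ∁) renaming (_∩_ to _∩ᵖ_; _∖_ to _∖ᵖ_)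

import Algebra.Properties.AbelianGroup
import Algebra.Properties.CommutativeSemigroup
import Algebra.Properties.Monoid.Mult
import Data.Integer.Properties as ℤₚ
import Data.List.Membership.Setoid
import Data.List.Membership.Setoid.Properties as Mem
import Data.List.Properties as Listₚ
import Data.List.Relation.Binary.Subset.Setoid
import Data.List.Relation.Unary.Unique.DecSetoid.Properties as DecUniqueₚ
import Data.List.Relation.Unary.Unique.Setoid.Properties as Uniqueₚ
import Data.Nat.Properties as ℕₚ
import Relation.Binary.Reasoning.Setoid

-- Linear consequences over ℕ, certified by Farkas' lemma: the sum of the hypotheses, with
-- the goal moved to the other side, has to be dominated coefficient by coefficient.
module LinearArithmetic where

  open Algebra.Properties.CommutativeSemigroup ℕₚ.+-commutativeSemigroup using (interchange)

  infixl 7 _:+_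
  infix 6 _:≤_
  infix 3 _⊢_

  data Term (n : ℕ) : Set where
    var  : Fin n → Term n
    con  : ℕ → Term n
    _:+_ : Term n → Term n → Term n

  Inequality : ℕ → Set
  Inequality n = Term n × Term n

  _:≤_ : ∀ {n} → Term n → Term n → Inequality n
  _:≤_ = _,_

  ⟦_⟧ : ∀ {n} → Term n → Vec ℕ n → ℕ
  ⟦ var i ⟧  ρ = Vec.lookup ρ i
  ⟦ con k ⟧  ρ = k
  ⟦ s :+ t ⟧ ρ = ⟦ s ⟧ ρ ℕ.+ ⟦ t ⟧ ρ

  Holds : ∀ {n} → Inequality n → Vec ℕ n → Set
  Holds (s , t) ρ = ⟦ s ⟧ ρ ℕ.≤ ⟦ t ⟧ ρ

  _⊢_ : ∀ {n} → List (Inequality n) → Inequality n → Vec ℕ n → Set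
  ([] ⊢ g)     ρ = Holds g ρ
  (h ∷ hs ⊢ g) ρ = Holds h ρ → (hs ⊢ g) ρ

  private
    -- The constant coefficient comes first.
    coefficients : ∀ {n} → Term n → Vec ℕ (suc n)
    coefficients (var i)  = 0 ∷ Vec.updateAt (Vec.replicate _ 0) i (λ _ → 1)
    coefficients (con k)  = k ∷ Vec.replicate _ 0
    coefficients (s :+ t) = Vec.zipWith ℕ._+_ (coefficients s) (coefficients t)

    dot : ∀ {n} → Vec ℕ n → Vec ℕ n → ℕ
    dot []       []      = 0
    dot (k ∷ ks) (x ∷ ρ) = k ℕ.* x ℕ.+ dot ks ρ

    dot-zeros : ∀ {n} (ρ : Vec ℕ n) → dot (Vec.replicate n 0) ρ ≡ 0
    dot-zeros []      = refl
    dot-zeros (x ∷ ρ) = dot-zeros ρ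

    dot-unit : ∀ {n} (i : Fin n) ρ → dot (Vec.updateAt (Vec.replicate n 0) i (λ _ → 1)) ρ ≡ Vec.lookup ρ i
    dot-unit zero    (x ∷ ρ) = ≡.trans (≡.cong₂ ℕ._+_ (ℕₚ.*-identityˡ x) (dot-zeros ρ)) (ℕₚ.+-identityʳ x)
    dot-unit (suc i) (x ∷ ρ) = dot-unit i ρ

    dot-+ : ∀ {n} (u v ρ : Vec ℕ n) → dot (Vec.zipWith ℕ._+_ u v) ρ ≡ dot u ρ ℕ.+ dot v ρ
    dot-+ []      []      []      = refl
    dot-+ (k ∷ u) (l ∷ v) (x ∷ ρ) = ≡.trans
      (≡.cong₂ ℕ._+_ (ℕₚ.*-distribʳ-+ x k l) (dot-+ u v ρ)) (interchange (k ℕ.* x) (l ℕ.* x) _ _)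

    sound : ∀ {n} (t : Term n) ρ → dot (coefficients t) (1 ∷ ρ) ≡ ⟦ t ⟧ ρ
    sound (var i)  ρ = dot-unit i ρ
    sound (con k)  ρ = ≡.trans (≡.cong₂ ℕ._+_ (ℕₚ.*-identityʳ k) (dot-zeros ρ)) (ℕₚ.+-identityʳ k)
    sound (s :+ t) ρ = ≡.trans (dot-+ (coefficients s) (coefficients t) (1 ∷ ρ))
        (≡.cong₂ ℕ._+_ (sound s ρ) (sound t ρ))

    _≤ⱽ_ : ∀ {n} → Vec ℕ n → Vec ℕ n → Bool
    []      ≤ⱽ []      = true
    (k ∷ u) ≤ⱽ (l ∷ v) = (k ℕ.≤ᵇ l) ∧ (u ≤ⱽ v)

    dot-mono : ∀ {n} (u v ρ : Vec ℕ n) → T (u ≤ⱽ v) → dot u ρ ℕ.≤ dot v ρ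
    dot-mono []      []      []      _ = z≤n
    dot-mono (k ∷ u) (l ∷ v) (x ∷ ρ) t with k ℕ.≤ᵇ l in eq
    ... | true = ℕₚ.+-mono-≤ (ℕₚ.*-monoˡ-≤ x (ℕₚ.≤ᵇ⇒≤ k l (≡.subst T (≡.sym eq) tt))) (dot-mono u v ρ t)

    totalˡ totalʳ : ∀ {n} → List (Inequality n) → Term n
    totalˡ = List.foldr (_:+_ ∘ proj₁) (con 0)
    totalʳ = List.foldr (_:+_ ∘ proj₂) (con 0)

    certificate : ∀ {n} → List (Inequality n) → Inequality n → Bool
    certificate hs (a , b) = coefficients (a :+ totalʳ hs) ≤ⱽ coefficients (b :+ totalˡ hs)

    conclude : ∀ {n} (hs : List (Inequality n)) (g : Inequality n) ρ →
               (Holds (totalˡ hs , totalʳ hs) ρ → Holds g ρ) → (hs ⊢ g) ρ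
    conclude []       g ρ f = f z≤n
    conclude (h ∷ hs) g ρ f p = conclude hs g ρ (f ∘ ℕₚ.+-mono-≤ p)

    farkas : ∀ {n} (hs : List (Inequality n)) (g : Inequality n) → T (certificate hs g) → ∀ ρ → (hs ⊢ g) ρ
    farkas hs g@(a , b) cert ρ = conclude hs g ρ λ l≤r → ℕₚ.+-cancelʳ-≤ (⟦ totalʳ hs ⟧ ρ) _ _ (begin
      ⟦ a :+ totalʳ hs ⟧ ρ                           ≡⟨ sound (a :+ totalʳ hs) ρ ⟨
      dot (coefficients (a :+ totalʳ hs)) (1 ∷ ρ)    ≤⟨ dot-mono (coefficients (a :+ totalʳ hs))
          (coefficients (b :+ totalˡ hs)) (1 ∷ ρ) cert ⟩
      dot (coefficients (b :+ totalˡ hs)) (1 ∷ ρ)    ≡⟨ sound (b :+ totalˡ hs) ρ ⟩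
      ⟦ b ⟧ ρ ℕ.+ ⟦ totalˡ hs ⟧ ρ                    ≤⟨ ℕₚ.+-monoʳ-≤ (⟦ b ⟧ ρ) l≤r ⟩
      ⟦ b ⟧ ρ ℕ.+ ⟦ totalʳ hs ⟧ ρ                    ∎)
      where open ℕₚ.≤-Reasoning

    Problem : ℕ → Set
    Problem n = List (Inequality n) × Inequality n

    close : ∀ n → N-ary n (Term n) (Problem n) → Problem n
    close n f = f $ⁿ Vec.map var (allFin n)

  infix 3 _⊩_
  _⊩_ : ∀ {n} → List (Inequality n) → Inequality n → List (Inequality n) × Inequality n
  _⊩_ = _,_

  abstract
    -- Every hypothesis enters the sum once, so one that is needed twice is listed twice in the
    -- call. The certificate computes to the unit type, hence the argument `_` of each call.
    linarith : ∀ n (f : N-ary n (Term n) (Problem n)) → let hs , g = close n f in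
               T (certificate hs g) → ∀ⁿ n (curryⁿ (hs ⊢ g))
    linarith n f cert = let hs , g = close n f in
      Equivalence.from (uncurry-∀ⁿ n) λ ρ →
        ≡.subst id (≡.sym (left-inverse (hs ⊢ g) ρ)) (farkas hs g cert ρ)

  1≰0 : 1 ℕ.≤ 0 → ⊥
  1≰0 ()

open LinearArithmetic using (con; _:+_; _:≤_; _⊩_; linarith; 1≰0)

-- Equations in abelian groups, decided by comparing linear forms.

module AbelianGroupSolver {c ℓ} (G : AbelianGroup c ℓ) where
  private module G = AbelianGroup G
  open Subsets G using (Carrier; _≈_; _+_; 0#; -_; _·_)
  open Algebra.Properties.AbelianGroup G
  open Algebra.Properties.CommutativeSemigroup G.commutativeSemigroup using (interchange)
  open Algebra.Properties.Monoid.Mult G.monoid using (×-homo-+)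
  open Relation.Binary.Reasoning.Setoid G.setoid

  infixl 6 _⊕_ _⊖_
  infix 8 ⊝_
  infix 4 _⊜_

  data Expr (n : ℕ) : Set where
    var : Fin n → Expr n
    𝟘   : Expr n
    _⊕_ : Expr n → Expr n → Expr n
    ⊝_  : Expr n → Expr n

  _⊖_ : ∀ {n} → Expr n → Expr n → Expr n
  e ⊖ f = e ⊕ (⊝ f)

  _⊜_ : ∀ {n} → Expr n → Expr n → Expr n × Expr n
  _⊜_ = _,_

  ⟦_⟧ : ∀ {n} → Expr n → Vec Carrier n → Carrier
  ⟦ var i ⟧ ρ = Vec.lookup ρ i
  ⟦ 𝟘 ⟧     ρ = 0#
  ⟦ e ⊕ f ⟧ ρ = ⟦ e ⟧ ρ + ⟦ f ⟧ ρ
  ⟦ ⊝ e ⟧   ρ = - ⟦ e ⟧ ρ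

  private
    _⊞_ : ∀ {n} → Vec ℕ n → Vec ℕ n → Vec ℕ n
    _⊞_ = Vec.zipWith ℕ._+_

    zeros : ∀ {n} → Vec ℕ n
    zeros = Vec.replicate _ 0

    unit : ∀ {n} → Fin n → Vec ℕ n
    unit zero    = 1 ∷ zeros
    unit (suc i) = 0 ∷ unit i

    -- ⟦ e ⟧ is the difference of the linear forms pos e and neg e.
    pos neg : ∀ {n} → Expr n → Vec ℕ n
    pos (var i) = unit i
    pos 𝟘       = zeros
    pos (e ⊕ f) = pos e ⊞ pos f
    pos (⊝ e)   = neg e
    neg (var i) = zeros
    neg 𝟘       = zeros
    neg (e ⊕ f) = neg e ⊞ neg f
    neg (⊝ e)   = pos e

    eval : ∀ {n} → Vec ℕ n → Vec Carrier n → Carrier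
    eval []       []       = 0#
    eval (k ∷ ks) (x ∷ xs) = k · x + eval ks xs

    eval-zeros : ∀ {n} (ρ : Vec Carrier n) → eval zeros ρ ≈ 0#
    eval-zeros []      = G.refl
    eval-zeros (x ∷ ρ) = G.trans (G.identityˡ _) (eval-zeros ρ)

    eval-unit : ∀ {n} (i : Fin n) ρ → eval (unit i) ρ ≈ Vec.lookup ρ i
    eval-unit zero    (x ∷ ρ) =
      G.trans (G.∙-cong (G.identityʳ x) (eval-zeros ρ)) (G.identityʳ x)
    eval-unit (suc i) (x ∷ ρ) = G.trans (G.identityˡ _) (eval-unit i ρ)

    eval-⊞ : ∀ {n} (u v : Vec ℕ n) ρ → eval (u ⊞ v) ρ ≈ eval u ρ + eval v ρ
    eval-⊞ []      []      []      = G.sym (G.identityˡ 0#)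
    eval-⊞ (k ∷ u) (l ∷ v) (x ∷ ρ) = begin
      (k ℕ.+ l) · x + eval (u ⊞ v) ρ          ≈⟨ G.∙-cong (×-homo-+ x k l) (eval-⊞ u v ρ) ⟩
      (k · x + l · x) + (eval u ρ + eval v ρ) ≈⟨ interchange _ _ _ _ ⟩
      (k · x + eval u ρ) + (l · x + eval v ρ) ∎

    difference : ∀ {n} (e : Expr n) ρ → ⟦ e ⟧ ρ + eval (neg e) ρ ≈ eval (pos e) ρ
    difference (var i) ρ = begin
      Vec.lookup ρ i + eval zeros ρ ≈⟨ G.∙-cong (G.sym (eval-unit i ρ)) (eval-zeros ρ) ⟩
      eval (unit i) ρ + 0#          ≈⟨ G.identityʳ _ ⟩
      eval (unit i) ρ               ∎
    difference 𝟘 ρ = G.identityˡ _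
    difference (e ⊕ f) ρ = begin
      (⟦ e ⟧ ρ + ⟦ f ⟧ ρ) + eval (neg e ⊞ neg f) ρ            ≈⟨ G.∙-congˡ (eval-⊞ (neg e) (neg f) ρ) ⟩
      (⟦ e ⟧ ρ + ⟦ f ⟧ ρ) + (eval (neg e) ρ + eval (neg f) ρ) ≈⟨ interchange _ _ _ _ ⟩
      (⟦ e ⟧ ρ + eval (neg e) ρ) + (⟦ f ⟧ ρ + eval (neg f) ρ) ≈⟨ G.∙-cong (difference e ρ) (difference f ρ) ⟩
      eval (pos e) ρ + eval (pos f) ρ                         ≈⟨ eval-⊞ (pos e) (pos f) ρ ⟨
      eval (pos e ⊞ pos f) ρ                                  ∎
    difference (⊝ e) ρ = begin
      - ⟦ e ⟧ ρ + eval (pos e) ρ                ≈⟨ G.∙-congˡ (difference e ρ) ⟨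
      - ⟦ e ⟧ ρ + (⟦ e ⟧ ρ + eval (neg e) ρ)    ≈⟨ \\-leftDividesʳ (⟦ e ⟧ ρ) _ ⟩
      eval (neg e) ρ                            ∎

    sound : ∀ {n} (e f : Expr n) → pos e ⊞ neg f ≡ pos f ⊞ neg e →
            ∀ ρ → ⟦ e ⟧ ρ ≈ ⟦ f ⟧ ρ
    sound e f eq ρ = ∙-cancelʳ (eval (neg e) ρ + eval (neg f) ρ) _ _ (begin
      ⟦ e ⟧ ρ + (eval (neg e) ρ + eval (neg f) ρ) ≈⟨ G.assoc _ _ _ ⟨
      ⟦ e ⟧ ρ + eval (neg e) ρ + eval (neg f) ρ   ≈⟨ G.∙-congʳ (difference e ρ) ⟩
      eval (pos e) ρ + eval (neg f) ρ             ≈⟨ eval-⊞ (pos e) (neg f) ρ ⟨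
      eval (pos e ⊞ neg f) ρ                      ≈⟨ G.reflexive (≡.cong (λ v → eval v ρ) eq) ⟩
      eval (pos f ⊞ neg e) ρ                      ≈⟨ eval-⊞ (pos f) (neg e) ρ ⟩
      eval (pos f) ρ + eval (neg e) ρ             ≈⟨ G.∙-congʳ (difference f ρ) ⟨
      ⟦ f ⟧ ρ + eval (neg f) ρ + eval (neg e) ρ   ≈⟨ G.assoc _ _ _ ⟩
      ⟦ f ⟧ ρ + (eval (neg f) ρ + eval (neg e) ρ) ≈⟨ G.∙-congˡ (G.comm _ _) ⟩
      ⟦ f ⟧ ρ + (eval (neg e) ρ + eval (neg f) ρ) ∎)

    close : ∀ {A : Set} n → N-ary n (Expr n) A → A
    close n f = f $ⁿ Vec.map var (allFin n)

  abstract
    -- Signs are kept in two vectors over ℕ, so the side condition compares closed vectors and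
    -- `refl` proves it. Multiples such as `i · d` are passed as variables.
    solve : ∀ n (f : N-ary n (Expr n) (Expr n × Expr n)) →
            let l = proj₁ (close n f) ; r = proj₂ (close n f) in
            pos l ⊞ neg r ≡ pos r ⊞ neg l →
            Eq n _≈_ (curryⁿ ⟦ l ⟧) (curryⁿ ⟦ r ⟧)
    solve n f eq = curryⁿ-cong _≈_ ⟦ proj₁ (close n f) ⟧ ⟦ proj₂ (close n f) ⟧
      (sound (proj₁ (close n f)) (proj₂ (close n f)) eq)

module Classical (em : ∀ {a} → ExcludedMiddle a) where

  abstract
    by-contradiction : ∀ {a} {A : Set a} → (¬ A → ⊥) → A
    by-contradiction = decidable-stable em

    private
      least-below : ∀ {a p} {A : Set a} (P : Pred A p) (f : A → ℕ) n x → P x → f x ℕ.≤ n →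
                    ∃ λ y → P y × (∀ z → P z → f y ℕ.≤ f z)
      least-below P f n x px fx≤n with em {P = ∃ λ z → P z × f z ℕ.< f x}
      ... | no  minimal = x , px , λ z pz → ℕₚ.≮⇒≥ λ fz<fx → minimal (z , pz , fz<fx)
      least-below P f zero    x px fx≤n | yes (z , pz , fz<fx) =
        ⊥-elim (ℕₚ.n≮0 (ℕₚ.<-≤-trans fz<fx fx≤n))
      least-below P f (suc n) x px fx≤n | yes (z , pz , fz<fx) =
        least-below P f n z pz (ℕ.s≤s⁻¹ (ℕₚ.≤-trans fz<fx fx≤n))

    minimum : ∀ {a p} {A : Set a} (P : Pred A p) (f : A → ℕ) → ∃ P →
              ∃ λ y → P y × (∀ z → P z → f y ℕ.≤ f z)
    minimum P f (x , px) = least-below P f (f x) x px ℕₚ.≤-refl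

-- Cardinalities of finite sets.

module FiniteSets (em : ∀ {a} → ExcludedMiddle a) {c ℓ} (G : AbelianGroup c ℓ) where
  open Classical em
  private module G = AbelianGroup G
  open Subsets G using (Carrier; _≈_; setoid; Subset; HasSize)
  open Data.List.Membership.Setoid setoid public using (_∈_; _∉_)
  open Data.List.Relation.Binary.Subset.Setoid setoid public using (_⊆_)

  -- A finite set is a list up to order, repetition and _≈_; ♯ is its cardinality.
  FSet : Set c
  FSet = List Carrier

  Elements : FSet → Subset
  Elements A x = x ∈ A

  private
    decSetoid : DecSetoid c ℓ
    decSetoid = record
      { isDecEquivalence = record { isEquivalence = Setoid.isEquivalence setoid ; _≟_ = λ _ _ → em } }
    open DecSetoid decSetoid using (_≟_)

    length-mono : ∀ {xs ys} → Unique setoid xs → xs ⊆ ys → length xs ℕ.≤ length ys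
    length-mono {xs} {ys} xs! xs⊆ys = injective⇒≤ {f = f} f-injective
      where
      f : Fin (length xs) → Fin (length ys)
      f i = index (xs⊆ys (Mem.∈-lookup setoid xs i))
      lookup-injective : ∀ {zs} → Unique setoid zs → ∀ i j → List.lookup zs i ≈ List.lookup zs j → i ≡ j
      lookup-injective (_ ∷ _)   zero    zero    _  = refl
      lookup-injective (z∉ ∷ _)  zero    (suc j) eq = ⊥-elim
          (All.lookupₛ setoid (λ e ¬e e′ → ¬e (G.trans e′ (G.sym e))) z∉ (Mem.∈-lookup setoid _ j) eq)
      lookup-injective (z∉ ∷ _)  (suc i) zero    eq = ⊥-elim
          (All.lookupₛ setoid (λ e ¬e e′ → ¬e (G.trans e′ (G.sym e))) z∉ (Mem.∈-lookup setoid _ i) (G.sym eq))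
      lookup-injective (_ ∷ zs!) (suc i) (suc j) eq = ≡.cong suc (lookup-injective zs! i j eq)
      f-injective : ∀ {i j} → f i ≡ f j → i ≡ j
      f-injective {i} {j} eq = lookup-injective xs! i j
        (Mem.index-injective setoid (xs⊆ys (Mem.∈-lookup setoid xs i)) (xs⊆ys (Mem.∈-lookup setoid xs j)) eq)

  ∈-resp : ∀ {A : FSet} → (_∈ A) Respects _≈_
  ∈-resp = Mem.∈-resp-≈ setoid

  abstract
    ♯ : FSet → ℕ
    ♯ A = length (deduplicate _≟_ A)

    enumeration : ∀ A → ∃ λ D → Unique setoid D × length D ≡ ♯ A × A ⊆ D × D ⊆ A
    enumeration A = deduplicate _≟_ A , DecUniqueₚ.deduplicate-! decSetoid A , refl ,
      Mem.∈-deduplicate⁺ setoid _≟_ (λ e e′ → G.trans e′ (G.sym e)) , Mem.∈-deduplicate⁻ setoid _≟_ A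

  ♯-mono : ∀ {A B} → A ⊆ B → ♯ A ℕ.≤ ♯ B
  ♯-mono {A} {B} A⊆B with enumeration A | enumeration B
  ... | D , D! , D≡ , _ , D⊆A | E , E! , E≡ , B⊆E , _ =
    ≡.subst₂ ℕ._≤_ D≡ E≡ (length-mono D! (B⊆E ∘ A⊆B ∘ D⊆A))

  ♯-cong : ∀ {A B} → A ⊆ B → B ⊆ A → ♯ A ≡ ♯ B
  ♯-cong A⊆B B⊆A = ℕₚ.≤-antisym (♯-mono A⊆B) (♯-mono B⊆A)

  ♯-unique : ∀ {A} → Unique setoid A → ♯ A ≡ length A
  ♯-unique {A} A! with enumeration A
  ... | D , D! , D≡ , A⊆D , D⊆A =
    ≡.trans (≡.sym D≡) (ℕₚ.≤-antisym (length-mono D! D⊆A) (length-mono A! A⊆D))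

  ¬-resp : ∀ {p} {P : Pred Carrier p} → P Respects _≈_ → ∁ P Respects _≈_
  ¬-resp resp e ¬p p = ¬p (resp (G.sym e) p)

  infixl 6 _∪_
  infixl 7 _∩_ _∖_

  abstract
    restrict : ∀ {p} (P : Pred Carrier p) → FSet → FSet
    restrict P = filter (λ x → em {P = P x})

    _∪_ _∩_ _∖_ : FSet → FSet → FSet
    A ∪ B = A ++ B
    A ∩ B = restrict (_∈ B) A
    A ∖ B = restrict (_∉ B) A

    image : (Carrier → Carrier) → FSet → FSet
    image = map

    ∈-restrict⁺ : ∀ {p} {P : Pred Carrier p} → P Respects _≈_ →
                  ∀ {A x} → x ∈ A → P x → x ∈ restrict P A
    ∈-restrict⁺ resp = Mem.∈-filter⁺ setoid _ resp

    ∈-restrict⁻ : ∀ {p} {P : Pred Carrier p} → P Respects _≈_ →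
                  ∀ {A x} → x ∈ restrict P A → x ∈ A × P x
    ∈-restrict⁻ resp = Mem.∈-filter⁻ setoid _ resp

    ∈-∪ˡ : ∀ {A B x} → x ∈ A → x ∈ A ∪ B
    ∈-∪ˡ = Mem.∈-++⁺ˡ setoid

    ∈-∪ʳ : ∀ {A B x} → x ∈ B → x ∈ A ∪ B
    ∈-∪ʳ {A} = Mem.∈-++⁺ʳ setoid A

    ∈-∪⁻ : ∀ {A B x} → x ∈ A ∪ B → x ∈ A ⊎ x ∈ B
    ∈-∪⁻ {A} = Mem.∈-++⁻ setoid A

    ∈-∩⁺ : ∀ {A B x} → x ∈ A → x ∈ B → x ∈ A ∩ B
    ∈-∩⁺ = ∈-restrict⁺ ∈-resp

    ∈-∩⁻ : ∀ {A B x} → x ∈ A ∩ B → x ∈ A × x ∈ B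
    ∈-∩⁻ = ∈-restrict⁻ ∈-resp

    ∈-∖⁺ : ∀ {A B x} → x ∈ A → x ∉ B → x ∈ A ∖ B
    ∈-∖⁺ = ∈-restrict⁺ (¬-resp ∈-resp)

    ∈-∖⁻ : ∀ {A B x} → x ∈ A ∖ B → x ∈ A × x ∉ B
    ∈-∖⁻ = ∈-restrict⁻ (¬-resp ∈-resp)

    ∈-image⁺ : ∀ {f} → (∀ {x y} → x ≈ y → f x ≈ f y) → ∀ {A x} → x ∈ A → f x ∈ image f A
    ∈-image⁺ cong = Mem.∈-map⁺ setoid setoid cong

    ∈-image⁻ : ∀ {f A y} → y ∈ image f A → ∃ λ x → x ∈ A × y ≈ f x
    ∈-image⁻ = Mem.∈-map⁻ setoid setoid

    private
      ♯-⊎′ : ∀ {A B D E} → Unique setoid D → Unique setoid E → (∀ {x} → x ∈ A → x ∉ B) →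
             A ⊆ D → D ⊆ A → B ⊆ E → E ⊆ B → ♯ (A ∪ B) ≡ length D ℕ.+ length E
      ♯-⊎′ {A} {B} {D} {E} D! E! disj A⊆D D⊆A B⊆E E⊆B = begin
        ♯ (A ++ B)            ≡⟨ ♯-cong (λ x∈ → [ ∈-∪ˡ ∘ A⊆D , ∈-∪ʳ {D} ∘ B⊆E ]′ (∈-∪⁻ {A} x∈))
                                        (λ x∈ → [ ∈-∪ˡ ∘ D⊆A , ∈-∪ʳ {A} ∘ E⊆B ]′ (∈-∪⁻ {D} x∈)) ⟩
        ♯ (D ++ E)            ≡⟨ ♯-unique (Uniqueₚ.++⁺ setoid D! E! λ (x∈D , x∈E) → disj (D⊆A x∈D) (E⊆B x∈E)) ⟩
        length (D ++ E)       ≡⟨ Listₚ.length-++ D ⟩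
        length D ℕ.+ length E ∎
        where open ≡.≡-Reasoning

    ♯-image : ∀ {f} → (∀ {x y} → x ≈ y → f x ≈ f y) → (∀ {x y} → f x ≈ f y → x ≈ y) →
              ∀ A → ♯ (image f A) ≡ ♯ A
    ♯-image {f} cong inj A with enumeration A
    ... | D , D! , D≡ , A⊆D , D⊆A = begin
      ♯ (map f A)       ≡⟨ ♯-cong (transport A⊆D) (transport D⊆A) ⟩
      ♯ (map f D)       ≡⟨ ♯-unique (Uniqueₚ.map⁺ setoid setoid inj D!) ⟩
      length (map f D)  ≡⟨ Listₚ.length-map f D ⟩
      length D          ≡⟨ D≡ ⟩
      ♯ A               ∎
      where
      open ≡.≡-Reasoning
      transport : ∀ {B C} → B ⊆ C → map f B ⊆ map f C
      transport B⊆C y∈ with ∈-image⁻ y∈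
      ... | x , x∈B , y≈fx = ∈-resp (G.sym y≈fx) (∈-image⁺ cong (B⊆C x∈B))

  ∪-least : ∀ {A B C} → A ⊆ C → B ⊆ C → A ∪ B ⊆ C
  ∪-least A⊆C B⊆C x∈ = [ A⊆C , B⊆C ]′ (∈-∪⁻ x∈)

  ♯-⊎ : ∀ {A B} → (∀ {x} → x ∈ A → x ∉ B) → ♯ (A ∪ B) ≡ ♯ A ℕ.+ ♯ B
  ♯-⊎ {A} {B} disj with enumeration A | enumeration B
  ... | D , D! , D≡ , A⊆D , D⊆A | E , E! , E≡ , B⊆E , E⊆B =
    ≡.trans (♯-⊎′ D! E! disj A⊆D D⊆A B⊆E E⊆B) (≡.cong₂ ℕ._+_ D≡ E≡)

  ♯-∪-≤ : ∀ A B → ♯ (A ∪ B) ℕ.≤ ♯ A ℕ.+ ♯ B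
  ♯-∪-≤ A B = begin
    ♯ (A ∪ B)           ≤⟨ ♯-mono (∪-least ∈-∪ˡ split) ⟩
    ♯ (A ∪ (B ∖ A))     ≡⟨ ♯-⊎ (λ x∈A x∈ → proj₂ (∈-∖⁻ x∈) x∈A) ⟩
    ♯ A ℕ.+ ♯ (B ∖ A)   ≤⟨ ℕₚ.+-monoʳ-≤ (♯ A) (♯-mono (proj₁ ∘ ∈-∖⁻)) ⟩
    ♯ A ℕ.+ ♯ B         ∎
    where
    open ℕₚ.≤-Reasoning
    split : B ⊆ A ∪ (B ∖ A)
    split {x} x∈B with em {P = x ∈ A}
    ... | yes x∈A = ∈-∪ˡ x∈A
    ... | no  x∉A = ∈-∪ʳ (∈-∖⁺ x∈B x∉A)

  ♯-restrict : ∀ {p} {P : Pred Carrier p} → P Respects _≈_ → ∀ A →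
               ♯ A ≡ ♯ (restrict P A) ℕ.+ ♯ (restrict (∁ P) A)
  ♯-restrict {P = P} resp A = ≡.trans
    (♯-cong split (∪-least (proj₁ ∘ ∈-restrict⁻ resp) (proj₁ ∘ ∈-restrict⁻ (¬-resp resp))))
    (♯-⊎ λ x∈ x∈′ → proj₂ (∈-restrict⁻ (¬-resp resp) x∈′) (proj₂ (∈-restrict⁻ resp x∈)))
    where
    split : A ⊆ restrict P A ∪ restrict (∁ P) A
    split {x} x∈A with em {P = P x}
    ... | yes p = ∈-∪ˡ (∈-restrict⁺ resp x∈A p)
    ... | no ¬p = ∈-∪ʳ (∈-restrict⁺ (¬-resp resp) x∈A ¬p)

  ♯-∩+∖ : ∀ A B → ♯ A ≡ ♯ (A ∩ B) ℕ.+ ♯ (A ∖ B)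
  ♯-∩+∖ A B = ≡.trans
    (♯-cong split (∪-least (proj₁ ∘ ∈-∩⁻) (proj₁ ∘ ∈-∖⁻)))
    (♯-⊎ λ x∈ x∈′ → proj₂ (∈-∖⁻ x∈′) (proj₂ (∈-∩⁻ x∈)))
    where
    split : A ⊆ A ∩ B ∪ A ∖ B
    split {x} x∈A with em {P = x ∈ B}
    ... | yes p = ∈-∪ˡ (∈-∩⁺ x∈A p)
    ... | no ¬p = ∈-∪ʳ (∈-∖⁺ x∈A ¬p)

  ♯-∪+∩ : ∀ A B → ♯ (A ∪ B) ℕ.+ ♯ (A ∩ B) ≡ ♯ A ℕ.+ ♯ B
  ♯-∪+∩ A B = begin
    ♯ (A ∪ B) ℕ.+ ♯ (A ∩ B)           ≡⟨ ≡.cong (ℕ._+ ♯ (A ∩ B))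
        (♯-cong (∪-least split ∈-∪ʳ) (∪-least (∈-∪ˡ ∘ proj₁ ∘ ∈-∖⁻) ∈-∪ʳ)) ⟩
    ♯ (A ∖ B ∪ B) ℕ.+ ♯ (A ∩ B)       ≡⟨ ≡.cong (ℕ._+ ♯ (A ∩ B)) (♯-⊎ (proj₂ ∘ ∈-∖⁻)) ⟩
    ♯ (A ∖ B) ℕ.+ ♯ B ℕ.+ ♯ (A ∩ B)   ≡⟨ rearrange (♯ (A ∖ B)) (♯ B) (♯ (A ∩ B)) ⟩
    ♯ (A ∩ B) ℕ.+ ♯ (A ∖ B) ℕ.+ ♯ B   ≡⟨ ≡.cong (ℕ._+ ♯ B) (♯-∩+∖ A B) ⟨
    ♯ A ℕ.+ ♯ B                       ∎
    where
    open ≡.≡-Reasoning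
    rearrange : ∀ x y z → x ℕ.+ y ℕ.+ z ≡ z ℕ.+ x ℕ.+ y
    rearrange x y z = ≡.trans (ℕₚ.+-comm (x ℕ.+ y) z) (≡.sym (ℕₚ.+-assoc z x y))
    split : A ⊆ A ∖ B ∪ B
    split {x} x∈A with em {P = x ∈ B}
    ... | yes x∈B = ∈-∪ʳ x∈B
    ... | no  x∉B = ∈-∪ˡ (∈-∖⁺ x∈A x∉B)

  ⊆⇒⊇ : ∀ {A B} → A ⊆ B → ♯ B ℕ.≤ ♯ A → B ⊆ A
  ⊆⇒⊇ {A} {B} A⊆B B≤A {x} x∈B = by-contradiction λ x∉A → ℕₚ.1+n≰n (begin
    suc (♯ A)               ≡⟨ ≡.cong (ℕ._+ ♯ A) (♯-unique {x ∷ []} ([] ∷ [])) ⟨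
    ♯ (x ∷ []) ℕ.+ ♯ A      ≡⟨ ♯-⊎ (λ { (here e) → x∉A ∘ ∈-resp e }) ⟨
    ♯ ((x ∷ []) ∪ A)        ≤⟨ ♯-mono (∪-least (λ { (here e) → ∈-resp (G.sym e) x∈B }) A⊆B) ⟩
    ♯ B                     ≤⟨ B≤A ⟩
    ♯ A                     ∎)
    where open ℕₚ.≤-Reasoning

  ♯-singleton : ∀ x → ♯ (x ∷ []) ≡ 1
  ♯-singleton x = ♯-unique ([] ∷ [])

  ♯-pair : ∀ {x y} → ¬ x ≈ y → ♯ (x ∷ y ∷ []) ≡ 2
  ♯-pair x≉y = ♯-unique ((x≉y ∷ []) ∷ [] ∷ [])

  ♯≥1 : ∀ {A x} → x ∈ A → 1 ℕ.≤ ♯ A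
  ♯≥1 {A} {x} x∈A = ≡.subst (ℕ._≤ ♯ A) (♯-singleton x) (♯-mono λ { (here e) → ∈-resp (G.sym e) x∈A })

  ♯≥2 : ∀ {A x y} → x ∈ A → y ∈ A → ¬ x ≈ y → 2 ℕ.≤ ♯ A
  ♯≥2 {A} x∈A y∈A x≉y = ≡.subst (ℕ._≤ ♯ A) (♯-pair x≉y)
    (♯-mono λ { (here e) → ∈-resp (G.sym e) x∈A ; (there (here e)) → ∈-resp (G.sym e) y∈A })

  ♯<⇒∃∉ : ∀ {A B} → ♯ B ℕ.< ♯ A → ∃ λ x → x ∈ A × x ∉ B
  ♯<⇒∃∉ {A} {B} B<A = by-contradiction λ ¬∃ → ℕₚ.<⇒≱ B<A
    (♯-mono λ {x} x∈A → by-contradiction λ x∉B → ¬∃ (x , x∈A , x∉B))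

  ♯≥1⁻ : ∀ {A} → 1 ℕ.≤ ♯ A → ∃ (_∈ A)
  ♯≥1⁻ {[]} le = ⊥-elim (ℕₚ.1+n≰n (≡.subst (1 ℕ.≤_) (♯-unique []) le))
  ♯≥1⁻ {x ∷ A} le = x , here G.refl

  ♯≥2⁻ : ∀ {A} → 2 ℕ.≤ ♯ A → ∀ x → ∃ λ y → y ∈ A × ¬ y ≈ x
  ♯≥2⁻ le x with ♯<⇒∃∉ {B = x ∷ []} (≡.subst (ℕ._< _) (≡.sym (♯-singleton x)) le)
  ... | y , y∈A , y∉ = y , y∈A , λ e → y∉ (here e)

  pigeonhole : ∀ {A B M} → A ⊆ M → B ⊆ M → ♯ M ℕ.< ♯ A ℕ.+ ♯ B → ∃ λ x → x ∈ A × x ∈ B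
  pigeonhole {A} {B} {M} A⊆M B⊆M lt = by-contradiction λ ¬∃ → ℕₚ.<⇒≱ lt (begin
    ♯ A ℕ.+ ♯ B   ≡⟨ ♯-⊎ (λ {x} x∈A x∈B → ¬∃ (x , x∈A , x∈B)) ⟨
    ♯ (A ∪ B)         ≤⟨ ♯-mono (∪-least A⊆M B⊆M) ⟩
    ♯ M             ∎)
    where open ℕₚ.≤-Reasoning

  hasSize : ∀ {A : FSet} → HasSize (_∈ A) (♯ A)
  hasSize {A = A} with enumeration A
  ... | D , D! , D≡ , A⊆D , D⊆A = D , D! , D≡ , A⊆D , D⊆A

-- Sumsets, translates and reflections.

module Sumsets (em : ∀ {a} → ExcludedMiddle a) {c ℓ} (G : AbelianGroup c ℓ) where
  open Classical em
  open FiniteSets em G public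
  private module G = AbelianGroup G
  open Subsets G using (Carrier; _≈_; _+_; 0#; -_; _-_; setoid; whole; IsSubgroup)
  open AbelianGroupSolver G
  open IsSubgroup

  infixl 7 _⊞_

  abstract
    _⊞_ : FSet → FSet → FSet
    A ⊞ B = cartesianProductWith _+_ A B

    ∈-⊞⁺ : ∀ {A B a b x} → a ∈ A → b ∈ B → x ≈ a + b → x ∈ A ⊞ B
    ∈-⊞⁺ a∈A b∈B x≈ = ∈-resp (G.sym x≈) (Mem.∈-cartesianProductWith⁺ setoid setoid setoid G.∙-cong a∈A b∈B)

    ∈-⊞⁻ : ∀ {A B x} → x ∈ A ⊞ B → ∃₂ λ a b → a ∈ A × b ∈ B × x ≈ a + b
    ∈-⊞⁻ {A} {B} = Mem.∈-cartesianProductWith⁻ setoid setoid setoid _+_ A B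

  ⊞-mono : ∀ {A B C D} → A ⊆ C → B ⊆ D → A ⊞ B ⊆ C ⊞ D
  ⊞-mono A⊆C B⊆D x∈ with ∈-⊞⁻ x∈
  ... | a , b , a∈ , b∈ , x≈ = ∈-⊞⁺ (A⊆C a∈) (B⊆D b∈) x≈

  ⊞-comm : ∀ {A B} → A ⊞ B ⊆ B ⊞ A
  ⊞-comm x∈ with ∈-⊞⁻ x∈
  ... | a , b , a∈ , b∈ , x≈ = ∈-⊞⁺ b∈ a∈ (G.trans x≈ (G.comm a b))

  ♯-⊞-comm : ∀ A B → ♯ (A ⊞ B) ≡ ♯ (B ⊞ A)
  ♯-⊞-comm A B = ♯-cong ⊞-comm ⊞-comm

  ⊞-assoc : ∀ {A B C} → (A ⊞ B) ⊞ C ⊆ A ⊞ (B ⊞ C)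
  ⊞-assoc x∈ with ∈-⊞⁻ x∈
  ... | ab , c , ab∈ , c∈ , x≈ with ∈-⊞⁻ ab∈
  ...   | a , b , a∈ , b∈ , ab≈ =
    ∈-⊞⁺ a∈ (∈-⊞⁺ b∈ c∈ G.refl) (G.trans x≈ (G.trans (G.∙-congʳ ab≈) (G.assoc a b c)))

  ⊞-assoc⁻ : ∀ {A B C} → A ⊞ (B ⊞ C) ⊆ (A ⊞ B) ⊞ C
  ⊞-assoc⁻ x∈ with ∈-⊞⁻ x∈
  ... | a , bc , a∈ , bc∈ , x≈ with ∈-⊞⁻ bc∈
  ...   | b , c , b∈ , c∈ , bc≈ =
    ∈-⊞⁺ (∈-⊞⁺ a∈ b∈ G.refl) c∈ (G.trans x≈ (G.trans (G.∙-congˡ bc≈) (G.sym (G.assoc a b c))))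

  shift reflect : Carrier → FSet → FSet
  shift g   = image (g +_)
  reflect g = image (λ x → g - x)

  ∈-shift⁺ : ∀ {g A x} → x - g ∈ A → x ∈ shift g A
  ∈-shift⁺ {g} {A} {x} x-g∈ =
    ∈-resp (solve 2 (λ g x → g ⊕ (x ⊖ g) ⊜ x) refl g x) (∈-image⁺ G.∙-congˡ x-g∈)

  ∈-shift⁻ : ∀ {g A x} → x ∈ shift g A → x - g ∈ A
  ∈-shift⁻ {g} x∈ with ∈-image⁻ x∈
  ... | a , a∈ , x≈ = ∈-resp
    (G.trans (solve 2 (λ g a → a ⊜ (g ⊕ a) ⊖ g) refl g a) (G.∙-congʳ (G.sym x≈))) a∈

  ∈-reflect⁻ : ∀ {g A x} → x ∈ reflect g A → g - x ∈ A
  ∈-reflect⁻ {g} x∈ with ∈-image⁻ x∈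
  ... | a , a∈ , x≈ = ∈-resp
    (G.trans (solve 2 (λ g a → a ⊜ g ⊖ (g ⊖ a)) refl g a) (G.∙-congˡ (G.⁻¹-cong (G.sym x≈)))) a∈

  ♯-shift : ∀ g A → ♯ (shift g A) ≡ ♯ A
  ♯-shift g = ♯-image G.∙-congˡ λ {x} {y} e →
    G.trans (solve 2 (λ g x → x ⊜ (g ⊕ x) ⊖ g) refl g x)
      (G.trans (G.∙-congʳ e) (solve 2 (λ g y → (g ⊕ y) ⊖ g ⊜ y) refl g y))

  ♯-reflect : ∀ g A → ♯ (reflect g A) ≡ ♯ A
  ♯-reflect g = ♯-image (G.∙-congˡ ∘ G.⁻¹-cong) λ {x} {y} e →
    G.trans (solve 2 (λ g x → x ⊜ g ⊖ (g ⊖ x)) refl g x)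
      (G.trans (G.∙-congˡ (G.⁻¹-cong e)) (solve 2 (λ g y → g ⊖ (g ⊖ y) ⊜ y) refl g y))

  shift-⊞ : ∀ {g A B} → shift g A ⊞ B ⊆ shift g (A ⊞ B)
  shift-⊞ {g} x∈ with ∈-⊞⁻ x∈
  ... | a , b , a∈ , b∈ , x≈ = ∈-shift⁺ (∈-⊞⁺ (∈-shift⁻ a∈) b∈
    (G.trans (G.∙-congʳ x≈) (solve 3 (λ g a b → (a ⊕ b) ⊖ g ⊜ (a ⊖ g) ⊕ b) refl g a b)))

  shift-⊞⁻ : ∀ {g A B} → shift g (A ⊞ B) ⊆ shift g A ⊞ B
  shift-⊞⁻ {g} {x = x} x∈ with ∈-⊞⁻ (∈-shift⁻ x∈)
  ... | a , b , a∈ , b∈ , x-g≈ = ∈-⊞⁺ (∈-image⁺ G.∙-congˡ a∈) b∈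
    (G.trans (solve 2 (λ g x → x ⊜ g ⊕ (x ⊖ g)) refl g x)
      (G.trans (G.∙-congˡ x-g≈) (solve 3 (λ g a b → g ⊕ (a ⊕ b) ⊜ (g ⊕ a) ⊕ b) refl g a b)))

  ♯-shift-⊞ : ∀ g A B → ♯ (shift g A ⊞ B) ≡ ♯ (A ⊞ B)
  ♯-shift-⊞ g A B = ≡.trans (♯-cong shift-⊞ shift-⊞⁻) (♯-shift g (A ⊞ B))

  ♯-≤-⊞ : ∀ {A B b} → b ∈ B → ♯ A ℕ.≤ ♯ (A ⊞ B)
  ♯-≤-⊞ {A} {B} {b} b∈ = ≡.subst (ℕ._≤ _) (♯-shift b A) (♯-mono λ {x} x∈ →
    ∈-⊞⁺ (∈-shift⁻ x∈) b∈ (solve 2 (λ b x → x ⊜ (x ⊖ b) ⊕ b) refl b x))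

  ⊞-∪ : ∀ {A B C} → (A ∪ B) ⊞ C ⊆ A ⊞ C ∪ B ⊞ C
  ⊞-∪ x∈ with ∈-⊞⁻ x∈
  ... | a , b , a∈ , b∈ , x≈ =
    [ (λ a∈A → ∈-∪ˡ (∈-⊞⁺ a∈A b∈ x≈)) , (λ a∈B → ∈-∪ʳ (∈-⊞⁺ a∈B b∈ x≈)) ]′ (∈-∪⁻ a∈)

  infixr 8 _⋆ˢ_

  _⋆ˢ_ : ℕ → FSet → FSet
  zero  ⋆ˢ A = 0# ∷ []
  suc k ⋆ˢ A = A ⊞ k ⋆ˢ A

  ⋆ˢ-mono : ∀ {A B} k → A ⊆ B → k ⋆ˢ A ⊆ k ⋆ˢ B
  ⋆ˢ-mono zero    A⊆B = id
  ⋆ˢ-mono (suc k) A⊆B = ⊞-mono A⊆B (⋆ˢ-mono k A⊆B)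

  0⊞⊆ : ∀ {A} → (0# ∷ []) ⊞ A ⊆ A
  0⊞⊆ x∈ with ∈-⊞⁻ x∈
  ... | _ , a , here o≈ , a∈ , x≈ = ∈-resp (G.sym (G.trans x≈ (G.trans (G.∙-congʳ o≈) (G.identityˡ a)))) a∈

  ⊆0⊞ : ∀ {A} → A ⊆ (0# ∷ []) ⊞ A
  ⊆0⊞ {x = x} x∈ = ∈-⊞⁺ (here G.refl) x∈ (G.sym (G.identityˡ x))

  double⊆⊞ : ∀ {A} → 2 ⋆ˢ A ⊆ A ⊞ A
  double⊆⊞ x∈ with ∈-⊞⁻ x∈
  ... | a , w , a∈ , w∈ , x≈ with ∈-⊞⁻ w∈
  ...   | b , _ , b∈ , here o≈ , w≈ =
    ∈-⊞⁺ a∈ b∈ (G.trans x≈ (G.∙-congˡ (G.trans w≈ (G.trans (G.∙-congˡ o≈) (G.identityʳ b)))))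

  ⊞⊆double : ∀ {A} → A ⊞ A ⊆ 2 ⋆ˢ A
  ⊞⊆double x∈ with ∈-⊞⁻ x∈
  ... | a , b , a∈ , b∈ , x≈ = ∈-⊞⁺ a∈ (∈-⊞⁺ b∈ (here G.refl) (G.sym (G.identityʳ b))) x≈

  ♯-double : ∀ A → ♯ (2 ⋆ˢ A) ≡ ♯ (A ⊞ A)
  ♯-double A = ♯-cong double⊆⊞ ⊞⊆double

  -- Meant for the complement of a sumset in `L`: either it supplies the `r` elements that
  -- admissibility asks for, or it is finite, and then so is `L`.
  finite-or-large : ∀ {p} (P : Pred Carrier p) → P Respects _≈_ → ∀ r →
    (∃ λ Y → r ℕ.≤ ♯ Y × (∀ {y} → y ∈ Y → P y)) ⊎
    (∃ λ Y → ♯ Y ℕ.< r × (∀ {y} → y ∈ Y → P y) × (∀ {y} → P y → y ∈ Y))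
  finite-or-large P resp zero = inj₁ ([] , z≤n , λ ())
  finite-or-large P resp (suc r) with finite-or-large P resp r
  ... | inj₂ (Y , Y<r , Y⊆P , P⊆Y) = inj₂ (Y , ℕₚ.m<n⇒m<1+n Y<r , Y⊆P , P⊆Y)
  ... | inj₁ (Y , r≤Y , Y⊆P) with em {P = ∃ λ x → P x × x ∉ Y}
  ...   | yes (x , px , x∉Y) = inj₁ ((x ∷ []) ∪ Y , size , λ {y} y∈ →
    [ (λ { (here e) → resp (G.sym e) px }) , Y⊆P ]′ (∈-∪⁻ y∈))
    where
    size : suc r ℕ.≤ ♯ ((x ∷ []) ∪ Y)
    size = ≡.subst (suc r ℕ.≤_)
      (≡.sym (≡.trans (♯-⊎ (λ { (here e) → x∉Y ∘ ∈-resp e })) (≡.cong (ℕ._+ ♯ Y) (♯-singleton x)))) (s≤s r≤Y)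
  ...   | no ¬∃ with em {P = suc r ℕ.≤ ♯ Y}
  ...     | yes 1+r≤Y = inj₁ (Y , 1+r≤Y , Y⊆P)
  ...     | no  1+r≰Y = inj₂ (Y , ℕₚ.≰⇒> 1+r≰Y , Y⊆P , λ {y} py →
    by-contradiction λ y∉Y → ¬∃ (y , py , y∉Y))

  Sidon : FSet → Set _
  Sidon A = ∀ g → ¬ g ≈ 0# → ♯ (A ∩ shift g A) ℕ.≤ 1

  whole-subgroup : IsSubgroup whole
  whole-subgroup = record { resp = λ _ x → x ; 0-mem = _ ; +-closed = λ _ _ → _ ; neg-closed = λ _ → _ }

-- Isoperimetry: fragments and atoms of a finite set.

-- The ambient group is a subgroup L, since Kneser's theorem for A and the study of an atom A
-- both take place in the subgroup generated by A.
module Isoperimetry (em : ∀ {a} → ExcludedMiddle a) {c ℓ} (G : AbelianGroup c ℓ)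
  (L : Subsets.Subset G) (isL : Subsets.IsSubgroup G L) where
  open Classical em
  open Sumsets em G
  private module G = AbelianGroup G
  open Subsets G using (Carrier; _≈_; _+_; 0#; -_; _-_; Subset; IsSubgroup)
  open AbelianGroupSolver G
  open IsSubgroup isL

  private
    L-diff : ∀ {x y} → L x → L y → L (x - y)
    L-diff lx ly = +-closed lx (neg-closed ly)

  infix 4 _⊑_
  _⊑_ : FSet → Subset → Set _
  A ⊑ P = ∀ {x} → x ∈ A → P x

  ⊞-⊑ : ∀ {A B} → A ⊑ L → B ⊑ L → A ⊞ B ⊑ L
  ⊞-⊑ A⊑L B⊑L x∈ with ∈-⊞⁻ x∈
  ... | a , b , a∈ , b∈ , x≈ = resp (G.sym x≈) (+-closed (A⊑L a∈) (B⊑L b∈))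

  -- By finiteness `A ⊆ shift g A` is an equality, which gives closure under sums; `0#` lying in
  -- `shift g A` gives negatives.
  subgroup : ∀ {A} → 0# ∈ A → (∀ {g} → g ∈ A → A ⊆ shift g A) → IsSubgroup (_∈ A)
  subgroup {A} 0∈A A⊆shift = record
    { resp       = ∈-resp
    ; 0-mem      = 0∈A
    ; +-closed   = λ {x} {y} x∈ y∈ → ⊆⇒⊇ (A⊆shift x∈) (ℕₚ.≤-reflexive (♯-shift x A))
        (∈-image⁺ G.∙-congˡ y∈)
    ; neg-closed = λ {x} x∈ → ∈-resp (G.identityˡ (- x)) (∈-shift⁻ (A⊆shift x∈ 0∈A))
    }

  module _ {S : FSet} (S⊑L : S ⊑ L) {s₀ : Carrier} (s₀∈S : s₀ ∈ S) where

    -- The complement of `X + S` in `L` may be infinite, so its size is bounded below by a witness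
    -- `Y`. The case `r = 1` yields subgroups, the case `r = 2` the atoms of the Vosper type
    -- theorem.
    record Admissible (r : ℕ) (X : FSet) : Set (c ⊔ ℓ) where
      field
        inside : X ⊑ L
        size   : r ℕ.≤ ♯ X
        cosize : ∃ λ Y → r ℕ.≤ ♯ Y × (∀ {y} → y ∈ Y → L y × y ∉ X ⊞ S)

    open Admissible

    -- The truncated subtraction is exact because `S` contains `s₀`.
    δ : FSet → ℕ
    δ X = ♯ (X ⊞ S) ℕ.∸ ♯ X

    ♯+δ : ∀ X → ♯ X ℕ.+ δ X ≡ ♯ (X ⊞ S)
    ♯+δ X = ℕₚ.m+[n∸m]≡n (♯-≤-⊞ s₀∈S)

    record Atom (r : ℕ) (A : FSet) : Set (c ⊔ ℓ) where
      field
        admissible : Admissible r A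
        δ-minimal  : ∀ X → Admissible r X → δ A ℕ.≤ δ X
        ♯-minimal  : ∀ X → Admissible r X → δ X ℕ.≤ δ A → ♯ A ℕ.≤ ♯ X

    open Atom

    atom-exists : ∀ {r} → ∃ (Admissible r) → ∃ (Atom r)
    atom-exists {r} X with minimum (Admissible r) δ X
    ... | Y , adm , δ-min with minimum (λ Z → Admissible r Z × δ Z ℕ.≤ δ Y) ♯ (Y , adm , ℕₚ.≤-refl)
    ...   | A , (admA , δA≤δY) , ♯-min = A , record
      { admissible = admA
      ; δ-minimal  = λ Z admZ → ℕₚ.≤-trans δA≤δY (δ-min Z admZ)
      ; ♯-minimal  = λ Z admZ δZ≤δA → ♯-min Z (admZ , ℕₚ.≤-trans δZ≤δA δA≤δY)
      }

    submodular : ∀ A F → ♯ ((A ∩ F) ⊞ S) ℕ.+ ♯ ((A ∪ F) ⊞ S) ℕ.≤ ♯ (A ⊞ S) ℕ.+ ♯ (F ⊞ S)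
    submodular A F = begin
      ♯ ((A ∩ F) ⊞ S) ℕ.+ ♯ ((A ∪ F) ⊞ S)             ≤⟨ ℕₚ.+-mono-≤ (♯-mono meet) (♯-mono ⊞-∪) ⟩
      ♯ ((A ⊞ S) ∩ (F ⊞ S)) ℕ.+ ♯ (A ⊞ S ∪ F ⊞ S)     ≡⟨ ℕₚ.+-comm (♯ ((A ⊞ S) ∩ (F ⊞ S))) _ ⟩
      ♯ (A ⊞ S ∪ F ⊞ S) ℕ.+ ♯ ((A ⊞ S) ∩ (F ⊞ S))     ≡⟨ ♯-∪+∩ (A ⊞ S) (F ⊞ S) ⟩
      ♯ (A ⊞ S) ℕ.+ ♯ (F ⊞ S)                         ∎
      where
      open ℕₚ.≤-Reasoning
      meet : (A ∩ F) ⊞ S ⊆ (A ⊞ S) ∩ (F ⊞ S)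
      meet x∈ = ∈-∩⁺ (⊞-mono (proj₁ ∘ ∈-∩⁻) id x∈) (⊞-mono (proj₂ ∘ ∈-∩⁻) id x∈)

    -- The complement of F + S, reflected, is again a fragment of S.
    module _ {r F M} (adm : Admissible r F) (M⊑L : M ⊑ L) (L⊑M : ∀ {x} → L x → x ∈ M) where

      dual : FSet
      dual = reflect 0# (M ∖ (F ⊞ S))

      ♯-dual : ♯ (F ⊞ S) ℕ.+ ♯ dual ≡ ♯ M
      ♯-dual = begin
        ♯ (F ⊞ S) ℕ.+ ♯ dual                          ≡⟨ ≡.cong (♯ (F ⊞ S) ℕ.+_) (♯-reflect 0# _) ⟩
        ♯ (F ⊞ S) ℕ.+ ♯ (M ∖ (F ⊞ S))                 ≡⟨ ≡.cong (ℕ._+ ♯ (M ∖ (F ⊞ S)))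
            (♯-cong (λ x∈ → ∈-∩⁺ (L⊑M (⊞-⊑ (inside adm) S⊑L x∈)) x∈) (proj₂ ∘ ∈-∩⁻)) ⟩
        ♯ (M ∩ (F ⊞ S)) ℕ.+ ♯ (M ∖ (F ⊞ S))           ≡⟨ ♯-∩+∖ M (F ⊞ S) ⟨
        ♯ M                                           ∎
        where open ≡.≡-Reasoning

      private
        ∈-dual⁻ : ∀ {x} → x ∈ dual → L x × 0# - x ∉ F ⊞ S
        ∈-dual⁻ {x} x∈ with ∈-∖⁻ (∈-reflect⁻ x∈)
        ... | -x∈M , -x∉ = resp (solve 1 (λ x → 𝟘 ⊖ (𝟘 ⊖ x) ⊜ x) refl x) (L-diff 0-mem (M⊑L -x∈M)) , -x∉

      dual-disjoint : ∀ {y} → y ∈ reflect 0# F → y ∉ dual ⊞ S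
      dual-disjoint {y} y∈ y∈⊞ with ∈-⊞⁻ y∈⊞
      ... | d , s , d∈ , s∈ , y≈ = proj₂ (∈-dual⁻ d∈) (∈-⊞⁺ (∈-reflect⁻ y∈) s∈
        (G.trans (solve 2 (λ d s → 𝟘 ⊖ d ⊜ (𝟘 ⊖ (d ⊕ s)) ⊕ s) refl d s)
          (G.∙-congʳ (G.∙-congˡ (G.⁻¹-cong (G.sym y≈))))))

      reflect⊑L : reflect 0# F ⊑ L
      reflect⊑L {y} y∈ = resp (solve 1 (λ x → 𝟘 ⊖ (𝟘 ⊖ x) ⊜ x) refl y)
          (L-diff 0-mem (inside adm (∈-reflect⁻ y∈)))

      dual-admissible : Admissible r dual
      dual-admissible = record
        { inside = proj₁ ∘ ∈-dual⁻
        ; size   = ≡.subst (r ℕ.≤_) (≡.sym (♯-reflect 0# _)) (ℕₚ.≤-trans (proj₁ (proj₂ (cosize adm)))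
                     (♯-mono λ y∈ → let ly , y∉ = proj₂ (proj₂ (cosize adm)) y∈ in ∈-∖⁺ (L⊑M ly) y∉))
        ; cosize = reflect 0# F , ≡.subst (r ℕ.≤_) (≡.sym (♯-reflect 0# F)) (size adm) ,
                     λ y∈ → reflect⊑L y∈ , dual-disjoint y∈
        }

      ♯-dual-⊞ : ♯ (dual ⊞ S) ℕ.+ ♯ F ℕ.≤ ♯ M
      ♯-dual-⊞ = begin
        ♯ (dual ⊞ S) ℕ.+ ♯ F                 ≡⟨ ≡.cong (♯ (dual ⊞ S) ℕ.+_) (♯-reflect 0# F) ⟨
        ♯ (dual ⊞ S) ℕ.+ ♯ (reflect 0# F)    ≡⟨ ♯-⊎ (λ y∈⊞ y∈ → dual-disjoint y∈ y∈⊞) ⟨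
        ♯ (dual ⊞ S ∪ reflect 0# F)          ≤⟨ ♯-mono
            (∪-least (L⊑M ∘ ⊞-⊑ (proj₁ ∘ ∈-dual⁻) S⊑L) (L⊑M ∘ reflect⊑L)) ⟩
        ♯ M                                  ∎
        where open ℕₚ.≤-Reasoning

      -- Passing to the dual exchanges two complements in `M`: `∣dual∣ = ∣M∣ - ∣F + S∣` and
      -- `∣dual + S∣ ≤ ∣M∣ - ∣F∣`. The difference of the two is the claim.
      δ-dual : δ dual ℕ.≤ δ F
      δ-dual = arithmetic (♯ F) (♯ dual) (δ F) (δ dual) (♯ M) (♯ (F ⊞ S)) (♯ (dual ⊞ S))
          ♯-dual-⊞ (ℕₚ.≤-reflexive (≡.sym ♯-dual)) (ℕₚ.≤-reflexive (≡.sym (♯+δ F))) (ℕₚ.≤-reflexive (♯+δ dual))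
        where
        arithmetic : ∀ f d x y m fs ds → ds ℕ.+ f ℕ.≤ m → m ℕ.≤ fs ℕ.+ d → fs ℕ.≤ f ℕ.+ x →
            d ℕ.+ y ℕ.≤ ds → y ℕ.≤ x
        arithmetic = linarith 7 (λ f d x y m fs ds →
          ds :+ f :≤ m ∷ m :≤ fs :+ d ∷ fs :≤ f :+ x ∷ d :+ y :≤ ds ∷ [] ⊩ y :≤ x) _

    -- Submodularity forces δ (A ∪ F) < δ A if A ⊄ F, so A ∪ F is not admissible and L is finite;
    -- then ∣A∣ ≤ ∣dual F∣ leaves room for r elements outside A ∪ F + S.
    atom-⊆ : ∀ {r A F} → Atom r A → Admissible r F → δ F ℕ.≤ δ A → r ℕ.≤ ♯ (A ∩ F) → A ⊆ F
    atom-⊆ {r} {A} {F} atom admF δF≤δA r≤A∩F = by-contradiction main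
      where
      admA = admissible atom

      meet-admissible : Admissible r (A ∩ F)
      meet-admissible = record
        { inside = inside admA ∘ proj₁ ∘ ∈-∩⁻
        ; size   = r≤A∩F
        ; cosize = let Y , r≤Y , out = cosize admA in
            Y , r≤Y , λ y∈ → proj₁ (out y∈) , λ y∈⊞ → proj₂ (out y∈) (⊞-mono (proj₁ ∘ ∈-∩⁻) id y∈⊞)
        }

      module _ (A⊄F : ¬ (A ⊆ F)) where

        δ-meet : suc (δ A) ℕ.≤ δ (A ∩ F)
        -- Were `δ` no larger on `A ∩ F`, the minimal cardinality of the atom would force `A ∩ F` to
        -- be all of `A`.
        δ-meet = ℕₚ.≰⇒> λ δ≤ → A⊄F (proj₂ ∘ ∈-∩⁻ ∘ ⊆⇒⊇ (proj₁ ∘ ∈-∩⁻) (♯-minimal atom _ meet-admissible δ≤))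

        δ-join : suc (δ (A ∪ F)) ℕ.≤ δ A
        δ-join = arithmetic (♯ A) (♯ F) (♯ (A ∩ F)) (♯ (A ∪ F)) (δ A) (δ F) (δ (A ∩ F)) (δ (A ∪ F))
            (≡.subst₂ ℕ._≤_ (≡.cong₂ ℕ._+_ (≡.sym (♯+δ (A ∩ F))) (≡.sym (♯+δ (A ∪ F))))
              (≡.cong₂ ℕ._+_ (≡.sym (♯+δ A)) (≡.sym (♯+δ F))) (submodular A F))
            (ℕₚ.≤-reflexive (≡.sym (♯-∪+∩ A F))) δF≤δA δ-meet
          where
          arithmetic : ∀ a f i u x y z w → (i ℕ.+ z) ℕ.+ (u ℕ.+ w) ℕ.≤ a ℕ.+ x ℕ.+ (f ℕ.+ y) →
            a ℕ.+ f ℕ.≤ u ℕ.+ i → y ℕ.≤ x → suc x ℕ.≤ z → suc w ℕ.≤ x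
          arithmetic = linarith 8 (λ a f i u x y z w →
            (i :+ z) :+ (u :+ w) :≤ a :+ x :+ (f :+ y) ∷ a :+ f :≤ u :+ i ∷ y :≤ x ∷ con 1 :+ x :≤ z ∷ []
              ⊩ con 1 :+ w :≤ x) _

        join⊑L : A ∪ F ⊑ L
        join⊑L = [ inside admA , inside admF ]′ ∘ ∈-∪⁻

        Outside : Carrier → Set _
        Outside x = L x × x ∉ (A ∪ F) ⊞ S

        main : ⊥
        main with finite-or-large Outside (λ e (lx , x∉) → resp e lx , ¬-resp ∈-resp e x∉) r
        ... | inj₁ (Y , r≤Y , out) = ℕₚ.<⇒≱ δ-join (δ-minimal atom (A ∪ F) record
          { inside = join⊑L
          ; size   = ℕₚ.≤-trans (size admA) (♯-mono ∈-∪ˡ)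
          ; cosize = Y , r≤Y , out
          })
        ... | inj₂ (Y , Y<r , Y⊑ , ⊑Y) =
          1≰0 (arithmetic (♯ A) (♯ F) (♯ (A ∩ F)) (♯ (A ∪ F)) (δ A) (δ F) (δ (A ∪ F))
              (♯ (dual admF M⊑L L⊑M)) (♯ Y) r
            (♯-minimal atom _ (dual-admissible admF M⊑L L⊑M) (ℕₚ.≤-trans (δ-dual admF M⊑L L⊑M) δF≤δA))
            covers Y<r r≤A∩F (ℕₚ.≤-reflexive (♯-∪+∩ A F))
            δ-join (δ-minimal atom F admF))
          where
          M : FSet
          M = Y ∪ (A ∪ F) ⊞ S
          M⊑L : M ⊑ L
          M⊑L = [ proj₁ ∘ Y⊑ , ⊞-⊑ join⊑L S⊑L ]′ ∘ ∈-∪⁻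
          L⊑M : ∀ {x} → L x → x ∈ M
          L⊑M {x} lx with em {P = x ∈ (A ∪ F) ⊞ S}
          ... | yes x∈ = ∈-∪ʳ x∈
          ... | no  x∉ = ∈-∪ˡ (⊑Y (lx , x∉))
          covers : ♯ F ℕ.+ δ F ℕ.+ ♯ (dual admF M⊑L L⊑M) ℕ.≤ ♯ Y ℕ.+ (♯ (A ∪ F) ℕ.+ δ (A ∪ F))
          covers = ≡.subst₂ ℕ._≤_
            (≡.sym (≡.trans (≡.cong (ℕ._+ ♯ (dual admF M⊑L L⊑M)) (♯+δ F)) (♯-dual admF M⊑L L⊑M)))
            (≡.cong (♯ Y ℕ.+_) (≡.sym (♯+δ (A ∪ F)))) (♯-∪-≤ Y ((A ∪ F) ⊞ S))
          arithmetic : ∀ a f i u x y w d e r → a ℕ.≤ d → f ℕ.+ y ℕ.+ d ℕ.≤ e ℕ.+ (u ℕ.+ w) →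
              suc e ℕ.≤ r → r ℕ.≤ i →
            u ℕ.+ i ℕ.≤ a ℕ.+ f → suc w ℕ.≤ x → x ℕ.≤ y → 1 ℕ.≤ 0
          arithmetic = linarith 10 (λ a f i u x y w d e r →
            a :≤ d ∷ f :+ y :+ d :≤ e :+ (u :+ w) ∷ con 1 :+ e :≤ r ∷ r :≤ i ∷ u :+ i :≤ a :+ f ∷
            con 1 :+ w :≤ x ∷ x :≤ y ∷ [] ⊩ con 1 :≤ con 0) _

    shift-admissible : ∀ {r X g} → L g → Admissible r X → Admissible r (shift g X)
    shift-admissible {r} {X} {g} lg adm = let Y , r≤Y , out = cosize adm in record
      { inside = shift-inside (inside adm)
      ; size   = ≡.subst (r ℕ.≤_) (≡.sym (♯-shift g X)) (size adm)
      ; cosize = shift g Y , ≡.subst (r ℕ.≤_) (≡.sym (♯-shift g Y)) r≤Y , λ y∈ →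
          shift-inside (proj₁ ∘ out) y∈ , λ y∈⊞ → proj₂ (out (∈-shift⁻ y∈)) (∈-shift⁻ (shift-⊞ y∈⊞))
      }
      where
      shift-inside : ∀ {Y} → Y ⊑ L → shift g Y ⊑ L
      shift-inside Y⊑L {y} y∈ = resp (solve 2 (λ g y → g ⊕ (y ⊖ g) ⊜ y) refl g y)
          (+-closed lg (Y⊑L (∈-shift⁻ y∈)))

    δ-shift : ∀ g X → δ (shift g X) ≡ δ X
    δ-shift g X = ≡.cong₂ ℕ._∸_ (♯-shift-⊞ g X S) (♯-shift g X)

    atom-⊆-shift : ∀ {r A g} → Atom r A → L g → r ℕ.≤ ♯ (A ∩ shift g A) → A ⊆ shift g A
    atom-⊆-shift {A = A} {g} atom lg =
      atom-⊆ atom (shift-admissible lg (admissible atom)) (ℕₚ.≤-reflexive (δ-shift g A))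

    atom∋0-exists : ∀ {r} → 1 ℕ.≤ r → ∃ (Admissible r) → ∃ λ A → Atom r A × 0# ∈ A
    atom∋0-exists {r} 1≤r X with atom-exists X
    ... | A , atom with ♯≥1⁻ (ℕₚ.≤-trans 1≤r (size (admissible atom)))
    ...   | a , a∈ = shift (- a) A , record
      { admissible = shift-admissible (neg-closed (inside (admissible atom) a∈)) (admissible atom)
      ; δ-minimal  = λ Z admZ → ≡.subst (ℕ._≤ δ Z) (≡.sym (δ-shift (- a) A)) (δ-minimal atom Z admZ)
      ; ♯-minimal  = λ Z admZ δZ≤ → ≡.subst (ℕ._≤ ♯ Z) (≡.sym (♯-shift (- a) A))
                       (♯-minimal atom Z admZ (≡.subst (δ Z ℕ.≤_) (δ-shift (- a) A) δZ≤))
      } , ∈-shift⁺ (∈-resp (solve 1 (λ a → a ⊜ 𝟘 ⊖ (⊝ a)) refl a) a∈)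

    δ-minimal′ : ∀ {r A X} → Atom r A → Admissible r X → ♯ (A ⊞ S) ℕ.+ ♯ X ℕ.≤ ♯ (X ⊞ S) ℕ.+ ♯ A
    δ-minimal′ {A = A} {X} atom adm = ≡.subst₂ (λ s t → s ℕ.+ ♯ X ℕ.≤ t ℕ.+ ♯ A) (♯+δ A) (♯+δ X)
      (linarith 4 (λ a x d e → d :≤ e ∷ [] ⊩ a :+ d :+ x :≤ x :+ e :+ a) _
        (♯ A) (♯ X) (δ A) (δ X) (δ-minimal atom X adm))

    Misses : FSet → Set _
    Misses X = ∃ λ y → L y × y ∉ X ⊞ S

    private
      1-admissible : ∀ {X x} → X ⊑ L → x ∈ X → Misses X → Admissible 1 X
      1-admissible X⊑L x∈ (y , ly , y∉) = record
        { inside = X⊑L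
        ; size   = ♯≥1 x∈
        ; cosize = y ∷ [] , ♯≥1 {x = y} (here G.refl) ,
            λ { (here e) → resp (G.sym e) ly , y∉ ∘ ∈-resp e }
        }

    -- For `r = 1` one common element suffices, and `g` lies in both `Q` and `shift g Q` because
    -- `0#` is in `Q`.
    atom-translate-⊆ : ∀ {Q} → Atom 1 Q → 0# ∈ Q → ∀ {g} → g ∈ Q → Q ⊆ shift g Q
    atom-translate-⊆ {Q} atom 0∈Q {g} g∈ = atom-⊆-shift atom (inside (admissible atom) g∈)
      (♯≥1 {Q ∩ shift g Q} {g} (∈-∩⁺ g∈ (∈-shift⁺ (∈-resp (G.sym (G.inverseʳ g)) 0∈Q))))

    -- What the later counting keeps of a 1-atom. The field `minimal` is
    -- `∣Q + S∣ - ∣Q∣ ≤ ∣X + S∣ - ∣X∣` without subtraction.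
    record FragmentSubgroup (Q : FSet) : Set (c ⊔ ℓ) where
      field
        isSubgroup : IsSubgroup (_∈ Q)
        within     : Q ⊑ L
        missed     : Misses Q
        minimal    : ∀ {X x} → X ⊑ L → x ∈ X → Misses X → ♯ (Q ⊞ S) ℕ.+ ♯ X ℕ.≤ ♯ (X ⊞ S) ℕ.+ ♯ Q

    atom⇒fragment-subgroup : ∀ {Q} → Atom 1 Q → 0# ∈ Q → FragmentSubgroup Q
    atom⇒fragment-subgroup {Q} atom 0∈Q = record
      { isSubgroup = subgroup 0∈Q (atom-translate-⊆ atom 0∈Q)
      ; within     = inside (admissible atom)
      ; missed     = let Y , 1≤Y , out = cosize (admissible atom) ; y , y∈ = ♯≥1⁻ 1≤Y in y , out y∈
      ; minimal    = λ X⊑L x∈X missed → δ-minimal′ atom (1-admissible X⊑L x∈X missed)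
      }

    fragment-subgroup : ∀ {X x} → X ⊑ L → x ∈ X → Misses X → ∃ FragmentSubgroup
    fragment-subgroup {X} X⊑L x∈X missed =
      let Q , atom , 0∈Q = atom∋0-exists {1} ℕₚ.≤-refl (X , 1-admissible X⊑L x∈X missed) in
      Q , atom⇒fragment-subgroup atom 0∈Q

    -- If `B` shares two elements with `shift g B` for some nonzero `g`, the two sets are equal and
    -- `g` lies in `B`. Then for every `h` in `B` the two elements `h` and `h + g` are common to `B`
    -- and `shift h B`, so `B` is contained in each of these translates and is a subgroup.
    dichotomy : ∀ {B} → Atom 2 B → 0# ∈ B → IsSubgroup (_∈ B) ⊎ Sidon B
    dichotomy {B} atom 0∈B with em {P = ∃ λ g → ¬ g ≈ 0# × 2 ℕ.≤ ♯ (B ∩ shift g B)}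
    ... | no ¬∃ = inj₂ λ g g≉0 → ℕ.s≤s⁻¹ (ℕₚ.≰⇒> λ 2≤ → ¬∃ (g , g≉0 , 2≤))
    ... | yes (g , g≉0 , 2≤) = inj₁ (subgroup 0∈B translate-⊆)
      where
      B⊑L = inside (admissible atom)
      lg : L g
      lg = let x , x∈ = ♯≥1⁻ (ℕₚ.≤-trans (s≤s z≤n) 2≤) ; x∈B , x∈shift = ∈-∩⁻ x∈ in
        resp (solve 2 (λ x g → x ⊖ (x ⊖ g) ⊜ g) refl x g) (L-diff (B⊑L x∈B) (B⊑L (∈-shift⁻ x∈shift)))
      shift⊆B : shift g B ⊆ B
      shift⊆B = ⊆⇒⊇ (atom-⊆-shift atom lg 2≤) (ℕₚ.≤-reflexive (♯-shift g B))
      g∈B : g ∈ B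
      g∈B = shift⊆B (∈-shift⁺ (∈-resp (G.sym (G.inverseʳ g)) 0∈B))
      +g : ∀ {h} → h ∈ B → h + g ∈ B
      +g {h} h∈ = shift⊆B (∈-shift⁺ (∈-resp (solve 2 (λ h g → h ⊜ (h ⊕ g) ⊖ g) refl h g) h∈))
      translate-⊆ : ∀ {h} → h ∈ B → B ⊆ shift h B
      translate-⊆ {h} h∈ = atom-⊆-shift atom (B⊑L h∈) (♯≥2 {B ∩ shift h B} {h} {h + g}
        (∈-∩⁺ h∈ (∈-shift⁺ (∈-resp (G.sym (G.inverseʳ h)) 0∈B)))
        (∈-∩⁺ (+g h∈) (∈-shift⁺ (∈-resp (solve 2 (λ h g → g ⊜ (h ⊕ g) ⊖ h) refl h g) g∈B)))
        λ h≈h+g → g≉0 (G.trans (solve 2 (λ h g → g ⊜ (h ⊕ g) ⊖ h) refl h g)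
          (G.trans (G.∙-congʳ (G.sym h≈h+g)) (G.inverseʳ h))))

    2-atom : ∃ (Admissible 2) → ∃ λ B → Atom 2 B × 0# ∈ B × (IsSubgroup (_∈ B) ⊎ Sidon B)
    2-atom adm = let B , atom , 0∈B = atom∋0-exists (s≤s z≤n) adm in B , atom , 0∈B , dichotomy atom 0∈B

-- Generated subgroups, cosets and Sidon sets.

module Generation (em : ∀ {a} → ExcludedMiddle a) {c ℓ} (G : AbelianGroup c ℓ) where
  open Classical em
  open Sumsets em G
  private module G = AbelianGroup G
  open Subsets G using (_≈_; _+_; 0#; -_; _-_; Subset; IsSubgroup; ⟨_⟩; gen; ⟨0⟩; _⟨+⟩_; ⟨-⟩_; ⟨≈⟩)
  open AbelianGroupSolver G
  open IsSubgroup

  generated-subgroup : ∀ (A : Subset) → IsSubgroup ⟨ A ⟩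
  generated-subgroup A = record { resp = ⟨≈⟩ ; 0-mem = ⟨0⟩ ; +-closed = _⟨+⟩_ ; neg-closed = ⟨-⟩_ }

  ⟨⟩-least : ∀ {A K : Subset} → IsSubgroup K → (∀ {x} → A x → K x) → ∀ {x} → ⟨ A ⟩ x → K x
  ⟨⟩-least isK A⊆K (gen a)   = A⊆K a
  ⟨⟩-least isK A⊆K ⟨0⟩       = 0-mem isK
  ⟨⟩-least isK A⊆K (x ⟨+⟩ y) = +-closed isK (⟨⟩-least isK A⊆K x) (⟨⟩-least isK A⊆K y)
  ⟨⟩-least isK A⊆K (⟨-⟩ x)   = neg-closed isK (⟨⟩-least isK A⊆K x)
  ⟨⟩-least isK A⊆K (⟨≈⟩ e x) = resp isK e (⟨⟩-least isK A⊆K x)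

  -- For negation: translation by g is injective on the finite set R, hence onto.
  closed⇒⟨⟩-closed : ∀ {B : Subset} {R} → (∀ {x b} → x ∈ R → B b → x + b ∈ R) →
                     ∀ {x g} → x ∈ R → ⟨ B ⟩ g → x + g ∈ R
  closed⇒⟨⟩-closed closed x∈ (gen b)   = closed x∈ b
  closed⇒⟨⟩-closed closed x∈ ⟨0⟩       = ∈-resp (G.sym (G.identityʳ _)) x∈
  closed⇒⟨⟩-closed closed x∈ (g ⟨+⟩ h) =
    ∈-resp (G.assoc _ _ _) (closed⇒⟨⟩-closed closed (closed⇒⟨⟩-closed closed x∈ g) h)
  closed⇒⟨⟩-closed {R = R} closed x∈ (⟨-⟩_ {g} p) = ∈-shift⁻
      (⊆⇒⊇ shift⊆R (ℕₚ.≤-reflexive (≡.sym (♯-shift g R))) x∈)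
    where
    shift⊆R : shift g R ⊆ R
    shift⊆R {y} y∈ = ∈-resp (solve 2 (λ y g → (y ⊖ g) ⊕ g ⊜ y) refl y g)
        (closed⇒⟨⟩-closed closed (∈-shift⁻ y∈) p)
  closed⇒⟨⟩-closed closed x∈ (⟨≈⟩ e g) = ∈-resp (G.∙-congˡ e) (closed⇒⟨⟩-closed closed x∈ g)

  -- All of `r + ⟨ B ⟩` stays inside `R`, so `⟨ B ⟩` is finite and can be cut out of
  -- `shift (- r) R`.
  finite-closure : ∀ {B : Subset} {R r} → r ∈ R → (∀ {x b} → x ∈ R → B b → x + b ∈ R) →
    ∃ λ Q → IsSubgroup (_∈ Q) × (∀ {g} → ⟨ B ⟩ g → g ∈ Q) × (∀ {g} → g ∈ Q → ⟨ B ⟩ g)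
  finite-closure {B} {R} {r} r∈ closed = Q , isQ , ⟨B⟩⊆Q , Q⊆⟨B⟩
    where
    Q : FSet
    Q = restrict ⟨ B ⟩ (shift (- r) R)
    Q⊆⟨B⟩ : ∀ {g} → g ∈ Q → ⟨ B ⟩ g
    Q⊆⟨B⟩ = proj₂ ∘ ∈-restrict⁻ ⟨≈⟩
    ⟨B⟩⊆Q : ∀ {g} → ⟨ B ⟩ g → g ∈ Q
    ⟨B⟩⊆Q {g} p = ∈-restrict⁺ ⟨≈⟩ (∈-shift⁺ (∈-resp (solve 2 (λ r g → r ⊕ g ⊜ g ⊖ (⊝ r)) refl r g)
      (closed⇒⟨⟩-closed closed r∈ p))) p
    isQ : IsSubgroup (_∈ Q)
    isQ = record
      { resp       = ∈-resp
      ; 0-mem      = ⟨B⟩⊆Q ⟨0⟩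
      ; +-closed   = λ x∈ y∈ → ⟨B⟩⊆Q (Q⊆⟨B⟩ x∈ ⟨+⟩ Q⊆⟨B⟩ y∈)
      ; neg-closed = λ x∈ → ⟨B⟩⊆Q (⟨-⟩ Q⊆⟨B⟩ x∈)
      }

  module _ {Q : FSet} (isQ : IsSubgroup (_∈ Q)) where

    diff : ∀ {x y z} → x - y ∈ Q → y - z ∈ Q → x - z ∈ Q
    diff {x} {y} {z} p q =
      ∈-resp (solve 3 (λ x y z → (x ⊖ y) ⊕ (y ⊖ z) ⊜ x ⊖ z) refl x y z) (+-closed isQ p q)

    diff-sym : ∀ {x y} → x - y ∈ Q → y - x ∈ Q
    diff-sym {x} {y} p = ∈-resp (solve 2 (λ x y → ⊝ (x ⊖ y) ⊜ y ⊖ x) refl x y) (neg-closed isQ p)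

    diff-refl : ∀ x → x - x ∈ Q
    diff-refl x = ∈-resp (G.sym (G.inverseʳ x)) (0-mem isQ)

    shift⊆⊞ : ∀ {A a} → a ∈ A → shift a Q ⊆ Q ⊞ A
    shift⊆⊞ {a = a} a∈ {x} x∈ = ∈-⊞⁺ (∈-shift⁻ x∈) a∈ (solve 2 (λ x a → x ⊜ (x ⊖ a) ⊕ a) refl x a)

    cosets-disjoint : ∀ {a b x} → ¬ (b - a ∈ Q) → x ∈ shift a Q → x ∉ shift b Q
    cosets-disjoint b-a∉ x∈a x∈b = b-a∉ (diff (diff-sym (∈-shift⁻ x∈b)) (∈-shift⁻ x∈a))

    -- `Q + A` contains both cosets and the rest of `A`, so at most `∣Q∣ - 1` of the `2∣Q∣` elements
    -- of the two cosets are missing from `A`.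
    two-cosets : ∀ {A a b} → a ∈ A → b ∈ A → ¬ (b - a ∈ Q) → suc (♯ (Q ⊞ A)) ℕ.≤ ♯ Q ℕ.+ ♯ A →
                 suc (♯ Q) ℕ.≤ ♯ (A ∩ (shift a Q ∪ shift b Q))
    two-cosets {A} {a} {b} a∈ b∈ b-a∉ small =
      linarith 5 (λ q s d m n → con 1 :+ s :≤ q :+ (m :+ n) ∷ d :+ n :≤ s ∷ q :+ q :≤ d ∷ []
          ⊩ con 1 :+ q :≤ m) _
        (♯ Q) (♯ (Q ⊞ A)) (♯ D) (♯ (A ∩ D)) (♯ (A ∖ D))
        (≡.subst (λ n → suc (♯ (Q ⊞ A)) ℕ.≤ ♯ Q ℕ.+ n) (♯-∩+∖ A D) small) rest
        (ℕₚ.≤-reflexive (≡.sym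
            (≡.trans (♯-⊎ (cosets-disjoint b-a∉)) (≡.cong₂ ℕ._+_ (♯-shift a Q) (♯-shift b Q)))))
      where
      D = shift a Q ∪ shift b Q
      rest : ♯ D ℕ.+ ♯ (A ∖ D) ℕ.≤ ♯ (Q ⊞ A)
      rest = ≡.subst (ℕ._≤ ♯ (Q ⊞ A)) (♯-⊎ λ x∈D x∈ → proj₂ (∈-∖⁻ x∈) x∈D)
        (♯-mono (∪-least (∪-least (shift⊆⊞ a∈) (shift⊆⊞ b∈))
          λ {x} x∈ → ∈-⊞⁺ (0-mem isQ) (proj₁ (∈-∖⁻ x∈)) (G.sym (G.identityˡ x))))

  -- If `B` met two cosets of `Q`, its part `C` in them and `shift q C` would be two sets of more
  -- than `∣Q∣` elements inside a set of `2∣Q∣`. They would share two elements, against the Sidon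
  -- property.
  Sidon⇒coset : ∀ {Q B q} → IsSubgroup (_∈ Q) → Sidon B → q ∈ Q → ¬ q ≈ 0# →
                suc (♯ (Q ⊞ B)) ℕ.≤ ♯ Q ℕ.+ ♯ B → ∀ {a b} → a ∈ B → b ∈ B → b - a ∈ Q
  Sidon⇒coset {Q} {B} {q} isQ sidon q∈ q≉0 small {a} {b} a∈ b∈ = by-contradiction λ b-a∉ →
    1≰0 (linarith 5 (λ n m u i k → con 1 :+ n :≤ m ∷ con 1 :+ n :≤ m ∷ u :≤ n :+ n ∷ m :+ m :≤ u :+ i ∷
        i :≤ k ∷ k :≤ con 1 ∷ []
        ⊩ con 1 :≤ con 0) _
      (♯ Q) (♯ C) (♯ (C ∪ shift q C)) (♯ (C ∩ shift q C)) (♯ (B ∩ shift q B))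
      (two-cosets isQ a∈ b∈ b-a∉ small) (two-cosets isQ a∈ b∈ b-a∉ small)
      (ℕₚ.≤-trans (♯-mono (∪-least (proj₂ ∘ ∈-∩⁻) shiftC⊆D))
        (ℕₚ.≤-trans (♯-∪-≤ (shift a Q) (shift b Q))
            (ℕₚ.≤-reflexive (≡.cong₂ ℕ._+_ (♯-shift a Q) (♯-shift b Q)))))
      (ℕₚ.≤-reflexive (≡.sym (≡.trans (♯-∪+∩ C (shift q C)) (≡.cong (♯ C ℕ.+_) (♯-shift q C)))))
      (♯-mono λ x∈ → let x∈C , x∈shift = ∈-∩⁻ x∈ in
        ∈-∩⁺ (proj₁ (∈-∩⁻ x∈C)) (∈-shift⁺ (proj₁ (∈-∩⁻ (∈-shift⁻ x∈shift)))))
      (sidon q q≉0))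
    where
    D = shift a Q ∪ shift b Q
    C = B ∩ D
    coset-stable : ∀ {a x} → x - q ∈ shift a Q → x ∈ shift a Q
    coset-stable {a} {x} x-q∈ = ∈-shift⁺ (∈-resp (solve 3 (λ x q a → ((x ⊖ q) ⊖ a) ⊕ q ⊜ x ⊖ a) refl x q a)
      (+-closed isQ (∈-shift⁻ x-q∈) q∈))
    shiftC⊆D : shift q C ⊆ D
    shiftC⊆D x∈ = [ (λ p → ∈-∪ˡ (coset-stable p)) , (λ p → ∈-∪ʳ (coset-stable p)) ]′
      (∈-∪⁻ (proj₂ (∈-∩⁻ (∈-shift⁻ x∈))))

  Sidon-translates : ∀ {C a b} → Sidon C → ¬ a ≈ b → ♯ (shift a C ∩ shift b C) ℕ.≤ 1
  Sidon-translates {C} {a} {b} sidon a≉b = ℕₚ.≤-trans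
    (≡.subst (ℕ._≤ ♯ (C ∩ shift (b - a) C)) (♯-shift (- a) _) (♯-mono back)) (sidon (b - a) b-a≉0)
    where
    b-a≉0 : ¬ b - a ≈ 0#
    b-a≉0 e = a≉b (G.trans (solve 2 (λ a b → a ⊜ b ⊖ (b ⊖ a)) refl a b)
      (G.trans (G.∙-congˡ (G.⁻¹-cong e)) (solve 1 (λ b → b ⊖ 𝟘 ⊜ b) refl b)))
    back : shift (- a) (shift a C ∩ shift b C) ⊆ C ∩ shift (b - a) C
    back {x} x∈ = let p , q = ∈-∩⁻ (∈-shift⁻ x∈) in
      ∈-∩⁺ (∈-resp (solve 2 (λ x a → (x ⊖ (⊝ a)) ⊖ a ⊜ x) refl x a) (∈-shift⁻ p))
           (∈-shift⁺ (∈-resp (solve 3 (λ x a b → (x ⊖ (⊝ a)) ⊖ b ⊜ x ⊖ (b ⊖ a)) refl x a b) (∈-shift⁻ q)))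

  shift⊆⊞ʳ : ∀ {C B b} → b ∈ B → shift b C ⊆ C ⊞ B
  shift⊆⊞ʳ {b = b} b∈ {x} x∈ = ∈-⊞⁺ (∈-shift⁻ x∈) b∈ (solve 2 (λ x b → x ⊜ (x ⊖ b) ⊕ b) refl x b)

  two-translates : ∀ {C a b} → Sidon C → ¬ a ≈ b → ♯ C ℕ.+ ♯ C ℕ.≤ ♯ (shift a C ∪ shift b C) ℕ.+ 1
  two-translates {C} {a} {b} sidon a≉b =
    linarith 3 (λ n u i → n :+ n :≤ u :+ i ∷ i :≤ con 1 ∷ [] ⊩ n :+ n :≤ u :+ con 1) _
      (♯ C) (♯ (shift a C ∪ shift b C)) (♯ (shift a C ∩ shift b C))
      (ℕₚ.≤-reflexive (≡.sym
          (≡.trans (♯-∪+∩ (shift a C) (shift b C)) (≡.cong₂ ℕ._+_ (♯-shift a C) (♯-shift b C)))))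
      (Sidon-translates sidon a≉b)

  Sidon-⊞₂ : ∀ {C B} → Sidon C → 2 ℕ.≤ ♯ B → ♯ C ℕ.+ ♯ C ℕ.≤ ♯ (C ⊞ B) ℕ.+ 1
  Sidon-⊞₂ {C} {B} sidon 2≤B with ♯≥1⁻ (ℕₚ.≤-trans (s≤s z≤n) 2≤B)
  ... | a , a∈ with ♯≥2⁻ 2≤B a
  ...   | b , b∈ , b≉a = ℕₚ.≤-trans (two-translates sidon (b≉a ∘ G.sym))
    (ℕₚ.+-monoˡ-≤ 1 (♯-mono (∪-least (shift⊆⊞ʳ a∈) (shift⊆⊞ʳ b∈))))

  -- The second translate loses at most one element to the first, the third at most one to each of
  -- the other two.
  three-translates : ∀ {C a b c} → Sidon C → ¬ a ≈ b → ¬ a ≈ c → ¬ b ≈ c →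
                     ♯ C ℕ.+ ♯ C ℕ.+ ♯ C ℕ.≤ ♯ (shift a C ∪ shift b C ∪ shift c C) ℕ.+ 3
  three-translates {C} {a} {b} {c} sidon a≉b a≉c b≉c =
    linarith 6 (λ n u v i j k → n :+ n :≤ u :+ con 1 ∷ u :+ n :≤ v :+ i ∷ i :≤ j :+ k ∷ j :≤ con 1 ∷
        k :≤ con 1 ∷ []
      ⊩ n :+ n :+ n :≤ v :+ con 3) _
      (♯ C) (♯ (U ∪ V)) (♯ (U ∪ V ∪ W)) (♯ ((U ∪ V) ∩ W)) (♯ (U ∩ W)) (♯ (V ∩ W))
      (two-translates sidon a≉b)
      (ℕₚ.≤-reflexive (≡.sym (≡.trans (♯-∪+∩ (U ∪ V) W) (≡.cong (♯ (U ∪ V) ℕ.+_) (♯-shift c C)))))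
      (ℕₚ.≤-trans (♯-mono distribute) (♯-∪-≤ (U ∩ W) (V ∩ W)))
      (Sidon-translates sidon a≉c) (Sidon-translates sidon b≉c)
    where
    U = shift a C
    V = shift b C
    W = shift c C
    distribute : (U ∪ V) ∩ W ⊆ U ∩ W ∪ V ∩ W
    distribute x∈ with ∈-∩⁻ x∈
    ... | x∈UV , x∈W = [ (λ x∈U → ∈-∪ˡ (∈-∩⁺ x∈U x∈W)) , (λ x∈V → ∈-∪ʳ (∈-∩⁺ x∈V x∈W)) ]′ (∈-∪⁻ x∈UV)

  Sidon-⊞₃ : ∀ {C B} → Sidon C → 3 ℕ.≤ ♯ B → ♯ C ℕ.+ ♯ C ℕ.+ ♯ C ℕ.≤ ♯ (C ⊞ B) ℕ.+ 3
  Sidon-⊞₃ {C} {B} sidon 3≤B with ♯≥1⁻ (ℕₚ.≤-trans (s≤s z≤n) 3≤B)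
  ... | a , a∈ with ♯≥2⁻ (ℕₚ.≤-trans (s≤s (s≤s z≤n)) 3≤B) a
  ...   | b , b∈ , b≉a with ♯<⇒∃∉ {B} {a ∷ b ∷ []} (≡.subst (ℕ._< ♯ B) (≡.sym (♯-pair (b≉a ∘ G.sym))) 3≤B)
  ...     | c , c∈ , c∉ = ℕₚ.≤-trans
    (three-translates sidon (b≉a ∘ G.sym) (c∉ ∘ here ∘ G.sym) (c∉ ∘ there ∘ here ∘ G.sym))
    (ℕₚ.+-monoˡ-≤ 3 (♯-mono (∪-least (∪-least (shift⊆⊞ʳ a∈) (shift⊆⊞ʳ b∈)) (shift⊆⊞ʳ c∈))))

-- The theorem of Vosper type.

module Vosper (em : ∀ {a} → ExcludedMiddle a) {c ℓ} (G : AbelianGroup c ℓ) where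
  open Classical em
  open Sumsets em G
  open Generation em G
  private module G = AbelianGroup G
  open Subsets G using (Carrier; _≈_; _+_; 0#; -_; _-_; _·_; Subset; whole; IsSubgroup; IsArithmeticProgression; ⟨_⟩; gen; ⟨0⟩; _⟨+⟩_; ⟨-⟩_; ⟨≈⟩)
  open AbelianGroupSolver G
  open IsSubgroup
  open Algebra.Properties.AbelianGroup G using (⁻¹-involutive; ε⁻¹≈ε)

  -- The distinct elements `y` and `z` stand for `∣2T∣ ≤ ∣G∣ - 2`. Generation by `T - t` is stated
  -- as an elimination principle, which is the form in which it is applied to subgroups that need
  -- not be finite.
  record Vosperian (T : FSet) : Set (lsuc (c ⊔ ℓ)) where
    field
      small     : suc (♯ (T ⊞ T)) ℕ.≤ ♯ T ℕ.+ ♯ T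
      subgroups : ∀ {Q q y} → IsSubgroup (_∈ Q) → q ∈ Q → ¬ q ≈ 0# → y ∉ Q ⊞ T → ♯ Q ℕ.+ ♯ T ℕ.≤ ♯ (Q ⊞ T)
      generates : ∀ {K : Subset} → IsSubgroup K → ∀ {t} → t ∈ T → (∀ {s} → s ∈ T → K (s - t)) → ∀ x → K x
      y z       : Carrier
      y∉        : y ∉ T ⊞ T
      z∉        : z ∉ T ⊞ T
      y≉z       : ¬ y ≈ z

  module _ {T : FSet} (vosperian : Vosperian T) where
    open Vosperian vosperian

    -- R + Q = R, so Q + T falls short of the bound for subgroups unless it is the whole group;
    -- but then 2 ∣T∣ exceeds ∣G∣ and T + T is the whole group too.
    module _ {Q R r t} (isQ : IsSubgroup (_∈ Q)) (R⊆T : R ⊆ T) (r∈ : r ∈ R)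
             (closed : ∀ {x g} → x ∈ R → g ∈ Q → x + g ∈ R)
             (t∈ : t ∈ T) (t∉ : t ∉ R) (T⊆ : T ⊆ R ∪ shift t Q) where
      private
        Q⊞T⊆ : Q ⊞ T ⊆ R ∪ shift t Q
        Q⊞T⊆ {x} x∈ with ∈-⊞⁻ x∈
        ... | g , s , g∈ , s∈ , x≈ =
          [ (λ s∈R → ∈-∪ˡ (∈-resp (G.trans (G.comm s g) (G.sym x≈)) (closed s∈R g∈)))
          , (λ s∈tQ → ∈-∪ʳ (∈-shift⁺ (∈-resp
              (G.trans (solve 3 (λ g s t → g ⊕ (s ⊖ t) ⊜ (g ⊕ s) ⊖ t) refl g s t) (G.∙-congʳ (G.sym x≈)))
              (+-closed isQ g∈ (∈-shift⁻ s∈tQ)))))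
          ]′ (∈-∪⁻ (T⊆ s∈))

        R<T : suc (♯ R) ℕ.≤ ♯ T
        R<T = ℕₚ.≰⇒> λ T≤R → t∉ (⊆⇒⊇ R⊆T T≤R t∈)

        Q≤R : ♯ Q ℕ.≤ ♯ R
        Q≤R = ≡.subst (ℕ._≤ ♯ R) (♯-shift r Q) (♯-mono λ {x} x∈ →
          ∈-resp (solve 2 (λ r x → r ⊕ (x ⊖ r) ⊜ x) refl r x) (closed r∈ (∈-shift⁻ x∈)))

        union-≤ : ♯ (R ∪ shift t Q) ℕ.≤ ♯ R ℕ.+ ♯ Q
        union-≤ = ≡.subst (λ n → ♯ (R ∪ shift t Q) ℕ.≤ ♯ R ℕ.+ n) (♯-shift t Q) (♯-∪-≤ R (shift t Q))

        total⊥ : (∀ x → x ∈ R ∪ shift t Q) → ⊥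
        total⊥ covers with pigeonhole {T} {reflect y T} {R ∪ shift t Q} (λ {x} _ → covers x)
            (λ {x} _ → covers x)
          (≡.subst (λ n → ♯ (R ∪ shift t Q) ℕ.< ♯ T ℕ.+ n) (≡.sym (♯-reflect y T))
            (linarith 4 (λ m n k u → u :≤ k :+ n ∷ n :≤ k ∷ con 1 :+ k :≤ m ∷ con 1 :+ k :≤ m ∷ []
                ⊩ con 1 :+ u :≤ m :+ m) _
              (♯ T) (♯ Q) (♯ R) (♯ (R ∪ shift t Q)) union-≤ Q≤R R<T R<T))
        ... | x , x∈ , x∈′ = y∉ (∈-⊞⁺ x∈ (∈-reflect⁻ x∈′) (solve 2 (λ x y → y ⊜ x ⊕ (y ⊖ x)) refl x y))

      periodic-part⊥ : ∀ {q} → q ∈ Q → ¬ q ≈ 0# → ⊥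
      periodic-part⊥ q∈ q≉0 with em {P = ∃ λ x → x ∉ Q ⊞ T}
      ... | no ¬∃ = total⊥ λ x → Q⊞T⊆ (by-contradiction λ x∉ → ¬∃ (x , x∉))
      ... | yes (x , x∉) = 1≰0 (linarith 4 (λ n m k s → n :+ m :≤ s ∷ s :≤ k :+ n ∷ con 1 :+ k :≤ m ∷ []
          ⊩ con 1 :≤ con 0) _
        (♯ Q) (♯ T) (♯ R) (♯ (Q ⊞ T)) (subgroups isQ q∈ q≉0 x∉) (ℕₚ.≤-trans (♯-mono Q⊞T⊆) union-≤) R<T)

    -- Sets that gain at most one element from a translate are progressions.

    module _ {d} (d≉0 : ¬ d ≈ 0#) (d-small : ♯ (T ∪ shift d T) ℕ.≤ suc (♯ T)) where
      private
        D : Subset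
        D = _∈ (- d ∷ [])

        -d : ∀ {R} → (∀ {x} → x ∈ R → x - d ∈ R) → ∀ {x b} → x ∈ R → D b → x + b ∈ R
        -d closed x∈ (here b≈) = ∈-resp (G.∙-congˡ (G.sym b≈)) (closed x∈)

        -d≉0 : ¬ - d ≈ 0#
        -d≉0 e = d≉0 (G.trans (G.sym (⁻¹-involutive d)) (G.trans (G.⁻¹-cong e) ε⁻¹≈ε))

        -- An element of `T ∖ shift d T` is the first term of a maximal progression of difference
        -- `d` in `T`. The hypothesis leaves room for one such first term.
        ends-≤1 : ♯ (T ∖ shift d T) ℕ.≤ 1
        ends-≤1 = linarith 3 (λ e n u → e :+ n :≤ u ∷ u :≤ con 1 :+ n ∷ [] ⊩ e :≤ con 1) _
          (♯ (T ∖ shift d T)) (♯ T) (♯ (T ∪ shift d T))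
          (≡.subst (ℕ._≤ ♯ (T ∪ shift d T))
              (≡.trans (♯-⊎ (proj₂ ∘ ∈-∖⁻)) (≡.cong (♯ (T ∖ shift d T) ℕ.+_) (♯-shift d T)))
            (♯-mono (∪-least (∈-∪ˡ ∘ proj₁ ∘ ∈-∖⁻) ∈-∪ʳ)))
          d-small

        end-unique : ∀ {s t} → s ∈ T → s - d ∉ T → t ∈ T → t - d ∉ T → s ≈ t
        end-unique s∈ s∉ t∈ t∉ = by-contradiction λ s≉t → ℕₚ.<⇒≱ (♯≥2
          (∈-∖⁺ s∈ (s∉ ∘ ∈-shift⁻)) (∈-∖⁺ t∈ (t∉ ∘ ∈-shift⁻)) s≉t) ends-≤1

        -- Here `T` is a union of cosets of the finite subgroup `Q` generated by `- d`, so `Q + T`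
        -- is contained in `T`. That violates `subgroups` unless `T` is everything, and then `T + T`
        -- cannot miss `y`.
        no-end⊥ : ∀ {t} → t ∈ T → (∀ {t} → t ∈ T → t - d ∈ T) → ⊥
        no-end⊥ {t} t∈ closed with finite-closure t∈ (-d closed)
        ... | Q , isQ , ⟨D⟩⊆Q , Q⊆⟨D⟩ = case-split em
          where
          Q⊞T⊆T : Q ⊞ T ⊆ T
          Q⊞T⊆T x∈ with ∈-⊞⁻ x∈
          ... | g , s , g∈ , s∈ , x≈ =
            ∈-resp (G.trans (G.comm s g) (G.sym x≈)) (closed⇒⟨⟩-closed (-d closed) s∈ (Q⊆⟨D⟩ g∈))
          case-split : Dec (∃ λ x → x ∉ Q ⊞ T) → ⊥
          case-split (yes (x , x∉)) = 1≰0 (linarith 3 (λ n m s → n :+ m :≤ s ∷ s :≤ m ∷ con 1 :≤ n ∷ []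
              ⊩ con 1 :≤ con 0) _
            (♯ Q) (♯ T) (♯ (Q ⊞ T)) (subgroups isQ (⟨D⟩⊆Q (gen (here G.refl))) -d≉0 x∉) (♯-mono Q⊞T⊆T)
                (♯≥1 (0-mem isQ)))
          case-split (no ¬∃) = y∉ (∈-⊞⁺ t∈ (Q⊞T⊆T (by-contradiction λ x∉ → ¬∃ (y - t , x∉)))
            (solve 2 (λ y t → y ⊜ t ⊕ (y ⊖ t)) refl y t))

      module _ {t} (t∈ : t ∈ T) (t-d∉ : t - d ∉ T) where
        private
          -- Otherwise the ray from `t` is a finite set closed under adding `d`, hence also under
          -- subtracting `d`, and it contains `t - d`.
          ray-leaves : ∃ λ i → t + i · d ∉ T
          ray-leaves = by-contradiction λ ¬∃ → t-d∉ (-step ¬∃)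
            where
            On-ray : Carrier → Set _
            On-ray x = ∃ λ i → x ≈ t + i · d
            resp-ray : On-ray Respects _≈_
            resp-ray e (i , x≈) = i , G.trans (G.sym e) x≈
            Ray = restrict On-ray T
            -step : ¬ (∃ λ i → t + i · d ∉ T) → t - d ∈ T
            -step ¬∃ = proj₁ (∈-restrict⁻ resp-ray (closed⇒⟨⟩-closed {B = _∈ (d ∷ [])} step
              (∈-restrict⁺ resp-ray t∈ (0 , G.sym (G.identityʳ t))) (⟨-⟩ gen (here G.refl))))
              where
              step : ∀ {x b} → x ∈ Ray → b ∈ d ∷ [] → x + b ∈ Ray
              step {x} {b} x∈ (here b≈d) with ∈-restrict⁻ resp-ray x∈
              ... | _ , i , x≈ = ∈-restrict⁺ resp-ray
                (∈-resp (G.sym x+b≈) (by-contradiction λ ∉T → ¬∃ (suc i , ∉T))) (suc i , x+b≈)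
                where
                x+b≈ : x + b ≈ t + suc i · d
                x+b≈ = G.trans (G.∙-cong x≈ b≈d)
                    (solve 3 (λ t m d → (t ⊕ m) ⊕ d ⊜ t ⊕ (d ⊕ m)) refl t (i · d) d)

        module _ {m} (leaves : t + m · d ∉ T) (least : ∀ i → t + i · d ∉ T → m ℕ.≤ i) where
          private
            String : Carrier → Set _
            String x = ∃ λ i → i ℕ.< m × x ≈ t + i · d
            resp-string : String Respects _≈_
            resp-string e (i , i<m , x≈) = i , i<m , G.trans (G.sym e) x≈
            String⊆T : ∀ {x} → String x → x ∈ T
            String⊆T (i , i<m , x≈) = ∈-resp (G.sym x≈) (by-contradiction λ ∉T → ℕₚ.<⇒≱ i<m (least i ∉T))
            1≤m : 1 ℕ.≤ m
            1≤m = ℕₚ.≰⇒> λ m≤0 → leaves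
                (≡.subst (λ i → t + i · d ∈ T) (≡.sym (ℕₚ.n≤0⇒n≡0 m≤0)) (∈-resp (G.sym (G.identityʳ t)) t∈))
            t-string : String t
            t-string = 0 , 1≤m , G.sym (G.identityʳ t)
            R : FSet
            R = restrict (∁ String) T
            -- Only `t` has its predecessor outside `T`. A predecessor inside the string would put
            -- `x` in the string or at `t + m · d`, which is not in `T`.
            R-closed : ∀ {x} → x ∈ R → x - d ∈ R
            R-closed {x} x∈ with ∈-restrict⁻ (¬-resp resp-string) x∈
            ... | x∈T , x∉S = ∈-restrict⁺ (¬-resp resp-string)
              (by-contradiction λ x-d∉ → x∉S (resp-string (end-unique t∈ t-d∉ x∈T x-d∉) t-string))
              λ (i , i<m , x-d≈) → next i i<m (G.trans (solve 2 (λ x d → x ⊜ (x ⊖ d) ⊕ d) refl x d)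
                (G.trans (G.∙-congʳ x-d≈) (solve 3 (λ t m d → (t ⊕ m) ⊕ d ⊜ t ⊕ (d ⊕ m)) refl t (i · d) d)))
              where
              next : ∀ i → i ℕ.< m → x ≈ t + suc i · d → ⊥
              next i i<m x≈ with suc i ℕₚ.<? m
              ... | yes 1+i<m = x∉S (suc i , 1+i<m , x≈)
              ... | no  1+i≮m = leaves
                  (≡.subst (λ j → t + j · d ∈ T) (ℕₚ.≤-antisym i<m (ℕₚ.≮⇒≥ 1+i≮m)) (∈-resp x≈ x∈T))
            -- A nonempty `R` closed under subtracting `d` is a union of cosets of a finite subgroup
            -- `Q`, and the string lies in `shift t Q`; this is the configuration excluded by
            -- `periodic-part⊥`.
            R-empty : ∀ {r} → r ∈ R → ⊥
            R-empty r∈ with finite-closure r∈ (-d R-closed)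
            ... | Q , isQ , ⟨D⟩⊆Q , Q⊆⟨D⟩ = periodic-part⊥ isQ (proj₁ ∘ ∈-restrict⁻ (¬-resp resp-string)) r∈
                (λ x∈ g∈ → closed⇒⟨⟩-closed (-d R-closed) x∈ (Q⊆⟨D⟩ g∈))
                t∈ (λ t∈R → proj₂ (∈-restrict⁻ (¬-resp resp-string) t∈R) t-string) T⊆ -d∈Q -d≉0
              where
              -d∈Q : - d ∈ Q
              -d∈Q = ⟨D⟩⊆Q (gen (here G.refl))
              multiple : ∀ i → i · d ∈ Q
              multiple zero    = 0-mem isQ
              multiple (suc i) = +-closed isQ (∈-resp (⁻¹-involutive d) (neg-closed isQ -d∈Q)) (multiple i)
              T⊆ : T ⊆ R ∪ shift t Q
              T⊆ {x} x∈ with em {P = String x}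
              ... | no ¬s = ∈-∪ˡ (∈-restrict⁺ (¬-resp resp-string) x∈ ¬s)
              ... | yes (i , _ , x≈) = ∈-∪ʳ (∈-shift⁺ (∈-resp
                (G.trans (solve 2 (λ t m → m ⊜ (t ⊕ m) ⊖ t) refl t (i · d)) (G.∙-congʳ (G.sym x≈)))
                    (multiple i)))
            T⊆String : ∀ {x} → x ∈ T → String x
            T⊆String x∈ = by-contradiction λ ¬s → R-empty (∈-restrict⁺ (¬-resp resp-string) x∈ ¬s)

          progression′ : IsArithmeticProgression (_∈ T)
          progression′ = t , d , m , 1≤m , (λ x∈ → T⊆String x∈) , String⊆T

        progression : IsArithmeticProgression (_∈ T)
        progression = let m , leaves , least = minimum (λ i → t + i · d ∉ T) id ray-leaves in
          progression′ leaves least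

      pair⇒progression : ∀ {t} → t ∈ T → IsArithmeticProgression (_∈ T)
      pair⇒progression {t₀} t₀∈ with em {P = ∃ λ t → t ∈ T × t - d ∉ T}
      ... | yes (t , t∈ , t-d∉) = progression t∈ t-d∉
      ... | no ¬∃ = ⊥-elim (no-end⊥ t₀∈ λ {t} t∈ → by-contradiction λ ∉T → ¬∃ (t , t∈ , ∉T))

    -- Sidon atoms with at least three elements are impossible.

    module _ {B} (0∈B : 0# ∈ B) (sidon : Sidon B) (3≤B : 3 ℕ.≤ ♯ B)
             (B-small : suc (♯ (B ⊞ T)) ℕ.≤ ♯ B ℕ.+ ♯ T)
             {w w′} (w∉ : w ∉ B ⊞ T) (w′∉ : w′ ∉ B ⊞ T) (w≉w′ : ¬ w ≈ w′)
             {t} (t∈ : t ∈ T) (2≤T : 2 ℕ.≤ ♯ T) where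
      private
        L : Subset
        L = ⟨ _∈ B ⟩

        isL : IsSubgroup L
        isL = generated-subgroup (_∈ B)

        b≉0 : ∃ λ b → b ∈ B × ¬ b ≈ 0#
        b≉0 = ♯≥2⁻ (ℕₚ.≤-trans (s≤s (s≤s z≤n)) 3≤B) 0#

        swap : ∀ {X x} → x ∉ B ⊞ X → x ∉ X ⊞ B
        swap x∉ x∈ = x∉ (⊞-comm x∈)

        module InL = Isoperimetry em G L isL
        module InG = Isoperimetry em G whole whole-subgroup

        -- By `Sidon⇒coset` and `0∈B` the set `B` lies in `Q`; then so does `L`, and `Q + B` misses
        -- nothing of `L`.
        Sidon-subgroup⊥ : ∀ {Q y} → IsSubgroup (_∈ Q) → L y → y ∉ Q ⊞ B → suc (♯ (Q ⊞ B)) ℕ.≤ ♯ Q ℕ.+ ♯ B →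
                          ∀ {q} → q ∈ Q → ¬ q ≈ 0# → ⊥
        Sidon-subgroup⊥ {Q} {y} isQ ly y∉ small q∈ q≉0 = y∉ (∈-⊞⁺ (L⊆Q ly) 0∈B (G.sym (G.identityʳ y)))
          where
          L⊆Q : ∀ {x} → L x → x ∈ Q
          L⊆Q = ⟨⟩-least isQ λ {b} b∈ → ∈-resp (solve 1 (λ b → b ⊖ 𝟘 ⊜ b) refl b)
            (Sidon⇒coset isQ sidon q∈ q≉0 small 0∈B b∈)

        -- If the bound failed, the subgroup `Q` that is a 1-fragment of `B` in `L` would satisfy
        -- `∣Q + B∣ < ∣Q∣ + ∣B∣`. A nonzero `Q` is excluded by `Sidon-subgroup⊥`; for zero `Q` the
        -- bound is the isoperimetric inequality.
        L-bound : ∀ {X x y} → (∀ {z} → z ∈ X → L z) → x ∈ X → L y → y ∉ X ⊞ B → ♯ X ℕ.+ ♯ B ℕ.≤ suc (♯ (X ⊞ B))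
        L-bound {X} X⊑L x∈ ly y∉ = bound (InL.fragment-subgroup gen 0∈B X⊑L x∈ (_ , ly , y∉))
          where
          bound : ∃ (InL.FragmentSubgroup gen 0∈B) → ♯ X ℕ.+ ♯ B ℕ.≤ suc (♯ (X ⊞ B))
          bound (Q , fragment) = by-contradiction λ X>B → Sidon-case X>B em
            where
            open InL.FragmentSubgroup fragment renaming (missed to missed′)
            Q-bound : ♯ (Q ⊞ B) ℕ.+ ♯ X ℕ.≤ ♯ (X ⊞ B) ℕ.+ ♯ Q
            Q-bound = minimal X⊑L x∈ (_ , ly , y∉)
            B≤Q⊞B : ♯ B ℕ.≤ ♯ (Q ⊞ B)
            B≤Q⊞B = ≡.subst (♯ B ℕ.≤_) (♯-⊞-comm B Q) (♯-≤-⊞ (0-mem isSubgroup))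
            Sidon-case : ¬ (♯ X ℕ.+ ♯ B ℕ.≤ suc (♯ (X ⊞ B))) → Dec (∃ λ q → q ∈ Q × ¬ q ≈ 0#) → ⊥
            Sidon-case X>B (yes (q , q∈ , q≉0)) = Sidon-subgroup⊥ isSubgroup (proj₁ (proj₂ missed′))
                (proj₂ (proj₂ missed′))
              (linarith 5 (λ n b s x u → s :+ x :≤ u :+ n ∷ con 2 :+ u :≤ x :+ b ∷ [] ⊩ con 1 :+ s :≤ n :+ b) _
                (♯ Q) (♯ B) (♯ (Q ⊞ B)) (♯ X) (♯ (X ⊞ B)) Q-bound (ℕₚ.≰⇒> X>B)) q∈ q≉0
            Sidon-case X>B (no ¬∃) = 1≰0 (linarith 5 (λ n b s x u →
              s :+ x :≤ u :+ n ∷ con 2 :+ u :≤ x :+ b ∷ n :≤ con 1 ∷ b :≤ s ∷ [] ⊩ con 1 :≤ con 0) _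
              (♯ Q) (♯ B) (♯ (Q ⊞ B)) (♯ X) (♯ (X ⊞ B)) Q-bound (ℕₚ.≰⇒> X>B)
              (ℕ.s≤s⁻¹ (ℕₚ.≰⇒> λ 2≤Q → ¬∃ (♯≥2⁻ 2≤Q 0#))) B≤Q⊞B)

        -- If T + L ⊆ T + B, then L is a finite subgroup with ∣L + T∣ < ∣L∣ + ∣T∣.
        absorbing⊥ : (∀ {s l} → s ∈ T → L l → s + l ∈ T ⊞ B) → ⊥
        absorbing⊥ absorbs = finite (finite-closure (∈-⊞⁺ t∈ 0∈B G.refl) closed)
          where
          closed : ∀ {x b} → x ∈ T ⊞ B → b ∈ B → x + b ∈ T ⊞ B
          closed x∈ b∈ with ∈-⊞⁻ x∈
          ... | s , b′ , s∈ , b′∈ , x≈ = ∈-resp (G.trans (G.sym (G.assoc _ _ _)) (G.∙-congʳ (G.sym x≈)))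
            (absorbs s∈ (gen b′∈ ⟨+⟩ gen b∈))
          finite : (∃ λ Q → IsSubgroup (_∈ Q) × (∀ {g} → L g → g ∈ Q) × (∀ {g} → g ∈ Q → L g)) → ⊥
          finite (Q , isQ , L⊆Q , Q⊆L) = let b , b∈ , b≉ = b≉0 in
            1≰0 (linarith 5 (λ n m b s u → n :+ m :≤ s ∷ s :≤ u ∷ con 1 :+ u :≤ b :+ m ∷ b :≤ n ∷ []
                ⊩ con 1 :≤ con 0) _
              (♯ Q) (♯ T) (♯ B) (♯ (Q ⊞ T)) (♯ (B ⊞ T))
              (subgroups isQ (L⊆Q (gen b∈)) b≉ (w∉ ∘ ⊞-comm ∘ Q⊞T⊆)) (♯-mono (⊞-comm ∘ Q⊞T⊆)) B-small
                  (♯-mono (L⊆Q ∘ gen)))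
            where
            Q⊞T⊆ : Q ⊞ T ⊆ T ⊞ B
            Q⊞T⊆ x∈ with ∈-⊞⁻ x∈
            ... | g , s , g∈ , s∈ , x≈ = ∈-resp (G.trans (G.comm s g) (G.sym x≈)) (absorbs s∈ (Q⊆L g∈))

        module _ {s l} (s∈ : s ∈ T) (ll : L l) (s+l∉ : s + l ∉ T ⊞ B) where
          In-coset : Carrier → Set _
          In-coset x = L (x - s)
          resp-coset : In-coset Respects _≈_
          resp-coset e = ⟨≈⟩ (G.∙-congʳ e)
          T′ T″ : FSet
          T′ = restrict In-coset T
          T″ = restrict (∁ In-coset) T
          s∈coset : In-coset s
          s∈coset = ⟨≈⟩ (G.sym (G.inverseʳ s)) ⟨0⟩

          T′-bound : ♯ T′ ℕ.+ ♯ B ℕ.≤ suc (♯ (T′ ⊞ B))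
          T′-bound = ≡.subst₂ (λ m n → m ℕ.+ ♯ B ℕ.≤ suc n) (♯-shift (- s) T′) (♯-shift-⊞ (- s) T′ B)
            (L-bound
              (λ {z} z∈ → ⟨≈⟩ (solve 2 (λ z s → (z ⊖ (⊝ s)) ⊖ s ⊜ z) refl z s)
                  (proj₂ (∈-restrict⁻ resp-coset (∈-shift⁻ z∈))))
              (∈-shift⁺ (∈-resp (solve 1 (λ s → s ⊜ 𝟘 ⊖ (⊝ s)) refl s) (∈-restrict⁺ resp-coset s∈ s∈coset)))
              ll
              λ l∈ → s+l∉ (∈-resp (solve 2 (λ l s → l ⊖ (⊝ s) ⊜ s ⊕ l) refl l s)
                (⊞-mono (proj₁ ∘ ∈-restrict⁻ resp-coset) id (∈-shift⁻ (shift-⊞ l∈)))))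

          parts-disjoint : ∀ {x} → x ∈ T′ ⊞ B → x ∉ T″ ⊞ B
          parts-disjoint x∈ x∈′ with ∈-⊞⁻ x∈ | ∈-⊞⁻ x∈′
          ... | p , b , p∈ , b∈ , x≈ | p′ , b′ , p′∈ , b′∈ , x≈′ = proj₂ (∈-restrict⁻ (¬-resp resp-coset) p′∈)
            (⟨≈⟩ (G.trans (solve 4 (λ p s b b′ → (p ⊖ s) ⊕ (b ⊖ b′) ⊜ ((p ⊕ b) ⊖ b′) ⊖ s) refl p s b b′)
              (G.∙-congʳ (G.trans (G.∙-congʳ (G.trans (G.sym x≈) x≈′))
                  (solve 2 (λ p b → (p ⊕ b) ⊖ b ⊜ p) refl p′ b′))))
              (proj₂ (∈-restrict⁻ resp-coset p∈) ⟨+⟩ (gen b∈ ⟨+⟩ (⟨-⟩ gen b′∈))))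

          -- By `T′-bound`, the sum `T′ + B` already accounts for the whole excess `∣B∣ - 1` of
          -- `T + B` over `T`. What is left gives `∣T″ + B∣ ≤ ∣T″∣`.
          T″-closed : T″ ⊞ B ⊆ T″
          T″-closed = ⊆⇒⊇ (λ {x} x∈ → ∈-⊞⁺ x∈ 0∈B (G.sym (G.identityʳ x)))
            (linarith 7 (λ m b k l m′ b′ u → m :+ b :≤ con 1 :+ m′ ∷ m′ :+ b′ :≤ u ∷ con 1 :+ u :≤ b :+ l ∷
                l :≤ m :+ k ∷ [] ⊩ b′ :≤ k) _
              (♯ T′) (♯ B) (♯ T″) (♯ T) (♯ (T′ ⊞ B)) (♯ (T″ ⊞ B)) (♯ (T ⊞ B))
              T′-bound
              (≡.subst (ℕ._≤ ♯ (T ⊞ B)) (♯-⊎ parts-disjoint)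
                (♯-mono (∪-least (⊞-mono (proj₁ ∘ ∈-restrict⁻ resp-coset) id)
                    (⊞-mono (proj₁ ∘ ∈-restrict⁻ (¬-resp resp-coset)) id))))
              (≡.subst (λ n → suc n ℕ.≤ ♯ B ℕ.+ ♯ T) (♯-⊞-comm B T) B-small)
              (ℕₚ.≤-reflexive (♯-restrict resp-coset T)))

          T″-empty : ∀ {r} → r ∈ T″ → ⊥
          T″-empty r∈ = finite (finite-closure r∈ closed)
            where
            closed : ∀ {x b} → x ∈ T″ → b ∈ B → x + b ∈ T″
            closed x∈ b∈ = T″-closed (∈-⊞⁺ x∈ b∈ G.refl)
            finite : (∃ λ Q → IsSubgroup (_∈ Q) × (∀ {g} → L g → g ∈ Q) × (∀ {g} → g ∈ Q → L g)) → ⊥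
            finite (Q , isQ , L⊆Q , Q⊆L) = let b , b∈ , b≉ = b≉0 in
              periodic-part⊥ isQ (proj₁ ∘ ∈-restrict⁻ (¬-resp resp-coset)) r∈
                (λ x∈ g∈ → closed⇒⟨⟩-closed closed x∈ (Q⊆L g∈))
                s∈ (λ s∈T″ → proj₂ (∈-restrict⁻ (¬-resp resp-coset) s∈T″) s∈coset) T⊆ (L⊆Q (gen b∈)) b≉
              where
              T⊆ : T ⊆ T″ ∪ shift s Q
              T⊆ {x} x∈ with em {P = In-coset x}
              ... | yes p = ∈-∪ʳ (∈-shift⁺ (L⊆Q p))
              ... | no ¬p = ∈-∪ˡ (∈-restrict⁺ (¬-resp resp-coset) x∈ ¬p)

          L-total′ : ∀ x → L x
          L-total′ = generates isL s∈ λ {x} x∈ → by-contradiction λ ¬p → T″-empty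
              (∈-restrict⁺ (¬-resp resp-coset) x∈ ¬p)

        -- `absorbing⊥` leaves only the case where `T` lies in one coset of `L`, and then
        -- `generates` applies. It makes the argument inside `L` available for a 2-atom of `B` taken
        -- in `G`.
        L-total : ∀ x → L x
        L-total with em {P = ∃₂ λ s l → s ∈ T × L l × s + l ∉ T ⊞ B}
        ... | yes (s , l , s∈ , ll , s+l∉) = L-total′ s∈ ll s+l∉
        ... | no ¬∃ = ⊥-elim (absorbing⊥ λ {s} {l} s∈ ll → by-contradiction λ ∉ → ¬∃ (s , l , s∈ , ll , ∉))

        -- If `∣C∣ ≥ 3`, the Sidon bounds `3∣C∣ - 3` and `3∣B∣ - 3` for `∣C + B∣` add up to
        -- `∣C∣ + ∣B∣ ≤ 4`. If `∣C∣ = 2`, the bound `2∣B∣ - 1` gives `∣B∣ ≤ 2`.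
        dual-atom⊥ : ∀ {C x} → 2 ℕ.≤ ♯ C → suc (♯ (C ⊞ B)) ℕ.≤ ♯ C ℕ.+ ♯ B → x ∉ C ⊞ B →
            IsSubgroup (_∈ C) ⊎ Sidon C → ⊥
        dual-atom⊥ 2≤C C-small x∉ (inj₁ isC) = let q , q∈ , q≉0 = ♯≥2⁻ 2≤C 0# in
          Sidon-subgroup⊥ isC (L-total _) x∉ C-small q∈ q≉0
        dual-atom⊥ {C} 2≤C C-small x∉ (inj₂ sidonC) with em {P = 3 ℕ.≤ ♯ C}
        ... | yes 3≤C = 1≰0 (linarith 3 (λ n b s → con 1 :+ s :≤ n :+ b ∷ con 1 :+ s :≤ n :+ b ∷
            n :+ n :+ n :≤ s :+ con 3 ∷ b :+ b :+ b :≤ s :+ con 3 ∷ con 3 :≤ n ∷ con 3 :≤ b ∷ []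
                ⊩ con 1 :≤ con 0) _
          (♯ C) (♯ B) (♯ (C ⊞ B)) C-small C-small (Sidon-⊞₃ sidonC 3≤B)
          (≡.subst (λ n → ♯ B ℕ.+ ♯ B ℕ.+ ♯ B ℕ.≤ n ℕ.+ 3) (♯-⊞-comm B C) (Sidon-⊞₃ sidon 3≤C)) 3≤C 3≤B)
        ... | no 3≰C = 1≰0 (linarith 3 (λ n b s → con 1 :+ s :≤ n :+ b ∷ b :+ b :≤ s :+ con 1 ∷
            con 1 :+ n :≤ con 3 ∷ con 3 :≤ b ∷ []
            ⊩ con 1 :≤ con 0) _
          (♯ C) (♯ B) (♯ (C ⊞ B)) C-small
              (≡.subst (λ n → ♯ B ℕ.+ ♯ B ℕ.≤ n ℕ.+ 1) (♯-⊞-comm B C) (Sidon-⊞₂ sidon 2≤C)) (ℕₚ.≰⇒> 3≰C) 3≤B)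

        -- The roles are exchanged: `B` becomes the fixed summand and `T` the competitor, so a
        -- 2-atom `C` of `B` inherits `∣C + B∣ - ∣C∣ ≤ ∣T + B∣ - ∣T∣ < ∣B∣`.
        T-admissible : InG.Admissible _ 0∈B 2 T
        T-admissible = record
          { inside = _
          ; size   = 2≤T
          ; cosize = w ∷ w′ ∷ [] , ℕₚ.≤-reflexive (≡.sym (♯-pair w≉w′)) , λ where
              (here e)         → _ , λ y∈ → swap w∉ (∈-resp e y∈)
              (there (here e)) → _ , λ y∈ → swap w′∉ (∈-resp e y∈)
          }

      large-Sidon-atom⊥ : ⊥
      large-Sidon-atom⊥ = from-atom (InG.2-atom _ 0∈B (T , T-admissible))
        where
        from-atom : (∃ λ C → InG.Atom _ 0∈B 2 C × 0# ∈ C × (IsSubgroup (_∈ C) ⊎ Sidon C)) → ⊥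
        from-atom (C , atom , _ , dichotomy) with InG.Atom.admissible atom
        ... | adm with InG.Admissible.cosize adm
        ...   | Y , 2≤Y , out with ♯≥1⁻ (ℕₚ.≤-trans (s≤s z≤n) 2≤Y)
        ...     | x , x∈ = dual-atom⊥ (InG.Admissible.size adm)
          (linarith 5 (λ n b t s u → s :+ t :≤ u :+ n ∷ con 1 :+ u :≤ b :+ t ∷ [] ⊩ con 1 :+ s :≤ n :+ b) _
            (♯ C) (♯ B) (♯ T) (♯ (C ⊞ B)) (♯ (T ⊞ B)) (InG.δ-minimal′ _ 0∈B atom T-admissible)
            (≡.subst (λ n → suc n ℕ.≤ ♯ B ℕ.+ ♯ T) (♯-⊞-comm B T) B-small))
          (proj₂ (out x∈)) dichotomy

    vosper : 3 ℕ.≤ ♯ T → IsArithmeticProgression (_∈ T)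
    vosper 3≤T = from-element (♯≥1⁻ (ℕₚ.≤-trans (s≤s z≤n) 3≤T))
      where
      module InG = Isoperimetry em G whole whole-subgroup
      2≤T = ℕₚ.≤-trans (s≤s (s≤s z≤n)) 3≤T

      from-element : ∃ (_∈ T) → IsArithmeticProgression (_∈ T)
      from-element (t , t∈) = from-atom (InG.2-atom _ t∈ (T , T-admissible))
        where
        -- `T` competes with its own 2-atom `B`, so `∣B + T∣ - ∣B∣ ≤ ∣T + T∣ - ∣T∣ < ∣T∣` by
        -- `small`.
        T-admissible : InG.Admissible _ t∈ 2 T
        T-admissible = record
          { inside = _
          ; size   = 2≤T
          ; cosize = y ∷ z ∷ [] , ℕₚ.≤-reflexive (≡.sym (♯-pair y≉z)) , λ where
              (here e)         → _ , λ y∈ → y∉ (∈-resp e y∈)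
              (there (here e)) → _ , λ y∈ → z∉ (∈-resp e y∈)
          }

        from-atom : (∃ λ B → InG.Atom _ t∈ 2 B × 0# ∈ B × (IsSubgroup (_∈ B) ⊎ Sidon B)) →
            IsArithmeticProgression (_∈ T)
        from-atom (B , atom , 0∈B , dichotomy) with InG.Atom.admissible atom
        ... | adm with InG.Admissible.cosize adm
        ...   | Y , 2≤Y , out with ♯≥1⁻ (ℕₚ.≤-trans (s≤s z≤n) 2≤Y)
        ...     | w , w∈ with ♯≥2⁻ 2≤Y w | ♯≥2⁻ (InG.Admissible.size adm) 0#
        ...       | w′ , w′∈ , w′≉w | d , d∈ , d≉0 = by-kind dichotomy
          where
          w∉ = proj₂ (out w∈)
          B-small : suc (♯ (B ⊞ T)) ℕ.≤ ♯ B ℕ.+ ♯ T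
          B-small = linarith 4 (λ n t s u → s :+ t :≤ u :+ n ∷ con 1 :+ u :≤ t :+ t ∷ []
              ⊩ con 1 :+ s :≤ n :+ t) _
            (♯ B) (♯ T) (♯ (B ⊞ T)) (♯ (T ⊞ T)) (InG.δ-minimal′ _ t∈ atom T-admissible) small
          by-kind : IsSubgroup (_∈ B) ⊎ Sidon B → IsArithmeticProgression (_∈ T)
          by-kind (inj₁ isB) = ⊥-elim (ℕₚ.<⇒≱ B-small (subgroups isB d∈ d≉0 w∉))
          by-kind (inj₂ sidon) with em {P = 3 ℕ.≤ ♯ B}
          ... | yes 3≤B = ⊥-elim
              (large-Sidon-atom⊥ 0∈B sidon 3≤B B-small w∉ (proj₂ (out w′∈)) (w′≉w ∘ G.sym) t∈ 2≤T)
          -- Now `B` consists of `0#` and `d`, and `B + T` contains `T` and its translate by `d`.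
          ... | no  3≰B = pair⇒progression d≉0
            (linarith 4 (λ n t s u → con 1 :+ s :≤ n :+ t ∷ con 1 :+ n :≤ con 3 ∷ u :≤ s ∷ []
                ⊩ u :≤ con 1 :+ t) _
              (♯ B) (♯ T) (♯ (B ⊞ T)) (♯ (T ∪ shift d T)) B-small (ℕₚ.≰⇒> 3≰B)
              (♯-mono (∪-least (λ {x} x∈ → ∈-⊞⁺ 0∈B x∈ (G.sym (G.identityˡ x)))
                (λ {x} x∈ → ∈-⊞⁺ d∈ (∈-shift⁻ x∈) (solve 2 (λ x d → x ⊜ d ⊕ (x ⊖ d)) refl x d))))) t∈

-- The cosets of a fragment subgroup in multiples of a set.

module Structure (em : ∀ {a} → ExcludedMiddle a) {c ℓ} (G : AbelianGroup c ℓ) where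
  open Classical em
  open Sumsets em G
  open Generation em G
  private module G = AbelianGroup G
  open Subsets G using (Carrier; _≈_; _+_; 0#; -_; _-_; _·_; Subset; IsSubgroup)
  open AbelianGroupSolver G
  open IsSubgroup

  Aperiodicˢ : FSet → Set _
  Aperiodicˢ A = ∀ g → (∀ {x} → x ∈ A → x + g ∈ A) → g ≈ 0#

  ⋆-⊑ : ∀ {L : Subset} {A} → IsSubgroup L → (∀ {x} → x ∈ A → L x) → ∀ k {x} → x ∈ k ⋆ˢ A → L x
  ⋆-⊑ isL A⊑L zero    (here x≈) = resp isL (G.sym x≈) (0-mem isL)
  ⋆-⊑ isL A⊑L (suc k) x∈ with ∈-⊞⁻ x∈
  ... | a , w , a∈ , w∈ , x≈ = resp isL (G.sym x≈) (+-closed isL (A⊑L a∈) (⋆-⊑ isL A⊑L k w∈))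

  -- Common ground of two uses: the hyper-atom with `L` the whole group, and the induction for
  -- Kneser's theorem with `L` generated by the set. The field `spread` says that `S` meets at least
  -- two cosets of `Q`.
  record Fragment (L : Subset) (Q S : FSet) : Set (c ⊔ ℓ) where
    field
      isL      : IsSubgroup L
      isQ      : IsSubgroup (_∈ Q)
      S⊑L      : ∀ {x} → x ∈ S → L x
      Q⊑L      : ∀ {x} → x ∈ Q → L x
      small    : suc (♯ (Q ⊞ S)) ℕ.≤ ♯ Q ℕ.+ ♯ S
      expands  : ∀ {X x y} → (∀ {x} → x ∈ X → L x) → x ∈ X → L y → y ∉ X ⊞ S →
                 ♯ (Q ⊞ S) ℕ.+ ♯ X ℕ.≤ ♯ (X ⊞ S) ℕ.+ ♯ Q
      s₀ s₁    : Carrier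
      s₀∈      : s₀ ∈ S
      s₁∈      : s₁ ∈ S
      spread   : ¬ (s₁ - s₀ ∈ Q)
      smallest : ∀ {s} → s ∈ S → ♯ (S ∩ shift s₀ Q) ℕ.≤ ♯ (S ∩ shift s Q)

  module _ {L Q S} (fragment : Fragment L Q S) where
    open Fragment fragment

    S₀ : FSet
    S₀ = S ∩ shift s₀ Q

    S₀⊆S : S₀ ⊆ S
    S₀⊆S = proj₁ ∘ ∈-∩⁻

    private
      L-diff : ∀ {x y} → L x → L y → L (x - y)
      L-diff lx ly = +-closed isL lx (neg-closed isL ly)

      ∈-S₀ : ∀ {s} → s ∈ S → s - s₀ ∈ Q → s ∈ S₀
      ∈-S₀ s∈ p = ∈-∩⁺ s∈ (∈-shift⁺ p)

      S₀-coset : ∀ {s} → s ∈ S₀ → s - s₀ ∈ Q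
      S₀-coset s∈ = ∈-shift⁻ (proj₂ (∈-∩⁻ s∈))

      Full : ℕ → Carrier → Set _
      Full k x = ∀ {q} → q ∈ Q → x + q ∈ k ⋆ˢ S

      Full-resp : ∀ k {x y} → y - x ∈ Q → Full k x → Full k y
      Full-resp k {x} {y} p full {q} q∈ =
        ∈-resp (solve 3 (λ x y q → x ⊕ ((y ⊖ x) ⊕ q) ⊜ y ⊕ q) refl x y q) (full (+-closed isQ p q∈))

      ≈⇒diff : ∀ {x y} → x ≈ y → y - x ∈ Q
      ≈⇒diff {x} {y} e = ∈-resp (G.sym (G.trans (G.∙-congʳ (G.sym e)) (G.inverseʳ x))) (0-mem isQ)

    -- At most ∣Q∣ - 1 elements of S + Q are missing from S, so the sum of two components
    -- is a full coset unless both are the smallest one.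
    components-full : ∀ {s s′ q} → s ∈ S → s′ ∈ S → ¬ (s - s₀ ∈ Q) → q ∈ Q →
                      ∃₂ λ a b → a ∈ S × b ∈ S × (s + s′) + q ≈ a + b
    components-full {s} {s′} {q} s∈ s′∈ s∉ q∈
      with pigeonhole {S ∩ shift s Q} {reflect ((s + s′) + q) (S ∩ shift s′ Q)} {shift s Q} (proj₂ ∘ ∈-∩⁻)
          reflected large
      where
      reflected : reflect ((s + s′) + q) (S ∩ shift s′ Q) ⊆ shift s Q
      reflected {x} x∈ = ∈-shift⁺ (∈-resp
        (solve 4 (λ s s′ q x → q ⊕ (⊝ ((((s ⊕ s′) ⊕ q) ⊖ x) ⊖ s′)) ⊜ x ⊖ s) refl s s′ q x)
        (+-closed isQ q∈ (neg-closed isQ (∈-shift⁻ (proj₂ (∈-∩⁻ (∈-reflect⁻ x∈)))))))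
      large : ♯ (shift s Q) ℕ.< ♯ (S ∩ shift s Q) ℕ.+ ♯ (reflect ((s + s′) + q) (S ∩ shift s′ Q))
      large = ≡.subst₂ (λ m n → m ℕ.< ♯ (S ∩ shift s Q) ℕ.+ n) (≡.sym (♯-shift s Q)) (≡.sym (♯-reflect _ _))
        -- The component of `s′` is at least as large as `S₀` and may replace it in
        -- `∣S₀∣ + ∣S ∩ (s + Q)∣ > ∣Q∣`.
        (linarith 5 (λ n u v w t → con 1 :+ n :≤ u ∷ u :≤ v :+ w ∷ v :≤ t ∷ [] ⊩ con 1 :+ n :≤ w :+ t) _
          (♯ Q) (♯ (S ∩ (shift s₀ Q ∪ shift s Q))) (♯ S₀) (♯ (S ∩ shift s Q)) (♯ (S ∩ shift s′ Q))
          (two-cosets isQ s₀∈ s∈ s∉ small)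
          (ℕₚ.≤-trans (♯-mono distribute) (♯-∪-≤ S₀ (S ∩ shift s Q)))
          (smallest s′∈))
        where
        distribute : S ∩ (shift s₀ Q ∪ shift s Q) ⊆ S₀ ∪ (S ∩ shift s Q)
        distribute x∈ with ∈-∩⁻ x∈
        ... | x∈S , x∈∪ = [ (λ p → ∈-∪ˡ (∈-∩⁺ x∈S p)) , (λ p → ∈-∪ʳ (∈-∩⁺ x∈S p)) ]′ (∈-∪⁻ x∈∪)
    ... | x , x∈ , x∈′ = x , ((s + s′) + q) - x , proj₁ (∈-∩⁻ x∈) , proj₁ (∈-∩⁻ (∈-reflect⁻ x∈′)) ,
      solve 2 (λ y x → y ⊜ x ⊕ (y ⊖ x)) refl ((s + s′) + q) x

    private
      -- A summand `s` outside `S₀` makes a full coset with the next summand, and adding the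
      -- remaining ones keeps a full coset.
      head : ∀ k {s w} → s ∈ S → w ∈ suc k ⋆ˢ S → ¬ Full (2 ℕ.+ k) (s + w) → s ∈ S₀
      head k {s} {w} s∈ w∈ ¬full with ∈-⊞⁻ w∈
      ... | s′ , w′ , s′∈ , w′∈ , w≈ = ∈-S₀ s∈
          (by-contradiction λ s∉ → ¬full λ {q} q∈ → sum q∈ (components-full s∈ s′∈ s∉ q∈))
        where
        sum : ∀ {q} → q ∈ Q → (∃₂ λ a b → a ∈ S × b ∈ S × (s + s′) + q ≈ a + b) → (s + w) + q ∈ (2 ℕ.+ k) ⋆ˢ S
        sum {q} q∈ (a , b , a∈ , b∈ , eq) = ∈-⊞⁺ a∈ (∈-⊞⁺ b∈ w′∈ G.refl)
          (G.trans (G.∙-congʳ (G.∙-congˡ w≈)) (G.trans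
            (solve 4 (λ s s′ q w → (s ⊕ (s′ ⊕ w)) ⊕ q ⊜ ((s ⊕ s′) ⊕ q) ⊕ w) refl s s′ q w′)
            (G.trans (G.∙-congʳ eq) (G.assoc a b w′))))

      decompose : ∀ k {s w} → s ∈ S → w ∈ suc k ⋆ˢ S → ¬ Full (2 ℕ.+ k) (s + w) → s ∈ S₀ × w ∈ suc k ⋆ˢ S₀
      decompose k {s} {w} s∈ w∈ ¬full with ∈-⊞⁻ w∈
      -- The last summand has no successor to combine with, so it is moved to the front before
      -- `head` is applied.
      decompose zero    {s} {w} s∈ w∈ ¬full | s′ , w′ , s′∈ , w′∈ , w≈ = head 0 s∈ w∈ ¬full ,
        ∈-⊞⁺ (head 0 s′∈ (∈-⊞⁺ s∈ w′∈ G.refl) λ full → ¬full (Full-resp 2 (≈⇒diff eq) full)) w′∈ w≈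
        where
        eq : s′ + (s + w′) ≈ s + w
        eq = G.trans (solve 3 (λ s s′ w′ → s′ ⊕ (s ⊕ w′) ⊜ s ⊕ (s′ ⊕ w′)) refl s s′ w′) (G.∙-congˡ (G.sym w≈))
      decompose (suc k) {s} {w} s∈ w∈ ¬full | s′ , w′ , s′∈ , w′∈ , w≈ = head (suc k) s∈ w∈ ¬full ,
        ∈-⊞⁺ (proj₁ tail) (proj₂ tail) w≈
        where
        tail : s′ ∈ S₀ × w′ ∈ suc k ⋆ˢ S₀
        tail = decompose k s′∈ w′∈ λ full → ¬full λ {q} q∈ → ∈-⊞⁺ s∈ (full q∈)
          (G.trans (G.∙-congʳ (G.∙-congˡ w≈)) (G.assoc s (s′ + w′) q))

      ⋆-coset : ∀ k {x} → x ∈ k ⋆ˢ S₀ → x - k · s₀ ∈ Q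
      ⋆-coset zero    (here x≈) = ∈-resp (G.trans (G.sym x≈) (solve 1 (λ x → x ⊜ x ⊖ 𝟘) refl _)) (0-mem isQ)
      ⋆-coset (suc k) {x} x∈ with ∈-⊞⁻ x∈
      ... | s , w , s∈ , w∈ , x≈ = ∈-resp
        (G.trans (solve 4 (λ s w t u → (s ⊖ t) ⊕ (w ⊖ u) ⊜ (s ⊕ w) ⊖ (t ⊕ u)) refl s w s₀ (k · s₀))
            (G.∙-congʳ (G.sym x≈)))
        (+-closed isQ (S₀-coset s∈) (⋆-coset k w∈))

    ⋆-S₀-coset : ∀ k {x y} → x ∈ k ⋆ˢ S₀ → y ∈ k ⋆ˢ S₀ → x - y ∈ Q
    ⋆-S₀-coset k x∈ y∈ = diff isQ (⋆-coset k x∈) (diff-sym isQ (⋆-coset k y∈))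

    module _ {q} (q∈ : q ∈ Q) (q≉0 : ¬ q ≈ 0#) (n : ℕ) where
      private
        k = 2 ℕ.+ n

      module _ (aperiodic : Aperiodicˢ (k ⋆ˢ S)) where
        private
          not-full : ∃ λ y → y ∈ k ⋆ˢ S × ¬ Full k y
          not-full = by-contradiction λ ¬∃ → q≉0 (aperiodic q λ {x} x∈ →
            by-contradiction λ x+q∉ → ¬∃ (x , x∈ , λ full → x+q∉ (full q∈)))

          y₀ : Carrier
          y₀ = proj₁ not-full

          ¬full⇒S₀ : ∀ {x} → x ∈ k ⋆ˢ S → ¬ Full k x → x ∈ k ⋆ˢ S₀
          ¬full⇒S₀ x∈ ¬full with ∈-⊞⁻ x∈
          ... | s , w , s∈ , w∈ , x≈ = ∈-⊞⁺ (proj₁ parts) (proj₂ parts) x≈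
            where
            parts = decompose n s∈ w∈ λ full → ¬full (Full-resp k (≈⇒diff (G.sym x≈)) full)

          y₀∈ : y₀ ∈ k ⋆ˢ S₀
          y₀∈ = ¬full⇒S₀ (proj₁ (proj₂ not-full)) (proj₂ (proj₂ not-full))

        -- All of `k ⋆ˢ S₀` lies in the coset of `y₀`, which is not full, so `decompose` applies to
        -- any representation of a point of that coset.
        unique-representation : ∀ {s w y} → s ∈ S → w ∈ suc n ⋆ˢ S → y ∈ k ⋆ˢ S₀ → (s + w) - y ∈ Q →
                                s ∈ S₀ × w ∈ suc n ⋆ˢ S₀
        unique-representation s∈ w∈ y∈ p = decompose n s∈ w∈ λ full →
          proj₂ (proj₂ not-full) (Full-resp k (diff isQ (⋆-S₀-coset k y₀∈ y∈) (diff-sym isQ p)) full)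

        private
          near-y₀ : ∀ {s w} → s ∈ S → w ∈ suc n ⋆ˢ S → (s + w) - y₀ ∈ Q → s - s₀ ∈ Q
          near-y₀ s∈ w∈ p = S₀-coset (proj₁ (unique-representation s∈ w∈ y₀∈ p))

        -- A period of `k ⋆ˢ S₀` lies in `Q`, because this set lies in one coset. It therefore also
        -- preserves the full cosets and is a period of `k ⋆ˢ S`.
        ⋆-S₀-aperiodic : Aperiodicˢ (k ⋆ˢ S₀)
        ⋆-S₀-aperiodic g stable = aperiodic g λ {x} x∈ → by-contradiction λ x+g∉ →
          x+g∉ (⋆ˢ-mono k S₀⊆S (stable (¬full⇒S₀ x∈ λ full → x+g∉ (full g∈Q))))
          where
          g∈Q : g ∈ Q
          g∈Q = ∈-resp (solve 2 (λ y g → (y ⊕ g) ⊖ y ⊜ g) refl y₀ g) (⋆-S₀-coset k (stable y₀∈) y₀∈)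

        ♯-saturation : ♯ (k ⋆ˢ S ⊞ Q) ℕ.+ ♯ (k ⋆ˢ S₀) ℕ.≤ ♯ (k ⋆ˢ S) ℕ.+ ♯ Q
        ♯-saturation = linarith 6 (λ u z m i d n → u :≤ d :+ n ∷ z :≤ i ∷ i :+ d :≤ m ∷ [] ⊩ u :+ z :≤ m :+ n) _
          (♯ (k ⋆ˢ S ⊞ Q)) (♯ (k ⋆ˢ S₀)) (♯ (k ⋆ˢ S)) (♯ (k ⋆ˢ S ∩ shift y₀ Q)) (♯ (k ⋆ˢ S ∖ shift y₀ Q)) (♯ Q)
          (ℕₚ.≤-trans (♯-mono covered) (ℕₚ.≤-trans (♯-∪-≤ (k ⋆ˢ S ∖ shift y₀ Q) (shift y₀ Q))
            (ℕₚ.≤-reflexive (≡.cong (♯ (k ⋆ˢ S ∖ shift y₀ Q) ℕ.+_) (♯-shift y₀ Q)))))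
          (♯-mono λ x∈ → ∈-∩⁺ (⋆ˢ-mono k S₀⊆S x∈) (∈-shift⁺ (⋆-S₀-coset k x∈ y₀∈)))
          (ℕₚ.≤-reflexive (≡.sym (♯-∩+∖ (k ⋆ˢ S) (shift y₀ Q))))
          where
          covered : k ⋆ˢ S ⊞ Q ⊆ k ⋆ˢ S ∖ shift y₀ Q ∪ shift y₀ Q
          covered {x} x∈ with ∈-⊞⁻ x∈ | em {P = x ∈ shift y₀ Q}
          ... | _ | yes p = ∈-∪ʳ p
          ... | v , g , v∈ , g∈ , x≈ | no x∉ = ∈-∪ˡ (∈-∖⁺ (by-contradiction λ x∉kS → x∉ (∈-shift⁺
            (diff isQ (∈-resp (G.trans (solve 2 (λ v g → g ⊜ (v ⊕ g) ⊖ v) refl v g) (G.∙-congʳ (G.sym x≈))) g∈)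
              (⋆-S₀-coset k (¬full⇒S₀ v∈ λ full → x∉kS (∈-resp (G.sym x≈) (full g∈))) y₀∈)))) x∉)

        private
          X : ℕ → FSet
          X j = j ⋆ˢ S ⊞ Q

          X⊑L : ∀ j {x} → x ∈ X j → L x
          X⊑L j x∈ with ∈-⊞⁻ x∈
          ... | v , g , v∈ , g∈ , x≈ = resp isL (G.sym x≈) (+-closed isL (⋆-⊑ isL S⊑L j v∈) (Q⊑L g∈))

          X⊞S : ∀ j → X j ⊞ S ⊆ X (suc j)
          X⊞S j x∈ = ⊞-assoc⁻ (⊞-comm (⊞-mono id id x∈))

          X-step : ∀ j → (∀ {x} → L x → x ∈ X j) → ∀ {x} → L x → x ∈ X (suc j)
          X-step j covers {x} lx = X⊞S j
              (∈-⊞⁺ (covers (L-diff lx (S⊑L s₀∈))) s₀∈ (solve 2 (λ x s → x ⊜ (x ⊖ s) ⊕ s) refl x s₀))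

          X-steps : ∀ i j → (∀ {x} → L x → x ∈ X j) → ∀ {x} → L x → x ∈ X (i ℕ.+ j)
          X-steps zero    j covers = covers
          X-steps (suc i) j covers = X-step (i ℕ.+ j) (X-steps i j covers)

          y₀∈L : L y₀
          y₀∈L = ⋆-⊑ isL S⊑L k (proj₁ (proj₂ not-full))

          -- Otherwise `y₀` would lie in `s₁ + (k-1)S + Q`, although a first summand outside the
          -- coset of `s₀` never reaches the coset of `y₀`.
          not-total : ¬ (∀ {x} → L x → x ∈ X (suc n))
          not-total covers with ∈-⊞⁻ (covers (L-diff y₀∈L (S⊑L s₁∈)))
          ... | w , g , w∈ , g∈ , eq = spread (near-y₀ s₁∈ w∈ (∈-resp
            (G.trans (solve 4 (λ y s w g → ⊝ g ⊜ (s ⊕ (((w ⊕ g) ⊖ g))) ⊖ (s ⊕ (w ⊕ g))) refl y₀ s₁ w g)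
              (G.trans (G.∙-congˡ (G.⁻¹-cong
                  (G.trans (G.∙-congˡ (G.sym eq)) (solve 2 (λ y s → s ⊕ (y ⊖ s) ⊜ y) refl y₀ s₁))))
                (G.∙-congʳ (G.∙-congˡ (solve 2 (λ w g → (w ⊕ g) ⊖ g ⊜ w) refl w g)))))
            (neg-closed isQ g∈)))

          -- The substitute for `expands` when nothing is missed. A common element of `X (suc n)`
          -- and `V` writes the coset of `y₀` as a sum whose summand from `S` must be in the coset
          -- of `s₀`. So the two sets, both inside `X k`, share at most one coset.
          last-step : (∀ {x} → L x → x ∈ X k) → ♯ (X (suc n)) ℕ.+ ♯ (Q ⊞ S) ℕ.≤ ♯ (X k) ℕ.+ ♯ Q
          last-step covers = linarith 6 (λ a b u i m q → a :+ b :≤ u :+ i ∷ u :≤ m ∷ i :≤ q ∷ []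
              ⊩ a :+ b :≤ m :+ q) _
            (♯ (X (suc n))) (♯ (Q ⊞ S)) (♯ (X (suc n) ∪ V)) (♯ (X (suc n) ∩ V)) (♯ (X k)) (♯ Q)
            (ℕₚ.≤-reflexive (≡.sym
                (≡.trans (♯-∪+∩ (X (suc n)) V) (≡.cong (♯ (X (suc n)) ℕ.+_) (♯-reflect y₀ (Q ⊞ S))))))
            (♯-mono (∪-least (covers ∘ X⊑L (suc n)) (covers ∘ V⊑L)))
            (≡.subst (♯ (X (suc n) ∩ V) ℕ.≤_) (♯-shift (y₀ - s₀) Q) (♯-mono one-coset))
            where
            V = reflect y₀ (Q ⊞ S)
            V⊑L : ∀ {x} → x ∈ V → L x
            V⊑L {x} x∈ with ∈-⊞⁻ (∈-reflect⁻ x∈)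
            ... | g , s , g∈ , s∈ , eq = resp isL (solve 2 (λ y x → y ⊖ (y ⊖ x) ⊜ x) refl y₀ x)
              (L-diff y₀∈L (resp isL (G.sym eq) (+-closed isL (Q⊑L g∈) (S⊑L s∈))))
            one-coset : X (suc n) ∩ V ⊆ shift (y₀ - s₀) Q
            one-coset {x} x∈ with ∈-⊞⁻ (proj₁ (∈-∩⁻ x∈)) | ∈-⊞⁻ (∈-reflect⁻ (proj₂ (∈-∩⁻ x∈)))
            ... | w , g , w∈ , g∈ , x≈ | g′ , s , g′∈ , s∈ , y-x≈ = ∈-shift⁺ (∈-resp
              (G.trans (solve 4 (λ x g s s₀ → ⊝ (g ⊕ (s ⊖ s₀)) ⊜ x ⊖ ((x ⊕ (g ⊕ s)) ⊖ s₀)) refl x g′ s s₀)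
                (G.∙-congˡ (G.⁻¹-cong (G.∙-congʳ (G.sym y≈)))))
              (neg-closed isQ (+-closed isQ g′∈ (near-y₀ s∈ w∈ near))))
              where
              y≈ : y₀ ≈ x + (g′ + s)
              y≈ = G.trans (solve 2 (λ y x → y ⊜ x ⊕ (y ⊖ x)) refl y₀ x) (G.∙-congˡ y-x≈)
              near : (s + w) - y₀ ∈ Q
              near = ∈-resp (G.trans
                  (solve 4 (λ s w g g′ → ⊝ (g ⊕ g′) ⊜ (s ⊕ w) ⊖ ((w ⊕ g) ⊕ (g′ ⊕ s))) refl s w g g′)
                (G.∙-congˡ (G.⁻¹-cong (G.trans (G.∙-congʳ (G.sym x≈)) (G.sym y≈)))))
                    (neg-closed isQ (+-closed isQ g∈ g′∈))

          total-step : ∀ j → j ℕ.< k →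
              (∀ {x} → L x → x ∈ X (suc j)) → ♯ (X j) ℕ.+ ♯ (Q ⊞ S) ℕ.≤ ♯ (X (suc j)) ℕ.+ ♯ Q
          total-step j j<k covers with ℕₚ.m≤n⇒m<n∨m≡n (ℕ.s≤s⁻¹ j<k)
          ... | inj₁ j<1+n  = ⊥-elim (not-total λ {x} lx → ≡.subst (λ i → x ∈ X i) (ℕₚ.m∸n+n≡m j<1+n)
            (X-steps (suc n ℕ.∸ suc j) (suc j) covers lx))
          ... | inj₂ refl = last-step covers

        ⋆-growth : ∀ j → j ℕ.< k → ♯ (j ⋆ˢ S ⊞ Q) ℕ.+ ♯ (Q ⊞ S) ℕ.≤ ♯ (suc j ⋆ˢ S ⊞ Q) ℕ.+ ♯ Q
        ⋆-growth j j<k with em {P = ∃ λ y → L y × y ∉ X j ⊞ S}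
        ... | no ¬∃ = total-step j j<k λ {x} lx → X⊞S j (by-contradiction λ x∉ → ¬∃ (x , lx , x∉))
        ... | yes (y , ly , y∉) = linarith 5 (λ a b u v q → b :+ a :≤ u :+ q ∷ u :≤ v ∷ [] ⊩ a :+ b :≤ v :+ q) _
            (♯ (X j)) (♯ (Q ⊞ S)) (♯ (X j ⊞ S)) (♯ (X (suc j))) (♯ Q)
            (expands (X⊑L j) (proj₂ element) ly y∉) (♯-mono (X⊞S j))
          where
          ⋆-element : ∀ j → ∃ (_∈ j ⋆ˢ S)
          ⋆-element zero    = 0# , here G.refl
          ⋆-element (suc j) = _ , ∈-⊞⁺ s₀∈ (proj₂ (⋆-element j)) G.refl
          element : ∃ (_∈ X j)
          element = _ , ∈-⊞⁺ (proj₂ (⋆-element j)) (0-mem isQ) G.refl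

        -- The bound `∣jS + Q∣ ≥ jκ + ∣Q∣` with `κ = ∣Q + S∣ - ∣Q∣`, cleared of subtraction.
        ⋆-growthⁿ : ∀ j → j ℕ.≤ k → j ℕ.* ♯ (Q ⊞ S) ℕ.+ ♯ Q ℕ.≤ ♯ (j ⋆ˢ S ⊞ Q) ℕ.+ j ℕ.* ♯ Q
        ⋆-growthⁿ zero    _ = ℕₚ.≤-trans (♯-mono λ {x} x∈ → ∈-⊞⁺ (here G.refl) x∈ (G.sym (G.identityˡ x)))
            (ℕₚ.m≤m+n _ 0)
        ⋆-growthⁿ (suc j) j<k = linarith 6 (λ m jm q jq u v → jm :+ q :≤ u :+ jq ∷ u :+ m :≤ v :+ q ∷ []
            ⊩ m :+ jm :+ q :≤ v :+ (q :+ jq)) _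
          (♯ (Q ⊞ S)) (j ℕ.* ♯ (Q ⊞ S)) (♯ Q) (j ℕ.* ♯ Q) (♯ (X j)) (♯ (X (suc j)))
          (⋆-growthⁿ j (ℕₚ.<⇒≤ j<k)) (⋆-growth j j<k)

    -- This is `κ ≥ ∣S∣ - ∣S₀∣`: besides the coset of `s₀`, the sum `Q + S` contains every element
    -- of `S` outside it.
    ♯-without-S₀ : ♯ S ℕ.+ ♯ Q ℕ.≤ ♯ S₀ ℕ.+ ♯ (Q ⊞ S)
    ♯-without-S₀ = linarith 5 (λ s q z d u → s :≤ z :+ d ∷ d :+ q :≤ u ∷ [] ⊩ s :+ q :≤ z :+ u) _
      (♯ S) (♯ Q) (♯ S₀) (♯ (S ∖ shift s₀ Q)) (♯ (Q ⊞ S))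
      (ℕₚ.≤-reflexive (♯-∩+∖ S (shift s₀ Q)))
      (≡.subst (ℕ._≤ ♯ (Q ⊞ S)) (≡.trans (♯-⊎ (proj₂ ∘ ∈-∖⁻)) (≡.cong (♯ (S ∖ shift s₀ Q) ℕ.+_) (♯-shift s₀ Q)))
        (♯-mono (∪-least (λ {x} x∈ → ∈-⊞⁺ (0-mem isQ) (proj₁ (∈-∖⁻ x∈)) (G.sym (G.identityˡ x)))
            (shift⊆⊞ isQ s₀∈))))

    ♯-S₀<♯-S : ♯ S₀ ℕ.< ♯ S
    ♯-S₀<♯-S = ℕₚ.≰⇒> λ S≤S₀ → spread (S₀-coset (⊆⇒⊇ S₀⊆S S≤S₀ s₁∈))

-- Kneser's theorem for an aperiodic multiple of one set.

module Kneser (em : ∀ {a} → ExcludedMiddle a) {c ℓ} (G : AbelianGroup c ℓ) where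
  open Classical em
  open Sumsets em G
  open Generation em G
  open Structure em G
  private module G = AbelianGroup G
  open Subsets G using (_≈_; _+_; 0#; -_; _-_; _·_; Subset; IsSubgroup; ⟨_⟩; gen; ⟨0⟩; ⟨≈⟩)
  open AbelianGroupSolver G
  open IsSubgroup

  ⋆-ascending : ∀ {A} → 0# ∈ A → ∀ i j → j ⋆ˢ A ⊆ (i ℕ.+ j) ⋆ˢ A
  ⋆-ascending 0∈ zero    j = id
  ⋆-ascending 0∈ (suc i) j {x} x∈ = ∈-⊞⁺ 0∈ (⋆-ascending 0∈ i j x∈) (G.sym (G.identityˡ x))

  0∈⋆ : ∀ {A} → 0# ∈ A → ∀ j → 0# ∈ j ⋆ˢ A
  0∈⋆ 0∈ zero    = here G.refl
  0∈⋆ 0∈ (suc j) = ∈-⊞⁺ 0∈ (0∈⋆ 0∈ j) (G.sym (G.identityˡ 0#))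

  ⊆-⋆ : ∀ {A} → 0# ∈ A → ∀ j → A ⊆ suc j ⋆ˢ A
  ⊆-⋆ 0∈ j {x} x∈ = ∈-⊞⁺ x∈ (0∈⋆ 0∈ j) (G.sym (G.identityʳ x))

  ⋆-shift : ∀ {g A} k → k ⋆ˢ shift g A ⊆ shift (k · g) (k ⋆ˢ A)
  ⋆-shift zero    (here x≈) = ∈-shift⁺ (here (G.trans (G.∙-congʳ x≈) (G.inverseʳ 0#)))
  ⋆-shift {g} (suc k) x∈ with ∈-⊞⁻ x∈
  ... | a , w , a∈ , w∈ , x≈ = ∈-shift⁺ (∈-⊞⁺ (∈-shift⁻ a∈) (∈-shift⁻ (⋆-shift k w∈))
    (G.trans (G.∙-congʳ x≈) (solve 4 (λ a w g h → (a ⊕ w) ⊖ (g ⊕ h) ⊜ (a ⊖ g) ⊕ (w ⊖ h)) refl a w g (k · g))))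

  ⋆-shift⁻ : ∀ {g A} k → shift (k · g) (k ⋆ˢ A) ⊆ k ⋆ˢ shift g A
  ⋆-shift⁻ zero    {x} x∈ with ∈-shift⁻ x∈
  ... | here e = here (G.trans (solve 1 (λ x → x ⊜ x ⊖ 𝟘) refl x) e)
  ⋆-shift⁻ {g} {A} (suc k) {x} x∈ with ∈-⊞⁻ (∈-shift⁻ x∈)
  ... | a , w , a∈ , w∈ , x≈ = ∈-⊞⁺ (∈-image⁺ G.∙-congˡ a∈) (⋆-shift⁻ k (∈-image⁺ G.∙-congˡ w∈))
    (G.trans (solve 2 (λ x u → x ⊜ (x ⊖ u) ⊕ u) refl x (g + k · g)) (G.trans (G.∙-congʳ x≈)
      (solve 4 (λ a w g h → (a ⊕ w) ⊕ (g ⊕ h) ⊜ (g ⊕ a) ⊕ (h ⊕ w)) refl a w g (k · g))))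

  Kneser-bound : ℕ → FSet → Set
  Kneser-bound k A = k ℕ.* ♯ A ℕ.+ 1 ℕ.≤ ♯ (k ⋆ˢ A) ℕ.+ k

  private
    module Step {A} (0∈A : 0# ∈ A) (n : ℕ)
             (ih : ∀ {B b} → ♯ B ℕ.< ♯ A → b ∈ B → Aperiodicˢ ((2 ℕ.+ n) ⋆ˢ B) → Kneser-bound (2 ℕ.+ n) B)
             (aperiodic : Aperiodicˢ ((2 ℕ.+ n) ⋆ˢ A)) where
      k = 2 ℕ.+ n
      L : Subset
      L = ⟨ _∈ A ⟩
      isL : IsSubgroup L
      isL = generated-subgroup (_∈ A)
      module InL = Isoperimetry em G L isL

      no-nonzero : ∀ {B} → ¬ (∃ λ b → b ∈ B × ¬ b ≈ 0#) → ♯ B ℕ.≤ 1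
      no-nonzero ¬∃ = ℕ.s≤s⁻¹ (ℕₚ.≰⇒> λ 2≤B → ¬∃ (♯≥2⁻ 2≤B 0#))

      scaled : ∀ {a} → a ℕ.≤ 1 → ∀ j → j ℕ.* a ℕ.≤ j
      scaled a≤1 j = ≡.subst (j ℕ.* _ ℕ.≤_) (ℕₚ.*-identityʳ j) (ℕₚ.*-monoʳ-≤ j a≤1)

      -- If `k ⋆ˢ A` fills `L`, every element of `A` is a period, so `A` has no nonzero element.
      total-case : (∀ {x} → L x → x ∈ k ⋆ˢ A) → Kneser-bound k A
      total-case covers = linarith 3 (λ ka k u → ka :≤ k ∷ con 1 :≤ u ∷ [] ⊩ ka :+ con 1 :≤ u :+ k) _
        (k ℕ.* ♯ A) k (♯ (k ⋆ˢ A))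
        (scaled (no-nonzero λ (a , a∈ , a≉0) → a≉0
            (aperiodic a λ x∈ → covers (+-closed isL (⋆-⊑ isL gen k x∈) (gen a∈)))) k)
        (♯≥1 (0∈⋆ 0∈A k))

      combine : ∀ {Q} (fragment : Fragment L Q A) {q} → q ∈ Q → ¬ q ≈ 0# → Aperiodicˢ (k ⋆ˢ A) →
                Kneser-bound k (S₀ fragment) → Kneser-bound k A
      combine {Q} fragment q∈ q≉0 aperiodic bound₀ = linarith 9 (λ ka kq kz kw m z u q k →
          u :+ z :≤ m :+ q ∷ kw :+ q :≤ u :+ kq ∷ kz :+ con 1 :≤ z :+ k ∷ ka :+ kq :≤ kz :+ kw ∷ []
          ⊩ ka :+ con 1 :≤ m :+ k) _
        (k ℕ.* ♯ A) (k ℕ.* ♯ Q) (k ℕ.* ♯ (S₀ fragment)) (k ℕ.* ♯ (Q ⊞ A)) (♯ (k ⋆ˢ A))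
            (♯ (k ⋆ˢ S₀ fragment)) (♯ (k ⋆ˢ A ⊞ Q)) (♯ Q) k
        (♯-saturation fragment q∈ q≉0 n aperiodic) (⋆-growthⁿ fragment q∈ q≉0 n aperiodic k ℕₚ.≤-refl) bound₀
        (≡.subst₂ ℕ._≤_ (ℕₚ.*-distribˡ-+ k (♯ A) (♯ Q)) (ℕₚ.*-distribˡ-+ k (♯ (S₀ fragment)) (♯ (Q ⊞ A)))
          (ℕₚ.*-monoʳ-≤ k (♯-without-S₀ fragment)))

      module _ {y} (ly : L y) (y∉ : y ∉ k ⋆ˢ A) {Q} (atom : InL.FragmentSubgroup gen 0∈A Q) where
        open InL.FragmentSubgroup atom

        Q⊞A-bound : ♯ A ℕ.≤ ♯ (Q ⊞ A)
        Q⊞A-bound = ≡.subst (♯ A ℕ.≤_) (♯-⊞-comm A Q) (♯-≤-⊞ (0-mem isSubgroup))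

        -- With `Q` zero every further summand adds at least `∣A∣ - 1`. The inequality stays
        -- applicable up to `k` because `0#` in `A` makes the multiples ascending, so each of them
        -- misses `y`.
        trivial-case : ♯ Q ℕ.≤ 1 → Kneser-bound k A
        trivial-case Q≤1 = grow k ℕₚ.≤-refl
          where
          grow : ∀ j → j ℕ.≤ k → j ℕ.* ♯ A ℕ.+ 1 ℕ.≤ ♯ (j ⋆ˢ A) ℕ.+ j
          grow zero    _   = ℕₚ.≤-trans (♯≥1 {x = 0#} (here G.refl)) (ℕₚ.m≤m+n _ 0)
          grow (suc j) j<k = linarith 8 (λ a ja u v v′ w q j →
              ja :+ con 1 :≤ u :+ j ∷ w :+ u :≤ v′ :+ q ∷ v′ :≤ v ∷ a :≤ w ∷ q :≤ con 1 ∷ []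
              ⊩ a :+ ja :+ con 1 :≤ v :+ (con 1 :+ j)) _
            (♯ A) (j ℕ.* ♯ A) (♯ (j ⋆ˢ A)) (♯ (suc j ⋆ˢ A)) (♯ (j ⋆ˢ A ⊞ A)) (♯ (Q ⊞ A)) (♯ Q) j
            (grow j (ℕₚ.<⇒≤ j<k))
            (minimal (⋆-⊑ isL gen j) (0∈⋆ 0∈A j) (y , ly , y∉ ∘ up ∘ ⊞-comm))
            (♯-mono ⊞-comm) Q⊞A-bound Q≤1
            where
            up : suc j ⋆ˢ A ⊆ k ⋆ˢ A
            up {x} x∈ = ≡.subst (λ i → x ∈ i ⋆ˢ A) (ℕₚ.m∸n+n≡m j<k) (⋆-ascending 0∈A (k ℕ.∸ suc j) (suc j) x∈)

        module _ {q} (q∈ : q ∈ Q) (q≉0 : ¬ q ≈ 0#) where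

          with-smallest : (∃ λ s → s ∈ A × (∀ t → t ∈ A → ♯ (A ∩ shift s Q) ℕ.≤ ♯ (A ∩ shift t Q))) →
              Kneser-bound k A
          with-smallest (s , s∈ , least) = combine fragment q∈ q≉0 aperiodic
            (ih (♯-S₀<♯-S fragment) (∈-∩⁺ s∈ (∈-shift⁺ (diff-refl isSubgroup s)))
                (⋆-S₀-aperiodic fragment q∈ q≉0 n aperiodic))
            where
            A⊈s+Q : ∃ λ s₁ → s₁ ∈ A × ¬ (s₁ - s ∈ Q)
            -- If `A` lay in `shift s Q`, then `0∈A` would give first `A` and then `L` inside `Q`,
            -- but `Q + A` misses an element of `L`.
            A⊈s+Q = by-contradiction λ ¬∃ → contained λ {a} a∈ → by-contradiction λ a∉ → ¬∃ (a , a∈ , a∉)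
              where
              contained : (∀ {a} → a ∈ A → a - s ∈ Q) → ⊥
              contained A⊆ = proj₂ (proj₂ missed)
                  (∈-⊞⁺ (⟨⟩-least isSubgroup A⊆Q (proj₁ (proj₂ missed))) 0∈A (G.sym (G.identityʳ _)))
                where
                A⊆Q : ∀ {a} → a ∈ A → a ∈ Q
                A⊆Q {a} a∈ = ∈-resp (solve 2 (λ a s → (a ⊖ s) ⊖ (𝟘 ⊖ s) ⊜ a) refl a s)
                  (+-closed isSubgroup (A⊆ a∈) (neg-closed isSubgroup (A⊆ 0∈A)))

            fragment : Fragment L Q A
            fragment = record
              { isL      = isL
              ; isQ      = isSubgroup
              ; S⊑L      = gen
              ; Q⊑L      = within
              ; small    = small
              ; expands  = λ X⊑L x∈ lz z∉ → minimal X⊑L x∈ (_ , lz , z∉)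
              ; s₀       = s
              ; s₁       = proj₁ A⊈s+Q
              ; s₀∈      = s∈
              ; s₁∈      = proj₁ (proj₂ A⊈s+Q)
              ; spread   = proj₂ (proj₂ A⊈s+Q)
              ; smallest = λ {t} → least t
              }
              where
              small : suc (♯ (Q ⊞ A)) ℕ.≤ ♯ Q ℕ.+ ♯ A
              -- The competitor is the singleton of `0#`, which gives `∣Q + A∣ - ∣Q∣ ≤ ∣A∣ - 1`.
              small = linarith 4 (λ u a q z → u :+ z :≤ a :+ q ∷ con 1 :≤ z ∷ [] ⊩ con 1 :+ u :≤ q :+ a) _
                (♯ (Q ⊞ A)) (♯ A) (♯ Q) (♯ (0# ∷ []))
                (≡.subst (λ m → ♯ (Q ⊞ A) ℕ.+ ♯ (0# ∷ []) ℕ.≤ m ℕ.+ ♯ Q) (♯-cong 0⊞⊆ ⊆0⊞)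
                  (minimal (λ { (here e) → ⟨≈⟩ (G.sym e) ⟨0⟩ }) (here G.refl)
                    (y , ly , λ y∈ → y∉ (⊆-⋆ 0∈A (suc n) (0⊞⊆ y∈)))))
                (♯≥1 {x = 0#} (here G.refl))

        nontotal-case : Kneser-bound k A
        nontotal-case with em {P = ∃ λ q → q ∈ Q × ¬ q ≈ 0#}
        ... | no ¬∃              = trivial-case (no-nonzero ¬∃)
        ... | yes (q , q∈ , q≉0) = with-smallest q∈ q≉0 (minimum (_∈ A) (λ s → ♯ (A ∩ shift s Q)) (0# , 0∈A))

      kneser-step : Kneser-bound k A
      kneser-step with em {P = ∃ λ y → L y × y ∉ k ⋆ˢ A}
      ... | no ¬∃ = total-case λ {x} lx → by-contradiction λ x∉ → ¬∃ (x , lx , x∉)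
      ... | yes (y , ly , y∉) = from-fragment (InL.fragment-subgroup gen 0∈A {0# ∷ []} {0#}
          (λ { (here e) → ⟨≈⟩ (G.sym e) ⟨0⟩ }) (here G.refl)
          (y , ly , λ y∈ → y∉ (⊆-⋆ 0∈A (suc n) (0⊞⊆ y∈))))
        where
        from-fragment : ∃ (InL.FragmentSubgroup gen 0∈A) → Kneser-bound k A
        from-fragment (Q , atom) = nontotal-case ly y∉ atom

  -- Induction on the bound `m` for `∣A∣`, since the smallest component is a proper subset.
  -- Translation by `- a` arranges `0# ∈ A` and only translates the multiple.
  kneser : ∀ n m {A a} → ♯ A ℕ.≤ m → a ∈ A → Aperiodicˢ ((2 ℕ.+ n) ⋆ˢ A) → Kneser-bound (2 ℕ.+ n) A
  kneser n zero    A≤0 a∈ _ = ⊥-elim (1≰0 (ℕₚ.≤-trans (♯≥1 a∈) A≤0))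
  kneser n (suc m) {A} {a} A≤1+m a∈ aperiodic = ≡.subst₂ (λ i j → k ℕ.* i ℕ.+ 1 ℕ.≤ j ℕ.+ k)
      (♯-shift (- a) A) (≡.trans (♯-cong (⋆-shift k) (⋆-shift⁻ k)) (♯-shift (k · (- a)) (k ⋆ˢ A)))
      (Step.kneser-step 0∈A′ n
          (λ B<A′ → kneser n m (ℕ.s≤s⁻¹ (ℕₚ.≤-trans B<A′ (≡.subst (ℕ._≤ suc m) (≡.sym (♯-shift (- a) A)) A≤1+m)))) aperiodic′)
    where
    k = 2 ℕ.+ n
    A′ = shift (- a) A
    u = k · (- a)
    0∈A′ : 0# ∈ A′
    0∈A′ = ∈-shift⁺ (∈-resp (solve 1 (λ a → a ⊜ 𝟘 ⊖ (⊝ a)) refl a) a∈)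
    aperiodic′ : Aperiodicˢ (k ⋆ˢ A′)
    aperiodic′ g stable = aperiodic g λ {x} x∈ → ∈-resp
        (solve 3 (λ u x g → ((u ⊕ x) ⊕ g) ⊖ u ⊜ x ⊕ g) refl u x g)
      (∈-shift⁻ (⋆-shift k (stable (⋆-shift⁻ k (∈-image⁺ G.∙-congˡ x∈)))))

-- From the predicates of the statement to lists.

module Transfer (em : ∀ {a} → ExcludedMiddle a) {c ℓ} (G : AbelianGroup c ℓ) where
  open Classical em
  open Sumsets em G
  open Generation em G
  open Structure em G using (Aperiodicˢ)
  private module G = AbelianGroup G
  open Subsets G using (_≈_; _+_; 0#; -_; _-_; _·_; Subset; HasSize; IsFragment; Aperiodic; _+ˢ_; _⋆_; IsArithmeticProgression; gen; ⟨-⟩_)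
    renaming (_⊕_ to _⊕ˢ_)
  open AbelianGroupSolver G

  hasSize⁺ : ∀ {A a} → A ≐ (_∈ a) → HasSize A (♯ a)
  hasSize⁺ {a = a} (A⊆ , ⊆A) with enumeration a
  ... | D , D! , D≡ , a⊆D , D⊆a = D , D! , D≡ , (λ x∈ → a⊆D (A⊆ x∈)) , λ x∈ → ⊆A (D⊆a x∈)

  hasSize⁻ : ∀ {A a n} → A ≐ (_∈ a) → HasSize A n → ♯ a ≡ n
  hasSize⁻ (A⊆ , ⊆A) (D , D! , D≡ , A⊆D , D⊆A) = ≡.trans
    (♯-cong (λ x∈ → A⊆D (⊆A x∈)) (λ x∈ → A⊆ (D⊆A x∈))) (≡.trans (♯-unique D!) D≡)

  finite-fragment : ∀ {S X} → IsFragment S X → ∃ λ a → X ≐ (_∈ a)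
  finite-fragment (_ , _ , _ , _ , _ , _ , (a , _ , _ , X≐a) , _) = a , X≐a

  ⊕≐⊞ : ∀ {A B a b} → A ≐ (_∈ a) → B ≐ (_∈ b) → (A ⊕ˢ B) ≐ (_∈ a ⊞ b)
  ⊕≐⊞ (A⊆ , ⊆A) (B⊆ , ⊆B) =
    (λ (x , y , x∈ , y∈ , e) → ∈-⊞⁺ (A⊆ x∈) (B⊆ y∈) e) ,
    λ z∈ → let x , y , x∈ , y∈ , e = ∈-⊞⁻ z∈ in x , y , ⊆A x∈ , ⊆B y∈ , e

  ⋆≐⋆ˢ : ∀ {A a} k → A ≐ (_∈ a) → (k ⋆ A) ≐ (_∈ k ⋆ˢ a)
  ⋆≐⋆ˢ zero    A≐a = (λ (lift e) → here e) , λ { (here e) → lift e }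
  ⋆≐⋆ˢ (suc k) A≐a = ⊕≐⊞ A≐a (⋆≐⋆ˢ k A≐a)

  -- A finite set stable under adding `g` is stable under subtracting it, so one inclusion already
  -- makes `g` a period.
  aperiodic⁻ : ∀ {A a} → A ≐ (_∈ a) → Aperiodic A → Aperiodicˢ a
  aperiodic⁻ {A} {a} (A⊆ , ⊆A) aperiodic g stable = proj₁ aperiodic (shift⊆ , ⊆shift)
    where
    shift⊆ : ∀ {x} → (g +ˢ A) x → A x
    shift⊆ (y , y∈ , x≈) = ⊆A (∈-resp (G.trans (G.comm y g) (G.sym x≈)) (stable (A⊆ y∈)))
    ⊆shift : ∀ {x} → A x → (g +ˢ A) x
    ⊆shift {x} x∈ = x - g , ⊆A
        (closed⇒⟨⟩-closed {B = _∈ (g ∷ [])} (λ { y∈ (here b≈) → ∈-resp (G.∙-congˡ (G.sym b≈)) (stable y∈) })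
      (A⊆ x∈) (⟨-⟩ gen (here G.refl))) , solve 2 (λ x g → x ⊜ g ⊕ (x ⊖ g)) refl x g

  progression-resp : ∀ {A B : Subset} → A ≐ B → IsArithmeticProgression B → IsArithmeticProgression A
  progression-resp (A⊆B , B⊆A) (a , d , m , 1≤m , B⊆ , ⊆B) =
    a , d , m , 1≤m , (λ x∈ → B⊆ (A⊆B x∈)) , λ x∈ → B⊆A (⊆B x∈)

  ♯≤2⇒progression : ∀ {A s} → s ∈ A → ♯ A ℕ.≤ 2 → IsArithmeticProgression (_∈ A)
  ♯≤2⇒progression {A} {s} s∈ A≤2 with em {P = ∃ λ t → t ∈ A × ¬ s ≈ t}
  ... | no ¬∃ = s , 0# , 1 , s≤s z≤n , to , from
    where
    to : ∀ {x} → x ∈ A → ∃ λ i → i ℕ.< 1 × x ≈ s + i · 0#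
    to x∈ = 0 , s≤s z≤n , G.trans (G.sym (by-contradiction λ s≉x → ¬∃ (_ , x∈ , s≉x))) (G.sym (G.identityʳ s))
    from : ∀ {x} → (∃ λ i → i ℕ.< 1 × x ≈ s + i · 0#) → x ∈ A
    from (zero , _ , x≈) = ∈-resp (G.sym (G.trans x≈ (G.identityʳ s))) s∈
    from (suc _ , s≤s () , _)
  ... | yes (t , t∈ , s≉t) = s , t - s , 2 , s≤s z≤n , to ∘ A⊆pair , from
    where
    A⊆pair : A ⊆ s ∷ t ∷ []
    A⊆pair = ⊆⇒⊇ (λ { (here e) → ∈-resp (G.sym e) s∈ ; (there (here e)) → ∈-resp (G.sym e) t∈ })
      (≡.subst (♯ A ℕ.≤_) (≡.sym (♯-pair s≉t)) A≤2)
    second : s + 1 · (t - s) ≈ t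
    second = solve 2 (λ s t → s ⊕ ((t ⊖ s) ⊕ 𝟘) ⊜ t) refl s t
    to : ∀ {x} → x ∈ s ∷ t ∷ [] → ∃ λ i → i ℕ.< 2 × x ≈ s + i · (t - s)
    to (here e)         = 0 , s≤s z≤n , G.trans e (G.sym (G.identityʳ s))
    to (there (here e)) = 1 , s≤s (s≤s z≤n) , G.trans e (G.sym second)
    from : ∀ {x} → (∃ λ i → i ℕ.< 2 × x ≈ s + i · (t - s)) → x ∈ A
    from (0 , _ , x≈)           = ∈-resp (G.sym (G.trans x≈ (G.identityʳ s))) s∈
    from (1 , _ , x≈)           = ∈-resp (G.sym (G.trans x≈ second)) t∈
    from (suc (suc _) , s≤s (s≤s ()) , _)

-- Integer and truncated differences as inequalities in ℕ.

⊖-≤⇒ : ∀ a b c d → a ℤ.⊖ b ℤ.≤ c ℤ.⊖ d → a ℕ.+ d ℕ.≤ c ℕ.+ b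
⊖-≤⇒ a b c d a⊖b≤c⊖d = ℕₚ.≮⇒≥ λ c+b<a+d → ℤₚ.<⇒≱ (begin-strict
  c ℤ.⊖ d                     ≡⟨ ℤₚ.+-cancelˡ-⊖ b c d ⟨
  (b ℕ.+ c) ℤ.⊖ (b ℕ.+ d)     <⟨ ℤₚ.⊖-monoˡ-< (b ℕ.+ d)
      (≡.subst₂ ℕ._<_ (ℕₚ.+-comm c b) (ℕₚ.+-comm a d) c+b<a+d) ⟩
  (d ℕ.+ a) ℤ.⊖ (b ℕ.+ d)     ≡⟨ ≡.cong ((d ℕ.+ a) ℤ.⊖_) (ℕₚ.+-comm b d) ⟩
  (d ℕ.+ a) ℤ.⊖ (d ℕ.+ b)     ≡⟨ ℤₚ.+-cancelˡ-⊖ d a b ⟩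
  a ℤ.⊖ b                     ∎) a⊖b≤c⊖d
  where open ℤₚ.≤-Reasoning

⇒⊖-≤ : ∀ a b c d → a ℕ.+ d ℕ.≤ c ℕ.+ b → a ℤ.⊖ b ℤ.≤ c ℤ.⊖ d
⇒⊖-≤ a b c d a+d≤c+b = begin
  a ℤ.⊖ b                     ≡⟨ ℤₚ.+-cancelˡ-⊖ d a b ⟨
  (d ℕ.+ a) ℤ.⊖ (d ℕ.+ b)     ≡⟨ ≡.cong ((d ℕ.+ a) ℤ.⊖_) (ℕₚ.+-comm d b) ⟩
  (d ℕ.+ a) ℤ.⊖ (b ℕ.+ d)     ≤⟨ ℤₚ.⊖-monoˡ-≤ (b ℕ.+ d)
      (≡.subst₂ ℕ._≤_ (ℕₚ.+-comm a d) (ℕₚ.+-comm c b) a+d≤c+b) ⟩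
  (b ℕ.+ c) ℤ.⊖ (b ℕ.+ d)     ≡⟨ ℤₚ.+-cancelˡ-⊖ b c d ⟩
  c ℤ.⊖ d                     ∎
  where open ℤₚ.≤-Reasoning

-- The increments of a are at least m - q, which is written without truncated subtraction.
increments : ∀ (a : ℕ → ℕ) {m q} n → (∀ j → j ℕ.< 2 ℕ.+ n → a j ℕ.+ m ℕ.≤ a (suc j) ℕ.+ q) →
             a (2 ℕ.+ n) ℕ.+ (2 ℕ.+ n) ℕ.* q ℕ.≤ (2 ℕ.+ n) ℕ.* m ℕ.+ q → a 2 ℕ.+ q ℕ.≤ m ℕ.+ m
-- The `n` increments from index 2 on take at least `n (m - q)` of the total, which leaves
-- `a 2 ≤ 2 (m - q) + q`.
increments a {m} {q} n step last = linarith 6 (λ u v m q nm nq →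
    u :+ nm :≤ v :+ nq ∷ v :+ (q :+ (q :+ nq)) :≤ (m :+ (m :+ nm)) :+ q ∷ [] ⊩ u :+ q :≤ m :+ m) _
  (a 2) (a (2 ℕ.+ n)) m q (n ℕ.* m) (n ℕ.* q) (climb n ℕₚ.≤-refl) last
  where
  climb : ∀ i → i ℕ.≤ n → a 2 ℕ.+ i ℕ.* m ℕ.≤ a (2 ℕ.+ i) ℕ.+ i ℕ.* q
  climb zero    _   = ℕₚ.≤-refl
  climb (suc i) i<n = linarith 7 (λ u v w m q im iq → u :+ im :≤ v :+ iq ∷ v :+ m :≤ w :+ q ∷ []
      ⊩ u :+ (m :+ im) :≤ w :+ (q :+ iq)) _
    (a 2) (a (2 ℕ.+ i)) (a (3 ℕ.+ i)) m q (i ℕ.* m) (i ℕ.* q)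
    (climb i (ℕₚ.<⇒≤ i<n)) (step (2 ℕ.+ i) (s≤s (s≤s i<n)))

-- From `1 ≤ m` follows `k ≤ k * m`, so the truncated difference is the true one.
truncated-size : ∀ k m {x} → 1 ℕ.≤ m → x ≡ k ℕ.* m ℕ.∸ k ℕ.+ 1 → x ℕ.+ k ≡ k ℕ.* m ℕ.+ 1
truncated-size k m {x} 1≤m refl = begin
  k ℕ.* m ℕ.∸ k ℕ.+ 1 ℕ.+ k    ≡⟨ ℕₚ.+-assoc (k ℕ.* m ℕ.∸ k) 1 k ⟩
  k ℕ.* m ℕ.∸ k ℕ.+ (1 ℕ.+ k)  ≡⟨ ≡.cong (k ℕ.* m ℕ.∸ k ℕ.+_) (ℕₚ.+-comm 1 k) ⟩
  k ℕ.* m ℕ.∸ k ℕ.+ (k ℕ.+ 1)  ≡⟨ ℕₚ.+-assoc (k ℕ.* m ℕ.∸ k) k 1 ⟨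
  k ℕ.* m ℕ.∸ k ℕ.+ k ℕ.+ 1    ≡⟨ ≡.cong (ℕ._+ 1) (ℕₚ.m∸n+n≡m (ℕₚ.m≤m*n k m {{ℕ.>-nonZero 1≤m}})) ⟩
  k ℕ.* m ℕ.+ 1                ∎
  where open ≡.≡-Reasoning

truncated-size⁻ : ∀ k m {x} → 1 ℕ.≤ m → x ℕ.+ k ≡ k ℕ.* m ℕ.+ 1 → x ≡ k ℕ.* m ℕ.∸ k ℕ.+ 1
truncated-size⁻ k m {x} 1≤m eq =
  ℕₚ.+-cancelʳ-≡ k x _ (≡.trans eq (≡.sym (truncated-size k m 1≤m refl)))

-- Counting in the quotient.

module Cosets (em : ∀ {a} → ExcludedMiddle a) {c ℓ} (G : AbelianGroup c ℓ)
  {H : Subsets.Subset G} (isH : Subsets.IsSubgroup G H)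
  {Q : List (AbelianGroup.Carrier G)} (H≐Q : H ≐ FiniteSets.Elements em G Q) where

  open Classical em
  open Sumsets em G
  private module G = AbelianGroup G
  open Subsets G using (_≈_; IsSubgroup)
  open AbelianGroupSolver G
  open IsSubgroup isH
  open Quotient G H isH
  module B = Sumsets em G/H
  private module G/H = AbelianGroup G/H

  ≈⇒≈ᴴ : ∀ {x y} → x ≈ y → x ≈ᴴ y
  ≈⇒≈ᴴ e = resp (G.trans (G.sym (G.inverseʳ _)) (G.∙-congʳ (G.sym e))) 0-mem

  ∈⇒∈ᴴ : ∀ {X x} → x ∈ X → x B.∈ X
  ∈⇒∈ᴴ = Any.map ≈⇒≈ᴴ

  -- `G/H` has the carrier of `G`, so the same list `X` also represents the image of `X`, and
  -- `X ⊞ Q` is the preimage of that image.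
  saturated⇒∈ᴴ : ∀ {X x} → x ∈ X ⊞ Q → x B.∈ X
  saturated⇒∈ᴴ {X} x∈ with ∈-⊞⁻ x∈
  ... | a , q , a∈ , q∈ , x≈ = B.∈-resp {X} (G/H.sym x~a) (∈⇒∈ᴴ a∈)
    where
    x~a : _ ≈ᴴ a
    x~a = resp (G.trans (solve 2 (λ a q → q ⊜ (a ⊕ q) ⊖ a) refl a q) (G.∙-congʳ (G.sym x≈))) (proj₂ H≐Q q∈)

  ∈ᴴ⇒saturated : ∀ {X x} → x B.∈ X → x ∈ X ⊞ Q
  ∈ᴴ⇒saturated {a ∷ X} {x} (here x~a) =
    ∈-⊞⁺ (here G.refl) (proj₁ H≐Q x~a) (solve 2 (λ a x → x ⊜ a ⊕ (x ⊖ a)) refl a x)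
  ∈ᴴ⇒saturated (there x∈) = ⊞-mono there id (∈ᴴ⇒saturated x∈)

  -- ∣X + H∣ = ∣φ(X)∣ ∣H∣
  ♯-saturation-count : ∀ X → ♯ (X ⊞ Q) ≡ B.♯ X ℕ.* ♯ Q
  ♯-saturation-count X with B.enumeration X
  ... | D , D! , D≡ , X⊆D , D⊆X = ≡.trans
      (♯-cong (∈ᴴ⇒saturated ∘ X⊆D ∘ saturated⇒∈ᴴ) (∈ᴴ⇒saturated ∘ D⊆X ∘ saturated⇒∈ᴴ))
    (≡.trans (count D!) (≡.cong (ℕ._* ♯ Q) D≡))
    where
    count : ∀ {D} → Unique G/H.setoid D → ♯ (D ⊞ Q) ≡ length D ℕ.* ♯ Q
    count {[]} _ = ℕₚ.n≤0⇒n≡0 (ℕₚ.≮⇒≥ λ 0<♯ → absurd (♯≥1⁻ 0<♯))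
      where
      absurd : ∃ (_∈ [] ⊞ Q) → ⊥
      absurd (x , x∈) with ∈-⊞⁻ x∈
      ... | _ , _ , () , _
    count {d ∷ D} (d∉ ∷ D!) = ≡.trans (♯-cong split merge)
      (≡.trans (♯-⊎ disjoint) (≡.cong₂ ℕ._+_ (♯-shift d Q) (count D!)))
      where
      split : (d ∷ D) ⊞ Q ⊆ shift d Q ∪ D ⊞ Q
      split x∈ with ∈-⊞⁻ x∈
      ... | a , q , here a≈ , q∈ , x≈ = ∈-∪ˡ (∈-shift⁺ (∈-resp
        (G.trans (solve 2 (λ d q → q ⊜ (d ⊕ q) ⊖ d) refl d q)
            (G.∙-congʳ (G.sym (G.trans x≈ (G.∙-congʳ a≈))))) q∈))
      ... | a , q , there a∈ , q∈ , x≈ = ∈-∪ʳ (∈-⊞⁺ a∈ q∈ x≈)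
      merge : shift d Q ∪ D ⊞ Q ⊆ (d ∷ D) ⊞ Q
      merge {x} x∈ = [ (λ p → ∈-⊞⁺ (here G.refl) (∈-shift⁻ p) (solve 2 (λ d x → x ⊜ d ⊕ (x ⊖ d)) refl d x))
                     , ⊞-mono there id ]′ (∈-∪⁻ x∈)
      disjoint : ∀ {x} → x ∈ shift d Q → x ∉ D ⊞ Q
      disjoint x∈ x∈′ = All¬⇒¬Any d∉ (B.∈-resp {D} (proj₂ H≐Q (∈-shift⁻ x∈)) (saturated⇒∈ᴴ x∈′))

  ⊞ᴴ⇒saturated : ∀ {X Y x} → x B.∈ X B.⊞ Y → x ∈ (X ⊞ Q) ⊞ Y
  ⊞ᴴ⇒saturated x∈ with B.∈-⊞⁻ x∈
  ... | a , b , a∈ , b∈ , x~ with ∈-⊞⁻ (∈ᴴ⇒saturated a∈) | ∈-⊞⁻ (∈ᴴ⇒saturated b∈)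
  ...   | a′ , p , a′∈ , p∈ , a≈ | b′ , q , b′∈ , q∈ , b≈ =
    ∈-⊞⁺ (∈-⊞⁺ a′∈ (proj₁ H≐Q (+-closed x~ (+-closed (proj₂ H≐Q p∈) (proj₂ H≐Q q∈)))) G.refl) b′∈
      (G.trans (solve 3 (λ x a b → x ⊜ (a ⊕ b) ⊕ (x ⊖ (a ⊕ b))) refl _ a b)
        (G.trans (G.∙-congʳ (G.∙-cong a≈ b≈))
            (solve 5 (λ a p b q h → ((a ⊕ p) ⊕ (b ⊕ q)) ⊕ h ⊜ (a ⊕ (h ⊕ (p ⊕ q))) ⊕ b) refl a′ p b′ q _)))

  saturated⇒⊞ᴴ : ∀ {X Y x} → x ∈ (X ⊞ Q) ⊞ Y → x B.∈ X B.⊞ Y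
  saturated⇒⊞ᴴ x∈ with ∈-⊞⁻ x∈
  ... | a , b , a∈ , b∈ , x≈ = B.∈-⊞⁺ (saturated⇒∈ᴴ a∈) (∈⇒∈ᴴ b∈) (≈⇒≈ᴴ x≈)

  ♯-⊞ᴴ : ∀ X Y → ♯ ((X ⊞ Q) ⊞ Y) ≡ B.♯ (X B.⊞ Y) ℕ.* ♯ Q
  ♯-⊞ᴴ X Y = ≡.trans (♯-cong (∈ᴴ⇒saturated ∘ saturated⇒⊞ᴴ) (⊞ᴴ⇒saturated ∘ saturated⇒∈ᴴ))
      (♯-saturation-count (X B.⊞ Y))

-- The hyper-atom and the proof of the three parts.

module HyperAtoms (em : ∀ {a} → ExcludedMiddle a) {c ℓ} (G : AbelianGroup c ℓ)
  {S : Subsets.Subset G} {A : List (AbelianGroup.Carrier G)} (S≐A : S ≐ FiniteSets.Elements em G A)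
  {H : Subsets.Subset G} (hyperAtom : Subsets.IsHyperAtom G S H)
  {Q : List (AbelianGroup.Carrier G)} (H≐Q : H ≐ FiniteSets.Elements em G Q)
  {a : AbelianGroup.Carrier G} (a∈ : FiniteSets.Elements em G A a) where

  open Classical em
  open Sumsets em G
  open Generation em G
  open Structure em G
  open Transfer em G
  private module G = AbelianGroup G
  open Subsets G using (Carrier; _≈_; _+_; 0#; -_; _-_; _·_; Subset; HasSize; Contributes; IsSubgroup;
    IsHyperAtom; IsArithmeticProgression; Generates; whole; IsComponent; IsSmallestComponent; _+ˢ_; _-ˢ_; _⋆_)
    renaming (_⊕_ to _⊕ˢ_; _⊝_ to _⊝ˢ_)
  open AbelianGroupSolver G
  open IsSubgroup
  private module H = IsHyperAtom hyperAtom

  isQ : IsSubgroup (_∈ Q)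
  isQ = record
    { resp       = ∈-resp
    ; 0-mem      = proj₁ H≐Q (0-mem H.isSubgroup)
    ; +-closed   = λ x∈ y∈ → proj₁ H≐Q (+-closed H.isSubgroup (proj₂ H≐Q x∈) (proj₂ H≐Q y∈))
    ; neg-closed = λ x∈ → proj₁ H≐Q (neg-closed H.isSubgroup (proj₂ H≐Q x∈))
    }

  private
    z : ℤ
    z = proj₁ H.isFragment

    z≡ : z ≡ ♯ (Q ⊞ A) ℤ.⊖ ♯ Q
    z≡ with H.isFragment
    ... | _ , _ , _ , _ , m , n , H-size , sum-size , eq =
      ≡.trans eq (≡.sym (≡.cong₂ ℤ._⊖_ (hasSize⁻ (⊕≐⊞ H≐Q S≐A) sum-size) (hasSize⁻ H≐Q H-size)))

    contributes : ∀ {X x y} → x ∈ X → y ∉ X ⊞ A → Contributes S (_∈ X) (♯ (X ⊞ A) ℤ.⊖ ♯ X)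
    contributes {X} {x} {y} x∈ y∉ = (x , x∈) , (λ all → y∉ (proj₁ X⊕S (all y))) ,
      ♯ X , ♯ (X ⊞ A) , hasSize , hasSize⁺ X⊕S , refl
      where
      X⊕S : ((_∈ X) ⊕ˢ S) ≐ (_∈ X ⊞ A)
      X⊕S = ⊕≐⊞ ((λ x∈ → x∈) , λ x∈ → x∈) S≐A

  misses : ∃ λ y → y ∉ Q ⊞ A
  misses with H.isFragment
  ... | _ , _ , _ , ¬total , _ = by-contradiction λ ¬∃ → ¬total λ y →
    proj₂ (⊕≐⊞ H≐Q S≐A) (by-contradiction λ y∉ → ¬∃ (y , y∉))

  expands : ∀ {X x y} → x ∈ X → y ∉ X ⊞ A → ♯ (Q ⊞ A) ℕ.+ ♯ X ℕ.≤ ♯ (X ⊞ A) ℕ.+ ♯ Q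
  expands {X} x∈ y∉ = ⊖-≤⇒ (♯ (Q ⊞ A)) (♯ Q) (♯ (X ⊞ A)) (♯ X)
    (≡.subst (ℤ._≤ _) z≡ (proj₂ (proj₁ (proj₂ H.isFragment)) (_∈ X) _ (contributes x∈ y∉)))

  A⊆Q⊞A : A ⊆ Q ⊞ A
  A⊆Q⊞A {x} x∈ = ∈-⊞⁺ (0-mem isQ) x∈ (G.sym (G.identityˡ x))

  small : suc (♯ (Q ⊞ A)) ℕ.≤ ♯ Q ℕ.+ ♯ A
  small = linarith 5 (λ u q o b z → u :+ o :≤ b :+ q ∷ b :≤ z ∷ con 1 :≤ o ∷ [] ⊩ con 1 :+ u :≤ q :+ z) _
    (♯ (Q ⊞ A)) (♯ Q) (♯ (0# ∷ [])) (♯ ((0# ∷ []) ⊞ A)) (♯ A)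
    (expands (here G.refl) λ y∈ → proj₂ misses (A⊆Q⊞A (0⊞⊆ y∈))) (♯-mono 0⊞⊆) (♯≥1 {x = 0#} (here G.refl))

  -- Such a `K` attains the minimum and is itself a fragment, so the maximality of the hyper-atom
  -- applies. This supplies the condition on subgroups in the Vosper type theorem, both in `G` and
  -- in `G/H`.
  maximal-fragment : ∀ {K y} → IsSubgroup (_∈ K) → Q ⊆ K → y ∉ K ⊞ A →
                     ♯ (K ⊞ A) ℕ.+ ♯ Q ℕ.≤ ♯ (Q ⊞ A) ℕ.+ ♯ K → K ⊆ Q
  maximal-fragment {K} isK Q⊆K y∉ K≤Q x∈ = proj₁ H≐Q
    (H.maximal (_∈ K) isK
        (z , proj₁ (proj₂ H.isFragment) , ≡.subst (Contributes S (_∈ K)) (≡.sym K≡z) contribution)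
      (λ h → Q⊆K (proj₁ H≐Q h)) x∈)
    where
    contribution = contributes (0-mem isK) y∉
    K≡z : z ≡ ♯ (K ⊞ A) ℤ.⊖ ♯ K
    K≡z = ℤₚ.≤-antisym (proj₂ (proj₁ (proj₂ H.isFragment)) (_∈ K) _ contribution)
      (≡.subst (_ ℤ.≤_) (≡.sym z≡) (⇒⊖-≤ (♯ (K ⊞ A)) (♯ K) (♯ (Q ⊞ A)) (♯ Q) K≤Q))

  generating : Generates (S ⊝ˢ S) → ∀ {K : Subset} → IsSubgroup K → ∀ {t} →
      (∀ {s} → s ∈ A → K (s - t)) → ∀ x → K x
  generating gens {K} isK {t} A-t⊆K x = ⟨⟩-least isK S⊝S⊆K (gens x)
    where
    S⊝S⊆K : ∀ {x} → (S ⊝ˢ S) x → K x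
    S⊝S⊆K (a , b , a∈ , b∈ , x≈) = resp isK
      (G.trans (solve 3 (λ a b t → (a ⊖ t) ⊖ (b ⊖ t) ⊜ a ⊖ b) refl a b t) (G.sym x≈))
      (+-closed isK (A-t⊆K (proj₁ S≐A a∈)) (neg-closed isK (A-t⊆K (proj₁ S≐A b∈))))

  -- The case of a zero hyper-atom.

  module Trivial (Q-trivial : ∀ {q} → q ∈ Q → q ≈ 0#) (gens : Generates (S ⊝ˢ S))
    (¬progression : ¬ IsArithmeticProgression S) (n : ℕ) (aperiodic : Aperiodicˢ ((2 ℕ.+ n) ⋆ˢ A))
    (size : ♯ ((2 ℕ.+ n) ⋆ˢ A) ℕ.+ (2 ℕ.+ n) ≡ (2 ℕ.+ n) ℕ.* ♯ A ℕ.+ 1) where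

    private
      k = 2 ℕ.+ n

      Q≤1 : ♯ Q ℕ.≤ 1
      Q≤1 = ≡.subst (♯ Q ℕ.≤_) (♯-singleton 0#) (♯-mono λ q∈ → here (Q-trivial q∈))

      A≤Q⊞A : ♯ A ℕ.≤ ♯ (Q ⊞ A)
      A≤Q⊞A = ♯-mono A⊆Q⊞A

      expands₁ : ∀ {X x y} → x ∈ X → y ∉ X ⊞ A → ♯ X ℕ.+ ♯ A ℕ.≤ ♯ (X ⊞ A) ℕ.+ 1
      expands₁ {X} x∈ y∉ = linarith 5 (λ a u x v q → u :+ x :≤ v :+ q ∷ a :≤ u ∷ q :≤ con 1 ∷ []
          ⊩ x :+ a :≤ v :+ con 1) _
        (♯ A) (♯ (Q ⊞ A)) (♯ X) (♯ (X ⊞ A)) (♯ Q) (expands x∈ y∉) A≤Q⊞A Q≤1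

      3≤A : 3 ℕ.≤ ♯ A
      3≤A = ℕₚ.≰⇒> λ A≤2 → ¬progression (progression-resp S≐A (♯≤2⇒progression a∈ A≤2))

      total-step : ∀ {j} → (∀ x → x ∈ j ⋆ˢ A) → ∀ x → x ∈ suc j ⋆ˢ A
      total-step total x = ∈-⊞⁺ a∈ (total (x - a)) (solve 2 (λ x a → x ⊜ a ⊕ (x ⊖ a)) refl x a)

      total-steps : ∀ i {j} → (∀ x → x ∈ j ⋆ˢ A) → ∀ x → x ∈ (i ℕ.+ j) ⋆ˢ A
      total-steps zero    total = total
      total-steps (suc i) {j} total = total-step {i ℕ.+ j} (total-steps i total)

      not-total : ¬ (∀ x → x ∈ k ⋆ˢ A)
      not-total total with ♯≥2⁻ {A} (ℕₚ.≤-trans (s≤s (s≤s z≤n)) 3≤A) 0#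
      ... | b , _ , b≉0 = b≉0 (aperiodic b λ _ → total _)

      missing : ∀ j → j ℕ.≤ k → ∃ λ y → y ∉ j ⋆ˢ A
      missing j j≤k = by-contradiction λ ¬∃ → not-total λ x → ≡.subst (λ i → x ∈ i ⋆ˢ A) (ℕₚ.m∸n+n≡m j≤k)
        (total-steps (k ℕ.∸ j) (λ y → by-contradiction λ y∉ → ¬∃ (y , y∉)) x)

      element : ∀ j → ∃ (_∈ j ⋆ˢ A)
      element zero    = 0# , here G.refl
      element (suc j) = _ , ∈-⊞⁺ a∈ (proj₂ (element j)) G.refl

      step : ∀ j → j ℕ.< k → ♯ (j ⋆ˢ A) ℕ.+ ♯ A ℕ.≤ ♯ (suc j ⋆ˢ A) ℕ.+ 1
      step j j<k = ≡.subst (λ m → ♯ (j ⋆ˢ A) ℕ.+ ♯ A ℕ.≤ m ℕ.+ 1) (♯-⊞-comm (j ⋆ˢ A) A)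
        (expands₁ (proj₂ (element j)) (proj₂ (missing (suc j) j<k) ∘ ⊞-comm))

      small-double : suc (♯ (A ⊞ A)) ℕ.≤ ♯ A ℕ.+ ♯ A
      small-double = ≡.subst (ℕ._≤ ♯ A ℕ.+ ♯ A) (≡.trans (ℕₚ.+-comm _ 1) (≡.cong suc (♯-double A)))
        (increments (λ j → ♯ (j ⋆ˢ A)) n step
          (ℕₚ.≤-reflexive (≡.trans (≡.cong (♯ (k ⋆ˢ A) ℕ.+_) (ℕₚ.*-identityʳ k)) size)))

    y₀ : Carrier
    y₀ = proj₁ (missing 2 (s≤s (s≤s z≤n)))

    y₀∉ : y₀ ∉ A ⊞ A
    y₀∉ = proj₂ (missing 2 (s≤s (s≤s z≤n))) ∘ ⊞⊆double

    private
      open Vosper em G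

      vosperian : ∀ {z} → z ∉ A ⊞ A → ¬ y₀ ≈ z → Vosperian A
      vosperian {z} z∉ y₀≉z = record
        { small     = small-double
        ; subgroups = λ {K} isK q∈ q≉0 y∉ → by-contradiction λ K>A → q≉0 (Q-trivial (maximal-fragment isK
            (λ q∈ → resp isK (G.sym (Q-trivial q∈)) (0-mem isK)) y∉
            (linarith 5 (λ u q v κ a → con 1 :+ u :≤ κ :+ a ∷ q :≤ con 1 ∷ a :≤ v ∷ [] ⊩ u :+ q :≤ v :+ κ) _
              (♯ (K ⊞ A)) (♯ Q) (♯ (Q ⊞ A)) (♯ K) (♯ A) (ℕₚ.≰⇒> K>A) Q≤1 A≤Q⊞A) q∈))
        ; generates = λ isK _ → generating gens isK
        ; y         = y₀
        ; z         = z
        ; y∉        = y₀∉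
        ; z∉        = z∉
        ; y≉z       = y₀≉z
        }

      M : FSet
      M = (y₀ ∷ []) ∪ A ⊞ A

      -- A second element outside `A + A`, next to `y₀`, would make `S` a progression by `vosper`.
      covers : ∀ x → x ∈ M
      covers x with em {P = x ∈ A ⊞ A}
      ... | yes x∈ = ∈-∪ʳ x∈
      ... | no  x∉ = ∈-∪ˡ (here (G.sym (by-contradiction λ y₀≉x →
        ¬progression (progression-resp S≐A (vosper (vosperian x∉ y₀≉x) 3≤A)))))

      ♯-M : ♯ M ≡ suc (♯ (A ⊞ A))
      ♯-M = ≡.trans (♯-⊎ λ { (here e) → y₀∉ ∘ ∈-resp e }) (≡.cong (ℕ._+ ♯ (A ⊞ A)) (♯-singleton y₀))

    whole-size : HasSize whole (suc (♯ (A ⊞ A)))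
    whole-size = ≡.subst (HasSize whole) ♯-M (hasSize⁺ ((λ {x} _ → covers x) , λ _ → _))

    -- `A` and `reflect y₀ A` are disjoint because `y₀` is not in `A + A`. Together they have
    -- `2∣A∣ ≥ ∣2A∣ + 1` elements, which is the order of the group.
    reflection : ∀ x → x ∈ A ⊎ y₀ - x ∈ A
    reflection x = [ inj₁ , inj₂ ∘ ∈-reflect⁻ ]′ (∈-∪⁻ (⊆⇒⊇ {A ∪ reflect y₀ A} {M} (λ {x} _ → covers x)
      (≡.subst₂ ℕ._≤_ (≡.sym ♯-M) (≡.sym (≡.trans (♯-⊎ λ {x} x∈ x∈′ → y₀∉ (∈-⊞⁺ x∈ (∈-reflect⁻ x∈′)
        (solve 2 (λ x y → y ⊜ x ⊕ (y ⊖ x)) refl x y₀))) (≡.cong (♯ A ℕ.+_) (♯-reflect y₀ A)))) small-double)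
      (covers x)))

    -- For `k ≥ 3` the triple sum would miss an element, so `∣3A∣ ≤ ∣G∣ - 1 = ∣2A∣`; but a step adds
    -- at least `∣A∣ - 1 ≥ 2`.
    n≡0 : n ≡ 0
    n≡0 = ℕₚ.n≤0⇒n≡0 (ℕₚ.≮⇒≥ λ 0<n → 1≰0 (linarith 4 (λ u a v m → u :+ a :≤ v :+ con 1 ∷ con 1 :+ v :≤ m ∷
        m :≤ con 1 :+ u ∷ con 3 :≤ a ∷ []
        ⊩ con 1 :≤ con 0) _
      (♯ (2 ⋆ˢ A)) (♯ A) (♯ (3 ⋆ˢ A)) (♯ M) (step 2 (s≤s (s≤s 0<n)))
      (ℕₚ.≰⇒> λ M≤ → proj₂ (missing 3 (s≤s (s≤s 0<n))) (⊆⇒⊇ {3 ⋆ˢ A} {M} (λ {x} _ → covers x) M≤ (covers _)))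
      (ℕₚ.≤-reflexive (≡.trans ♯-M (≡.cong suc (≡.sym (♯-double A))))) 3≤A))

  component : ∀ {s} → s ∈ A → IsComponent H S (_∈ A ∩ shift s Q)
  component {s} s∈ = (s , ∈-∩⁺ s∈ (∈-shift⁺ (diff-refl isQ s))) , s ,
    (λ x∈ → let x∈A , x∈s+Q = ∈-∩⁻ x∈ in proj₂ S≐A x∈A , _ , proj₂ H≐Q (∈-shift⁻ x∈s+Q) , solve 2 (λ x s → x ⊜ s ⊕ (x ⊖ s)) refl _ s) ,
    λ (x∈S , h , h∈ , x≈) → ∈-∩⁺ (proj₁ S≐A x∈S)
      (∈-shift⁺ (∈-resp (G.trans (solve 2 (λ s h → h ⊜ (s ⊕ h) ⊖ s) refl s h) (G.∙-congʳ (G.sym x≈)))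
          (proj₁ H≐Q h∈)))

  component≐ : ∀ {T : Subset} {x t} → T ≐ (S ∩ᵖ (x +ˢ H)) → T t → T ≐ (_∈ A ∩ shift t Q)
  component≐ {T} {x} {t} (T⊆ , ⊆T) t∈T with T⊆ t∈T
  ... | _ , h₀ , h₀∈ , t≈ = to , from
    where
    to : ∀ {y} → T y → y ∈ A ∩ shift t Q
    to y∈T with T⊆ y∈T
    ... | y∈S , h , h∈ , y≈ = ∈-∩⁺ (proj₁ S≐A y∈S) (∈-shift⁺ (∈-resp
      (G.trans (solve 3 (λ x h h₀ → h ⊖ h₀ ⊜ (x ⊕ h) ⊖ (x ⊕ h₀)) refl x h h₀)
          (G.∙-cong (G.sym y≈) (G.⁻¹-cong (G.sym t≈))))
      (+-closed isQ (proj₁ H≐Q h∈) (neg-closed isQ (proj₁ H≐Q h₀∈)))))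
    from : ∀ {y} → y ∈ A ∩ shift t Q → T y
    from {y} y∈ with ∈-∩⁻ y∈
    ... | y∈A , y∈t+Q = ⊆T
        (proj₂ S≐A y∈A , h₀ + (y - t) , proj₂ H≐Q (+-closed isQ (proj₁ H≐Q h₀∈) (∈-shift⁻ y∈t+Q)) ,
      G.trans (solve 2 (λ y t → y ⊜ t ⊕ (y ⊖ t)) refl y t) (G.trans (G.∙-congʳ t≈) (G.assoc x h₀ (y - t))))

  -- The smallest component and part (b).

  module Component (gens : Generates (S ⊝ˢ S)) {S₀ : Subset} (smallest : IsSmallestComponent H S S₀) where

    private
      t₀ : Carrier
      t₀ = proj₁ (proj₁ (proj₁ smallest))

    A₀ : FSet
    A₀ = A ∩ shift t₀ Q

    S₀≐A₀ : S₀ ≐ (_∈ A₀)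
    S₀≐A₀ = component≐ (proj₂ (proj₂ (proj₁ smallest))) (proj₂ (proj₁ (proj₁ smallest)))

    private
      t₀∈ : t₀ ∈ A
      t₀∈ = proj₁ (∈-∩⁻ (proj₁ S₀≐A₀ (proj₂ (proj₁ (proj₁ smallest)))))

      A₀-smallest : ∀ {s} → s ∈ A → ♯ A₀ ℕ.≤ ♯ (A ∩ shift s Q)
      A₀-smallest {s} s∈ with proj₂ smallest
      ... | m , sized , minimal = ≡.subst (ℕ._≤ ♯ (A ∩ shift s Q)) (≡.sym (hasSize⁻ S₀≐A₀ sized))
        (minimal (_∈ A ∩ shift s Q) _ (component s∈) hasSize)

      spread : ∃ λ s → s ∈ A × ¬ (s - t₀ ∈ Q)
      -- If `A` lay in one coset of `Q`, generation would make `Q` the whole group, although `Q + A`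
      -- misses an element.
      spread = by-contradiction λ ¬∃ → single λ {s} s∈ → by-contradiction λ ∉ → ¬∃ (s , s∈ , ∉)
        where
        single : (∀ {s} → s ∈ A → s - t₀ ∈ Q) → ⊥
        single A⊆ = proj₂ misses (∈-⊞⁺ (generating gens isQ A⊆ (proj₁ misses - t₀)) t₀∈
          (solve 2 (λ y t → y ⊜ (y ⊖ t) ⊕ t) refl (proj₁ misses) t₀))

    fragment : Fragment whole Q A
    fragment = record
      { isL      = whole-subgroup
      ; isQ      = isQ
      ; S⊑L      = _
      ; Q⊑L      = _
      ; small    = small
      ; expands  = λ _ x∈ _ y∉ → expands x∈ y∉
      ; s₀       = t₀
      ; s₁       = proj₁ spread
      ; s₀∈      = t₀∈
      ; s₁∈      = proj₁ (proj₂ spread)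
      ; spread   = proj₂ (proj₂ spread)
      ; smallest = A₀-smallest
      }

    -- Equality in the count forces `Q + A` to be `D` together with the coset of `t₀`. Adding `Q` to
    -- `D` never reaches that coset, so it stays in `D`.
    periodic : ♯ A₀ ℕ.+ ♯ (Q ⊞ A) ℕ.≤ ♯ A ℕ.+ ♯ Q → ((S ∖ᵖ S₀) ⊕ˢ H) ≐ (S ∖ᵖ S₀)
    periodic tight = to , from
      where
      D = A ∖ shift t₀ Q
      ⊆D : ∀ {x} → (S ∖ᵖ S₀) x → x ∈ D
      ⊆D (x∈S , x∉S₀) = ∈-∖⁺ (proj₁ S≐A x∈S) λ x∈ → x∉S₀ (proj₂ S₀≐A₀ (∈-∩⁺ (proj₁ S≐A x∈S) x∈))
      D⊆ : ∀ {x} → x ∈ D → (S ∖ᵖ S₀) x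
      D⊆ x∈ with ∈-∖⁻ x∈
      ... | x∈A , x∉ = proj₂ S≐A x∈A , λ x∈S₀ → x∉ (proj₂ (∈-∩⁻ (proj₁ S₀≐A₀ x∈S₀)))
      Q⊞A⊆ : Q ⊞ A ⊆ D ∪ shift t₀ Q
      Q⊞A⊆ = ⊆⇒⊇ (∪-least (A⊆Q⊞A ∘ proj₁ ∘ ∈-∖⁻) (shift⊆⊞ isQ t₀∈))
        (≡.subst (♯ (Q ⊞ A) ℕ.≤_) (≡.sym (≡.trans (♯-⊎ (proj₂ ∘ ∈-∖⁻)) (≡.cong (♯ D ℕ.+_) (♯-shift t₀ Q))))
          (linarith 5 (λ z u a q d → z :+ u :≤ a :+ q ∷ a :≤ z :+ d ∷ [] ⊩ u :≤ d :+ q) _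
            (♯ A₀) (♯ (Q ⊞ A)) (♯ A) (♯ Q) (♯ D) tight (ℕₚ.≤-reflexive (♯-∩+∖ A (shift t₀ Q)))))
      to : ∀ {y} → ((S ∖ᵖ S₀) ⊕ˢ H) y → (S ∖ᵖ S₀) y
      to {y} (x , h , x∈ , h∈ , y≈) = D⊆
        ([ id , (λ y∈ → ⊥-elim (proj₂ (∈-∖⁻ (⊆D x∈)) (∈-shift⁺ (∈-resp
            (G.trans (G.∙-congʳ (G.∙-congʳ y≈)) (solve 3 (λ x h t → ((x ⊕ h) ⊖ t) ⊖ h ⊜ x ⊖ t) refl x h t₀))
            (+-closed isQ (∈-shift⁻ y∈) (neg-closed isQ (proj₁ H≐Q h∈))))))) ]′
          (∈-∪⁻ (Q⊞A⊆ (∈-⊞⁺ (proj₁ H≐Q h∈) (proj₁ (∈-∖⁻ (⊆D x∈))) (G.trans y≈ (G.comm x h))))))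
      from : ∀ {y} → (S ∖ᵖ S₀) y → ((S ∖ᵖ S₀) ⊕ˢ H) y
      from {y} y∈ = y , 0# , y∈ , proj₂ H≐Q (0-mem isQ) , G.sym (G.identityʳ y)

    module _ (Q-trivial : ∀ {q} → q ∈ Q → q ≈ 0#) where
      private
        A₀⊆ : A₀ ⊆ t₀ ∷ []
        A₀⊆ {x} x∈ = here (G.trans (solve 2 (λ x t → x ⊜ (x ⊖ t) ⊕ t) refl x t₀)
          (G.trans (G.∙-congʳ (Q-trivial (∈-shift⁻ (proj₂ (∈-∩⁻ x∈))))) (G.identityˡ t₀)))

      trivial-tight : ♯ A₀ ℕ.+ ♯ (Q ⊞ A) ℕ.≤ ♯ A ℕ.+ ♯ Q
      trivial-tight = linarith 4 (λ z u a q → z :≤ con 1 ∷ u :≤ a ∷ con 1 :≤ q ∷ [] ⊩ z :+ u :≤ a :+ q) _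
        (♯ A₀) (♯ (Q ⊞ A)) (♯ A) (♯ Q)
        (≡.subst (♯ A₀ ℕ.≤_) (♯-singleton t₀) (♯-mono A₀⊆)) (♯-mono Q⊞A⊆A) (♯≥1 (0-mem isQ))
        where
        Q⊞A⊆A : Q ⊞ A ⊆ A
        Q⊞A⊆A x∈ with ∈-⊞⁻ x∈
        ... | q , b , q∈ , b∈ , x≈ = ∈-resp
            (G.sym (G.trans x≈ (G.trans (G.∙-congʳ (Q-trivial q∈)) (G.identityˡ b)))) b∈

      trivial-size : ∀ k → ♯ (k ⋆ˢ A₀) ℕ.+ k ≡ k ℕ.* ♯ A₀ ℕ.+ 1
      trivial-size k = ≡.trans (≡.cong (ℕ._+ k) ♯-multiple) (≡.trans (ℕₚ.+-comm 1 k)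
        (≡.cong (ℕ._+ 1) (≡.trans (≡.sym (ℕₚ.*-identityʳ k)) (≡.cong (k ℕ.*_) (≡.sym ♯-A₀)))))
        where
        t₀∈A₀ : t₀ ∈ A₀
        t₀∈A₀ = ∈-∩⁺ t₀∈ (∈-shift⁺ (diff-refl isQ t₀))
        ♯-A₀ : ♯ A₀ ≡ 1
        ♯-A₀ = ≡.trans (♯-cong A₀⊆ λ { (here e) → ∈-resp (G.sym e) t₀∈A₀ }) (♯-singleton t₀)
        multiples : ∀ j → j ⋆ˢ A₀ ⊆ j · t₀ ∷ []
        multiples zero    x∈ = x∈
        multiples (suc j) x∈ with ∈-⊞⁻ x∈
        ... | s , w , s∈ , w∈ , x≈ with A₀⊆ s∈ | multiples j w∈
        ...   | here s≈ | here w≈ = here (G.trans x≈ (G.∙-cong s≈ w≈))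
        multiples⁻ : ∀ j → j · t₀ ∈ j ⋆ˢ A₀
        multiples⁻ zero    = here G.refl
        multiples⁻ (suc j) = ∈-⊞⁺ t₀∈A₀ (multiples⁻ j) G.refl
        ♯-multiple : ♯ (k ⋆ˢ A₀) ≡ 1
        ♯-multiple = ≡.trans (♯-cong (multiples k) λ { (here e) → ∈-resp (G.sym e) (multiples⁻ k) })
            (♯-singleton (k · t₀))

    -- The case of a nonzero hyper-atom.

    module Nontrivial {q} (q∈ : q ∈ Q) (q≉0 : ¬ q ≈ 0#) (n : ℕ) (aperiodic : Aperiodicˢ ((2 ℕ.+ n) ⋆ˢ A))
      (size : ♯ ((2 ℕ.+ n) ⋆ˢ A) ℕ.+ (2 ℕ.+ n) ≡ (2 ℕ.+ n) ℕ.* ♯ A ℕ.+ 1) where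

      private
        k = 2 ℕ.+ n

        A₀-bound : k ℕ.* ♯ A₀ ℕ.+ 1 ℕ.≤ ♯ (k ⋆ˢ A₀) ℕ.+ k
        A₀-bound = Kneser.kneser em G n (♯ A₀) ℕₚ.≤-refl (∈-∩⁺ t₀∈ (∈-shift⁺ (diff-refl isQ t₀)))
          (⋆-S₀-aperiodic fragment q∈ q≉0 n aperiodic)

        saturation : ♯ (k ⋆ˢ A ⊞ Q) ℕ.+ ♯ (k ⋆ˢ A₀) ℕ.≤ ♯ (k ⋆ˢ A) ℕ.+ ♯ Q
        saturation = ♯-saturation fragment q∈ q≉0 n aperiodic

        without-A₀ : k ℕ.* ♯ A ℕ.+ k ℕ.* ♯ Q ℕ.≤ k ℕ.* ♯ A₀ ℕ.+ k ℕ.* ♯ (Q ⊞ A)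
        without-A₀ = ≡.subst₂ ℕ._≤_ (ℕₚ.*-distribˡ-+ k (♯ A) (♯ Q)) (ℕₚ.*-distribˡ-+ k (♯ A₀) (♯ (Q ⊞ A)))
          (ℕₚ.*-monoʳ-≤ k (♯-without-S₀ fragment))

        climb : k ℕ.* ♯ (Q ⊞ A) ℕ.+ ♯ Q ℕ.≤ ♯ (k ⋆ˢ A ⊞ Q) ℕ.+ k ℕ.* ♯ Q
        climb = ⋆-growthⁿ fragment q∈ q≉0 n aperiodic k ℕₚ.≤-refl

      -- `saturation`, `climb`, `A₀-bound` and `without-A₀` add up to `∣kA∣ ≥ k∣A∣ - k + 1`, which
      -- `size` makes an equality. Leaving one of them out of the sum gives its reverse: here
      -- `without-A₀`, with the factor `k` cancelled.
      tight : ♯ A₀ ℕ.+ ♯ (Q ⊞ A) ℕ.≤ ♯ A ℕ.+ ♯ Q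
      tight = ℕₚ.*-cancelˡ-≤ k (≡.subst₂ ℕ._≤_
        (≡.sym (ℕₚ.*-distribˡ-+ k (♯ A₀) (♯ (Q ⊞ A)))) (≡.sym (ℕₚ.*-distribˡ-+ k (♯ A) (♯ Q)))
        (linarith 9 (λ ka kq kz kw m z u q k →
            u :+ z :≤ m :+ q ∷ kw :+ q :≤ u :+ kq ∷ kz :+ con 1 :≤ z :+ k ∷ m :+ k :≤ ka :+ con 1 ∷ []
                ⊩ kz :+ kw :≤ ka :+ kq) _
          (k ℕ.* ♯ A) (k ℕ.* ♯ Q) (k ℕ.* ♯ A₀) (k ℕ.* ♯ (Q ⊞ A)) (♯ (k ⋆ˢ A)) (♯ (k ⋆ˢ A₀))
              (♯ (k ⋆ˢ A ⊞ Q)) (♯ Q) k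
          saturation climb A₀-bound (ℕₚ.≤-reflexive size)))

      A₀-size : ♯ (k ⋆ˢ A₀) ℕ.+ k ≡ k ℕ.* ♯ A₀ ℕ.+ 1
      A₀-size = ℕₚ.≤-antisym
        (linarith 9 (λ ka kq kz kw m z u q k →
            u :+ z :≤ m :+ q ∷ kw :+ q :≤ u :+ kq ∷ ka :+ kq :≤ kz :+ kw ∷ m :+ k :≤ ka :+ con 1 ∷ []
                ⊩ z :+ k :≤ kz :+ con 1) _
          (k ℕ.* ♯ A) (k ℕ.* ♯ Q) (k ℕ.* ♯ A₀) (k ℕ.* ♯ (Q ⊞ A)) (♯ (k ⋆ˢ A)) (♯ (k ⋆ˢ A₀))
              (♯ (k ⋆ˢ A ⊞ Q)) (♯ Q) k
          saturation climb without-A₀ (ℕₚ.≤-reflexive size))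
        A₀-bound

      -- Divided by `∣H∣` this is `∣2φ(S)∣ ≤ 2∣φ(S)∣ - 1`. The bound on the `k`-fold sum is the
      -- reverse of `climb`, and `increments` brings it down to the double.
      saturated-double : ♯ (2 ⋆ˢ A ⊞ Q) ℕ.+ ♯ Q ℕ.≤ ♯ (Q ⊞ A) ℕ.+ ♯ (Q ⊞ A)
      saturated-double = increments (λ j → ♯ (j ⋆ˢ A ⊞ Q)) n (⋆-growth fragment q∈ q≉0 n aperiodic)
        (linarith 9 (λ ka kq kz kw m z u q k →
            u :+ z :≤ m :+ q ∷ kz :+ con 1 :≤ z :+ k ∷ ka :+ kq :≤ kz :+ kw ∷ m :+ k :≤ ka :+ con 1 ∷ []
                ⊩ u :+ kq :≤ kw :+ q) _
          (k ℕ.* ♯ A) (k ℕ.* ♯ Q) (k ℕ.* ♯ A₀) (k ℕ.* ♯ (Q ⊞ A)) (♯ (k ⋆ˢ A)) (♯ (k ⋆ˢ A₀))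
              (♯ (k ⋆ˢ A ⊞ Q)) (♯ Q) k
          saturation A₀-bound without-A₀ (ℕₚ.≤-reflexive size))

      saturated-step : ∀ j → j ℕ.< k → ♯ (j ⋆ˢ A ⊞ Q) ℕ.+ ♯ (Q ⊞ A) ℕ.≤ ♯ (suc j ⋆ˢ A ⊞ Q) ℕ.+ ♯ Q
      saturated-step = ⋆-growth fragment q∈ q≉0 n aperiodic

      same-coset : ∀ {s w t t′} → s ∈ A → w ∈ suc n ⋆ˢ A → t ∈ A₀ → t′ ∈ suc n ⋆ˢ A₀ → (s + w) -
          (t + t′) ∈ Q → s - t ∈ Q
      same-coset s∈ w∈ t∈ t′∈ p = diff isQ (∈-shift⁻ (proj₂ (∈-∩⁻ s∈A₀)))
          (diff-sym isQ (∈-shift⁻ (proj₂ (∈-∩⁻ t∈))))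
        where
        s∈A₀ = proj₁ (unique-representation fragment q∈ q≉0 n aperiodic s∈ w∈ (∈-⊞⁺ t∈ t′∈ G.refl) p)

      -- The image in the quotient for `k ≥ 3`.

      module QuotientProgression (1≤n : 1 ℕ.≤ n) where
        open Quotient G H H.isSubgroup
        open Cosets em G H.isSubgroup H≐Q
        private
          module Q/ = Subsets G/H
          module T/ = Transfer em G/H
          module G/H = AbelianGroup G/H

          1≤Q : 1 ℕ.≤ ♯ Q
          1≤Q = ♯≥1 (0-mem isQ)

          cancel : ∀ {x y} → x ℕ.* ♯ Q ℕ.≤ y ℕ.* ♯ Q → x ℕ.≤ y
          cancel {x} {y} = ℕₚ.*-cancelʳ-≤ x y (♯ Q) {{ℕ.>-nonZero 1≤Q}}

          ♯-Q⊞A : ♯ (Q ⊞ A) ≡ B.♯ A ℕ.* ♯ Q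
          ♯-Q⊞A = ≡.trans (♯-⊞-comm Q A) (♯-saturation-count A)

          double⇒ : ∀ {x} → x B.∈ 2 ⋆ˢ A → x B.∈ A B.⊞ A
          double⇒ x∈ = saturated⇒⊞ᴴ (rearrange (∈ᴴ⇒saturated x∈))
            where
            rearrange : 2 ⋆ˢ A ⊞ Q ⊆ (A ⊞ Q) ⊞ A
            rearrange y∈ = ⊞-assoc⁻ (⊞-mono id ⊞-comm (⊞-assoc (⊞-mono double⊆⊞ id y∈)))

          ⇒double : ∀ {x} → x B.∈ A B.⊞ A → x B.∈ 2 ⋆ˢ A
          ⇒double x∈ = saturated⇒∈ᴴ (rearrange (⊞ᴴ⇒saturated x∈))
            where
            rearrange : (A ⊞ Q) ⊞ A ⊆ 2 ⋆ˢ A ⊞ Q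
            rearrange y∈ = ⊞-mono ⊞⊆double id (⊞-assoc⁻ (⊞-mono id ⊞-comm (⊞-assoc y∈)))

          small-double : suc (B.♯ (A B.⊞ A)) ℕ.≤ B.♯ A ℕ.+ B.♯ A
          small-double = cancel (≡.subst₂ ℕ._≤_
            (≡.trans (≡.cong (ℕ._+ ♯ Q)
                (≡.trans (♯-saturation-count (2 ⋆ˢ A)) (≡.cong (ℕ._* ♯ Q) (B.♯-cong double⇒ ⇒double))))
              (ℕₚ.+-comm _ (♯ Q)))
            (≡.trans (≡.cong₂ ℕ._+_ ♯-Q⊞A ♯-Q⊞A) (≡.sym (ℕₚ.*-distribʳ-+ (♯ Q) (B.♯ A) (B.♯ A))))
            saturated-double)

          triple-growth : B.♯ (2 ⋆ˢ A) ℕ.+ B.♯ A ℕ.≤ suc (B.♯ (3 ⋆ˢ A))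
          triple-growth = cancel (≡.subst₂ ℕ._≤_
            (≡.trans (≡.cong₂ ℕ._+_ (♯-saturation-count (2 ⋆ˢ A)) ♯-Q⊞A)
                (≡.sym (ℕₚ.*-distribʳ-+ (♯ Q) (B.♯ (2 ⋆ˢ A)) (B.♯ A))))
            (≡.trans (≡.cong (ℕ._+ ♯ Q) (♯-saturation-count (3 ⋆ˢ A))) (ℕₚ.+-comm _ (♯ Q)))
            (saturated-step 2 (s≤s (s≤s 1≤n))))

          -- The preimage `K′` of a violating `K` satisfies `∣K′ + A∣ - ∣K′∣ ≤ ∣Q + A∣ - ∣Q∣` after
          -- multiplication by `∣Q∣`. Maximality puts `K′` inside `Q`, so `K` is zero in the
          -- quotient.
          subgroups : ∀ {K x y} → Q/.IsSubgroup (B._∈ K) → x B.∈ K → ¬ x Q/.≈ 0# → y B.∉ K B.⊞ A →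
                      B.♯ K ℕ.+ B.♯ A ℕ.≤ B.♯ (K B.⊞ A)
          subgroups {K} {x} isK x∈ x≉0 y∉ = by-contradiction λ K>A → x≉0 (x∈H K>A)
            where
            module K = Q/.IsSubgroup isK
            K′ = K ⊞ Q
            isK′ : IsSubgroup (_∈ K′)
            isK′ = record
              { resp       = ∈-resp
              ; 0-mem      = ∈ᴴ⇒saturated K.0-mem
              ; +-closed   = λ x∈ y∈ → ∈ᴴ⇒saturated (K.+-closed (saturated⇒∈ᴴ x∈) (saturated⇒∈ᴴ y∈))
              ; neg-closed = λ x∈ → ∈ᴴ⇒saturated (K.neg-closed (saturated⇒∈ᴴ x∈))
              }
            Q⊆K′ : Q ⊆ K′
            Q⊆K′ {g} g∈ = ∈ᴴ⇒saturated (K.resp {0#} {g} (resp H.isSubgroup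
              (solve 1 (λ g → ⊝ g ⊜ 𝟘 ⊖ g) refl g) (neg-closed H.isSubgroup (proj₂ H≐Q g∈))) K.0-mem)
            K′-small : ¬ (B.♯ K ℕ.+ B.♯ A ℕ.≤ B.♯ (K B.⊞ A)) → ♯ (K′ ⊞ A) ℕ.+ ♯ Q ℕ.≤ ♯ (Q ⊞ A) ℕ.+ ♯ K′
            K′-small K>A = ≡.subst₂ ℕ._≤_
              (≡.trans (ℕₚ.+-comm (♯ Q) _) (≡.cong (ℕ._+ ♯ Q) (≡.sym (♯-⊞ᴴ K A))))
              (≡.trans (ℕₚ.*-distribʳ-+ (♯ Q) (B.♯ K) (B.♯ A)) (≡.trans (ℕₚ.+-comm (B.♯ K ℕ.* ♯ Q) _)
                (≡.cong₂ ℕ._+_ (≡.sym ♯-Q⊞A) (≡.sym (♯-saturation-count K)))))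
              (ℕₚ.*-monoˡ-≤ (♯ Q) (ℕₚ.≰⇒> K>A))
            x∈H : ¬ (B.♯ K ℕ.+ B.♯ A ℕ.≤ B.♯ (K B.⊞ A)) → x Q/.≈ 0#
            x∈H K>A = resp H.isSubgroup (solve 1 (λ x → x ⊜ x ⊖ 𝟘) refl x) (proj₂ H≐Q
              (maximal-fragment isK′ Q⊆K′ (y∉ ∘ saturated⇒⊞ᴴ) (K′-small K>A) (∈ᴴ⇒saturated x∈)))

          generates : ∀ {K : Subset} → Q/.IsSubgroup K → ∀ {t} → (∀ {s} → s B.∈ A → K (s - t)) → ∀ x → K x
          generates isK A⊆ = generating gens (record
            { resp       = λ e → K.resp (≈⇒≈ᴴ e)
            ; 0-mem      = K.0-mem
            ; +-closed   = K.+-closed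
            ; neg-closed = K.neg-closed
            }) λ s∈ → A⊆ (∈⇒∈ᴴ s∈)
            where module K = Q/.IsSubgroup isK

          -- The two missed elements for `vosperian` are taken from the triple sum, which exceeds
          -- the double by at least `∣φ(S)∣ - 1`. The step from 2 to 3 is covered by
          -- `saturated-step` because `k ≥ 3`.
          outside : 3 ℕ.≤ B.♯ A → 2 ℕ.≤ B.♯ (3 ⋆ˢ A B.∖ 2 ⋆ˢ A)
          outside 3≤A = linarith 5 (λ a d t i o → d :+ a :≤ con 1 :+ t ∷ t :≤ i :+ o ∷ i :≤ d ∷ con 3 :≤ a ∷
              [] ⊩ con 2 :≤ o) _
            (B.♯ A) (B.♯ (2 ⋆ˢ A)) (B.♯ (3 ⋆ˢ A)) (B.♯ (3 ⋆ˢ A B.∩ 2 ⋆ˢ A)) (B.♯ (3 ⋆ˢ A B.∖ 2 ⋆ˢ A))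
            triple-growth (ℕₚ.≤-reflexive (B.♯-∩+∖ (3 ⋆ˢ A) (2 ⋆ˢ A))) (B.♯-mono (proj₂ ∘ B.∈-∩⁻)) 3≤A

          vosperian : ∀ {y z} → y B.∉ 2 ⋆ˢ A → z B.∉ 2 ⋆ˢ A → ¬ y Q/.≈ z → Vosper.Vosperian em G/H A
          vosperian {y} {z} y∉ z∉ y≉z = record
            { small     = small-double
            ; subgroups = subgroups
            ; generates = λ isK _ → generates isK
            ; y         = y
            ; z         = z
            ; y∉        = λ p → y∉ (⇒double p)
            ; z∉        = λ p → z∉ (⇒double p)
            ; y≉z       = y≉z
            }

          two-outside : 2 ℕ.≤ B.♯ (3 ⋆ˢ A B.∖ 2 ⋆ˢ A) → ∃₂ λ y z → y B.∉ 2 ⋆ˢ A × z B.∉ 2 ⋆ˢ A × ¬ y Q/.≈ z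
          two-outside 2≤ with B.♯≥1⁻ (ℕₚ.≤-trans (s≤s z≤n) 2≤)
          ... | y , y∈ with B.♯≥2⁻ 2≤ y
          ...   | z , z∈ , z≉y = y , z , proj₂ (B.∈-∖⁻ y∈) , proj₂ (B.∈-∖⁻ z∈) , λ e → z≉y (G/H.sym {y} {z} e)

          large-case : 3 ℕ.≤ B.♯ A → Q/.IsArithmeticProgression (B._∈ A)
          large-case 3≤A = from (two-outside (outside 3≤A))
            where
            from : (∃₂ λ y z → y B.∉ 2 ⋆ˢ A × z B.∉ 2 ⋆ˢ A × ¬ y Q/.≈ z) → Q/.IsArithmeticProgression (B._∈ A)
            from (y , z , y∉ , z∉ , y≉z) = Vosper.vosper em G/H (vosperian y∉ z∉ y≉z) 3≤A

        progression : Q/.IsArithmeticProgression φ[ S ]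
        progression = T/.progression-resp φS≐A (by-size em)
          where
          φS≐A : φ[ S ] ≐ (B._∈ A)
          φS≐A = (λ {x} (s , s∈ , x~s) → B.∈-resp {A} (G/H.sym {x} {s} x~s) (∈⇒∈ᴴ (proj₁ S≐A s∈))) , from
            where
            from : ∀ {x} → x B.∈ A → φ[ S ] x
            from x∈ with ∈-⊞⁻ (∈ᴴ⇒saturated x∈)
            ... | s , q , s∈ , q∈ , x≈ = s , proj₂ S≐A s∈ ,
              resp H.isSubgroup (G.trans (solve 2 (λ s q → q ⊜ (s ⊕ q) ⊖ s) refl s q)
                  (G.∙-congʳ (G.sym x≈))) (proj₂ H≐Q q∈)
          by-size : Dec (3 ℕ.≤ B.♯ A) → Q/.IsArithmeticProgression (B._∈ A)
          by-size (yes 3≤A) = large-case 3≤A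
          by-size (no  3≰A) = T/.♯≤2⇒progression (∈⇒∈ᴴ a∈) (ℕ.s≤s⁻¹ (ℕₚ.≰⇒> 3≰A))

    open Quotient G H H.isSubgroup
    private module Q/ = Subsets G/H

    -- 2S contains every coset of H that it meets except 2 φ(S₀), which is therefore a sum
    -- of two elements of φ(S) in only one way.
    unique-difference : ∀ {q} → q ∈ Q → ¬ q ≈ 0# → Aperiodicˢ (2 ⋆ˢ A) → ♯ (2 ⋆ˢ A) ℕ.+ 2 ≡ 2 ℕ.* ♯ A ℕ.+ 1 →
      ((φ[ S ] Q/.⊝ φ[ S₀ ]) ∩ᵖ (φ[ S₀ ] Q/.⊝ φ[ S ])) ≐ (λ y → y Q/.≈ φ 0#)
    unique-difference q∈ q≉0 aperiodic size = to , from
      where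
      module N = Nontrivial q∈ q≉0 0 aperiodic size
      ∈Q : ∀ {x y} → x Q/.≈ y → x - y ∈ Q
      ∈Q = proj₁ H≐Q
      to : ∀ {y} → ((φ[ S ] Q/.⊝ φ[ S₀ ]) ∩ᵖ (φ[ S₀ ] Q/.⊝ φ[ S ])) y → y Q/.≈ φ 0#
      to {y} ((a , b , (s , s∈ , a~s) , (t , t∈ , b~t) , y~a-b) ,
          (b′ , a′ , (t′ , t′∈ , b′~t′) , (s′ , s′∈ , a′~s′) , y~b′-a′)) =
        proj₂ H≐Q (∈-resp (solve 5 (λ y a b s t → (((y ⊖ (a ⊖ b)) ⊕ (a ⊖ s)) ⊕ (s ⊖ t)) ⊖ (b ⊖ t) ⊜ y ⊖ 𝟘)
            refl y a b s t)
          (+-closed isQ (+-closed isQ (+-closed isQ (∈Q y~a-b) (∈Q a~s)) s~t) (neg-closed isQ (∈Q b~t))))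
        where
        s~t : s - t ∈ Q
        -- Modulo `H` both `s - t` and `t′ - s′` equal `y`, so `s + s′` lies in the coset of
        -- `t + t′`, whose representation is unique.
        s~t = N.same-coset (proj₁ S≐A s∈) (∈-⊞⁺ (proj₁ S≐A s′∈) (here G.refl) (G.sym (G.identityʳ s′)))
          (proj₁ S₀≐A₀ t∈) (∈-⊞⁺ (proj₁ S₀≐A₀ t′∈) (here G.refl) (G.sym (G.identityʳ t′)))
          (∈-resp (G.trans (G.⁻¹-cong
              (G.∙-cong (solve 5 (λ y a b s t → ((y ⊖ (a ⊖ b)) ⊕ (a ⊖ s)) ⊖ (b ⊖ t) ⊜ (y ⊖ s) ⊕ t)
                  refl y a b s t)
                (G.⁻¹-cong (solve 5 (λ y a b s t → ((y ⊖ (b ⊖ a)) ⊖ (a ⊖ s)) ⊕ (b ⊖ t) ⊜ (y ⊖ t) ⊕ s) refl y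
                    a′ b′ s′ t′))))
              (solve 5 (λ y s t s′ t′ → ⊝ (((y ⊖ s) ⊕ t) ⊖ ((y ⊖ t′) ⊕ s′)) ⊜ (s ⊕ s′) ⊖ (t ⊕ t′)) refl
                  y s t s′ t′))
            (neg-closed isQ (+-closed isQ
              (+-closed isQ (+-closed isQ (∈Q y~a-b) (∈Q a~s)) (neg-closed isQ (∈Q b~t)))
              (neg-closed isQ (+-closed isQ (+-closed isQ (∈Q y~b′-a′) (neg-closed isQ (∈Q a′~s′)))
                  (∈Q b′~t′))))))
      from : ∀ {y} → y Q/.≈ φ 0# → ((φ[ S ] Q/.⊝ φ[ S₀ ]) ∩ᵖ (φ[ S₀ ] Q/.⊝ φ[ S ])) y
      from {y} y~0 = (t₀ , t₀ , φS , φS₀ , y~) , (t₀ , t₀ , φS₀ , φS , y~)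
        where
        t₀∈S₀ = proj₂ (proj₁ (proj₁ smallest))
        φS = t₀ , proj₂ S≐A t₀∈ , proj₂ H≐Q (diff-refl isQ t₀)
        φS₀ = t₀ , t₀∈S₀ , proj₂ H≐Q (diff-refl isQ t₀)
        y~ : y Q/.≈ t₀ - t₀
        y~ = resp H.isSubgroup (G.∙-congˡ (G.⁻¹-cong (G.sym (G.inverseʳ t₀)))) y~0

    image-structure : ∀ {q} → q ∈ Q → ¬ q ≈ 0# → ∀ n → Aperiodicˢ ((2 ℕ.+ n) ⋆ˢ A) →
      ♯ ((2 ℕ.+ n) ⋆ˢ A) ℕ.+ (2 ℕ.+ n) ≡ (2 ℕ.+ n) ℕ.* ♯ A ℕ.+ 1 →
      Q/.IsArithmeticProgression φ[ S ] ⊎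
      (2 ℕ.+ n ≡ 2 × ((φ[ S ] Q/.⊝ φ[ S₀ ]) ∩ᵖ (φ[ S₀ ] Q/.⊝ φ[ S ])) ≐ (λ y → y Q/.≈ φ 0#))
    image-structure q∈ q≉0 zero    aperiodic size = inj₂ (refl , unique-difference q∈ q≉0 aperiodic size)
    image-structure q∈ q≉0 (suc n) aperiodic size =
      inj₁ (Nontrivial.QuotientProgression.progression q∈ q≉0 (suc n) aperiodic size (s≤s z≤n))

    -- Assembly of (a), (b) and (c).

    module Result (¬progression : ¬ IsArithmeticProgression S) (n : ℕ) (aperiodic : Aperiodicˢ ((2 ℕ.+ n) ⋆ˢ A))
      (size : ♯ ((2 ℕ.+ n) ⋆ˢ A) ℕ.+ (2 ℕ.+ n) ≡ (2 ℕ.+ n) ℕ.* ♯ A ℕ.+ 1) where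

      private
        k = 2 ℕ.+ n

        Nonzero : Set _
        Nonzero = ∃ λ q → q ∈ Q × ¬ q ≈ 0#

        module T (¬nonzero : ¬ Nonzero) where
          trivial : ∀ {q} → q ∈ Q → q ≈ 0#
          trivial q∈ = by-contradiction λ q≉0 → ¬nonzero (_ , q∈ , q≉0)
          open Trivial trivial gens ¬progression n aperiodic size public

        module N (nonzero : Nonzero) =
          Nontrivial (proj₁ (proj₂ nonzero)) (proj₂ (proj₂ nonzero)) n aperiodic size

      -- By contraposition: with `H` zero, `whole-size` gives the group exactly one element more
      -- than `2 ⋆ S`.
      nontrivial : ¬ (∃ λ g → HasSize whole g × HasSize (2 ⋆ S) (g ℕ.∸ 1)) → ∃ λ h → HasSize H h × 2 ℕ.≤ h
      nontrivial ¬deficient with em {P = Nonzero}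
      ... | yes (q , q∈ , q≉0) = ♯ Q , hasSize⁺ H≐Q , ♯≥2 q∈ (0-mem isQ) q≉0
      ... | no ¬nonzero = ⊥-elim (¬deficient (suc (♯ (A ⊞ A)) , T.whole-size ¬nonzero ,
        ≡.subst (HasSize (2 ⋆ S)) (♯-double A) (hasSize⁺ (⋆≐⋆ˢ 2 S≐A))))

      remainder-periodic : ((S ∖ᵖ S₀) ⊕ˢ H) ≐ (S ∖ᵖ S₀)
      remainder-periodic with em {P = Nonzero}
      ... | yes nonzero    = periodic (N.tight nonzero)
      ... | no  ¬nonzero   = periodic (trivial-tight (T.trivial ¬nonzero))

      component-size : ∃ λ m → HasSize S₀ m × HasSize (k ⋆ S₀) (k ℕ.* m ℕ.∸ k ℕ.+ 1)
      component-size = ♯ A₀ , hasSize⁺ S₀≐A₀ , ≡.subst (HasSize (k ⋆ S₀))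
        (truncated-size⁻ k (♯ A₀) (♯≥1 (proj₁ S₀≐A₀ (proj₂ (proj₁ (proj₁ smallest))))) (A₀-size em))
            (hasSize⁺ (⋆≐⋆ˢ k S₀≐A₀))
        where
        A₀-size : Dec Nonzero → ♯ (k ⋆ˢ A₀) ℕ.+ k ≡ k ℕ.* ♯ A₀ ℕ.+ 1
        A₀-size (yes nonzero)  = N.A₀-size nonzero
        A₀-size (no  ¬nonzero) = trivial-size (T.trivial ¬nonzero) k

      quotient-image : Q/.IsArithmeticProgression φ[ S ] ⊎ (k ≡ 2 × ((∃ λ x → S ≐ (x -ˢ ∁ S)) ⊎
        ((φ[ S ] Q/.⊝ φ[ S₀ ]) ∩ᵖ (φ[ S₀ ] Q/.⊝ φ[ S ])) ≐ (λ y → y Q/.≈ φ 0#)))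
      quotient-image with em {P = Nonzero}
      ... | yes (q , q∈ , q≉0) = map₂ (λ (k≡2 , unique) → k≡2 , inj₂ unique)
          (image-structure q∈ q≉0 n aperiodic size)
      -- With `H` zero, `n≡0` gives `k = 2`, and the centre of the reflection is the element `y₀`
      -- missed by `A + A`.
      ... | no ¬nonzero = inj₂ (≡.cong (2 ℕ.+_) n≡0 , inj₁ (y₀ , to , from))
        where
        open T ¬nonzero
        to : ∀ {x} → S x → (y₀ -ˢ ∁ S) x
        to {x} x∈ = y₀ - x , (λ y-x∈ → y₀∉
            (∈-⊞⁺ (proj₁ S≐A x∈) (proj₁ S≐A y-x∈) (solve 2 (λ x y → y ⊜ x ⊕ (y ⊖ x)) refl x y₀))) ,
          solve 2 (λ x y → x ⊜ y ⊖ (y ⊖ x)) refl x y₀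
        from : ∀ {x} → (y₀ -ˢ ∁ S) x → S x
        from (s , s∉ , x≈) = proj₂ S≐A
            ([ (λ s∈ → ⊥-elim (s∉ (proj₂ S≐A s∈))) , ∈-resp (G.sym x≈) ]′ (reflection s))

open import Relation.Unary using (Satisfiable; _∩_; _∖_)

theorem17 :
  (∀ {a} → ExcludedMiddle a) →
  ∀ {c ℓ} (k : ℕ) → 2 ℕ.≤ k →
  (G : AbelianGroup c ℓ) →
  let open Subsets G in
  (S : Subset) (n : ℕ) →
  HasSize S n → Satisfiable S →
  Generates (S ⊝ S) →
  ¬ IsArithmeticProgression S →
  Aperiodic (k ⋆ S) →
  HasSize (k ⋆ S) (k ℕ.* n ℕ.∸ k ℕ.+ 1) →
  (H : Subset) (hyperAtom : IsHyperAtom S H) →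
  (S₀ : Subset) → IsSmallestComponent H S S₀ →
  let open Quotient G H (IsHyperAtom.isSubgroup hyperAtom)
      module Q = Subsets G/H in
  (¬ (∃ λ g → HasSize whole g × HasSize (2 ⋆ S) (g ℕ.∸ 1)) →
     ∃ λ h → HasSize H h × 2 ℕ.≤ h)
  ×
  (((S ∖ S₀) ⊕ H) ≐ (S ∖ S₀) ×
   ∃ λ m → HasSize S₀ m × HasSize (k ⋆ S₀) (k ℕ.* m ℕ.∸ k ℕ.+ 1))
  ×
  (Q.IsArithmeticProgression φ[ S ]
   ⊎
   (k ≡ 2 ×
    ((∃ λ x → S ≐ (x -ˢ ∁ S))
     ⊎
     ((φ[ S ] Q.⊝ φ[ S₀ ]) ∩ (φ[ S₀ ] Q.⊝ φ[ S ])) ≐ (λ y → y Q.≈ φ 0#))))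
theorem17 em (suc (suc n)) (s≤s (s≤s z≤n)) G S m (A , A! , ∣A∣≡m , S≐A) (_ , a∈S) generates ¬progression
    aperiodic kS-size H hyperAtom S₀ smallest = R.nontrivial , (R.remainder-periodic , R.component-size) , R.quotient-image
  where
  open Sumsets em G using (♯; ♯≥1; ♯-unique; _⋆ˢ_)
  open Transfer em G
  k = 2 ℕ.+ n
  ♯A≡m = ≡.trans (♯-unique A!) ∣A∣≡m
  a∈A = proj₁ S≐A a∈S
  kS≐kA = ⋆≐⋆ˢ k S≐A
  size : ♯ (k ⋆ˢ A) ℕ.+ k ≡ k ℕ.* ♯ A ℕ.+ 1
  size = truncated-size k (♯ A) (♯≥1 a∈A)
    (≡.subst (λ m → ♯ (k ⋆ˢ A) ≡ k ℕ.* m ℕ.∸ k ℕ.+ 1) (≡.sym ♯A≡m) (hasSize⁻ kS≐kA kS-size))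
  H-list = finite-fragment (Subsets.IsHyperAtom.isFragment hyperAtom)
  module R = HyperAtoms.Component.Result em G S≐A hyperAtom (proj₂ H-list) a∈A generates smallest
    ¬progression n (aperiodic⁻ kS≐kA aperiodic) size
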